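{- There exists an $O(n^4)$-time algorithm that, given a permutation graph $G$ on $n$ vertices, computes a strong edge coloring of $G$ using the minimum number $s\chi'(G)$ of colors.
   Context: A permutation diagram on $n$ points: take two horizontal lines $L_1,L_2$; on each line $L_i$ place the points $1,\dots,n$ in some linear order; for each $k$ connect the two points labeled $k$ by a straight line segment. A graph is a permutation graph if it is the intersection graph of the line segments of some permutation diagram. A strong edge coloring of $G$ is a proper edge coloring such that no edge is adjacent to two edges of the same color (equivalently, each color class is an induced matching: no two of its edges share an endpoint or are joined by an edge of $G$). $s\chi'(G)$ denotes the minimum number of colors of a strong edge coloring. -}

module Defs where

open import Data.Bool using (Bool; T; if_then_else_)
open import Data.Fin as Fin using (Fin; toℕ; fromℕ<; combine; remQuot)
open import Data.Nat using (ℕ; _+_; _*_; _∸_; _^_; _≤_; _<_; _≡ᵇ_; _<?_)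
open import Data.Product using (∃; ∃₂; _×_; _,_; uncurry)
open import Data.Rational as ℚ using (ℚ; 0ℚ; 1ℚ)
open import Data.Sum using (_⊎_)
open import Data.Unit using (⊤)
open import Function.Bundles using (_⇔_)
open import Function.Definitions using (Injective)
open import Relation.Nullary using (¬_; yes; no)
open import Relation.Binary.PropositionalEquality using (_≡_; _≢_)

record Graph (n : ℕ) : Set where
  field
    adj    : Fin n → Fin n → Bool
    sym    : ∀ u v → adj u v ≡ adj v u
    irrefl : ∀ u → ¬ T (adj u u)

  Adj : Fin n → Fin n → Set
  Adj u v = T (adj u v)

-- An unordered edge is represented by its endpoints in increasing order.
-- The proofs are irrelevant, so edges are equal iff their endpoints are.
record Edge {n : ℕ} (G : Graph n) : Set where
  constructor edge
  field
    lo hi     : Fin n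
    .lo<hi    : lo Fin.< hi
    .adjacent : Graph.Adj G lo hi

-- The lines are L₁ = { y = 0 } and L₂ = { y = 1 }; the linear order of the
-- labels on Lᵢ is given by the pairwise distinct abscissae of the points.
record PermutationDiagram (n : ℕ) : Set where
  field
    x₁ x₂        : Fin n → ℚ
    x₁-injective : Injective _≡_ _≡_ x₁
    x₂-injective : Injective _≡_ _≡_ x₂

  -- The convex combination of (x₁ k , 0) and (x₂ k , 1) with weight t.
  point : Fin n → ℚ → ℚ × ℚ
  point k t = ((1ℚ ℚ.- t) ℚ.* x₁ k ℚ.+ t ℚ.* x₂ k , t)

  _∈Segment_ : ℚ × ℚ → Fin n → Set
  p ∈Segment k = ∃ λ t → 0ℚ ℚ.≤ t × t ℚ.≤ 1ℚ × p ≡ point k t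

  -- Rational points suffice: two segments with rational endpoints on L₁ and
  -- L₂ that meet in the real plane also meet in a rational point.
  Intersect : Fin n → Fin n → Set
  Intersect k l = ∃ λ p → p ∈Segment k × p ∈Segment l

IsPermutationGraph : ∀ {n} → Graph n → Set
IsPermutationGraph {n} G =
  ∃ λ (D : PermutationDiagram n) → ∀ u v →
    Graph.Adj G u v ⇔ (u ≢ v × PermutationDiagram.Intersect D u v)

module _ {n : ℕ} {G : Graph n} where

  _IsEndOf_ : Fin n → Edge G → Set
  v IsEndOf e = v ≡ Edge.lo e ⊎ v ≡ Edge.hi e

  AdjacentEdges : Edge G → Edge G → Set
  AdjacentEdges e f = e ≢ f × ∃ λ v → v IsEndOf e × v IsEndOf f

  IsProperEdgeColouring : ∀ {k} → (Edge G → Fin k) → Set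
  IsProperEdgeColouring φ = ∀ e f → AdjacentEdges e f → φ e ≢ φ f

  IsStrongEdgeColouring : ∀ {k} → (Edge G → Fin k) → Set
  IsStrongEdgeColouring φ =
    IsProperEdgeColouring φ ×
    (∀ e f g → AdjacentEdges e f → AdjacentEdges e g → f ≢ g → φ f ≢ φ g)

StrongEdgeColourable : ∀ {n} → Graph n → ℕ → Set
StrongEdgeColourable G k = ∃ λ (φ : Edge G → Fin k) → IsStrongEdgeColouring φ

IsStrongChromaticIndex : ∀ {n} → Graph n → ℕ → Set
IsStrongChromaticIndex G k =
  StrongEdgeColourable G k × (∀ j → StrongEdgeColourable G j → k ≤ j)

-- Word RAM programs, as structured code over scalar variables and
-- one-dimensional arrays, both named by numbers.  Names are static, so a
-- given program uses only finitely many of them; interleaving its arrays in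
-- a single memory turns it into ordinary RAM code with constant-factor
-- overhead.

data Expr : Set where
  lit : ℕ → Expr
  var : ℕ → Expr
  arr : ℕ → Expr → Expr
  _⊕_ : Expr → Expr → Expr
  _⊖_ : Expr → Expr → Expr
  _⊗_ : Expr → Expr → Expr

data Command : Set where
  skip    : Command
  setVar  : ℕ → Expr → Command
  setArr  : ℕ → Expr → Expr → Command
  seq     : Command → Command → Command
  ifNZ    : Expr → Command → Command → Command
  whileNZ : Expr → Command → Command

record State : Set where
  constructor state
  field
    vars : ℕ → ℕ
    arrs : ℕ → ℕ → ℕ

open State public

update : {A : Set} → (ℕ → A) → ℕ → A → (ℕ → A)
update f i a j = if i ≡ᵇ j then a else f j

writeVar : State → ℕ → ℕ → State
writeVar σ x a = state (update (vars σ) x a) (arrs σ)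

writeArr : State → ℕ → ℕ → ℕ → State
writeArr σ x i a = state (vars σ) (update (arrs σ) x (update (arrs σ x) i a))

⟦_⟧ : Expr → State → ℕ
⟦ lit a   ⟧ σ = a
⟦ var x   ⟧ σ = vars σ x
⟦ arr x e ⟧ σ = arrs σ x (⟦ e ⟧ σ)
⟦ e ⊕ f   ⟧ σ = ⟦ e ⟧ σ + ⟦ f ⟧ σ
⟦ e ⊖ f   ⟧ σ = ⟦ e ⟧ σ ∸ ⟦ f ⟧ σ
⟦ e ⊗ f   ⟧ σ = ⟦ e ⟧ σ * ⟦ f ⟧ σ

-- Unit cost per literal, memory access and arithmetic operation.
cost : Expr → ℕ
cost (lit a)   = 1
cost (var x)   = 1
cost (arr x e) = 1 + cost e
cost (e ⊕ f)   = 1 + cost e + cost f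
cost (e ⊖ f)   = 1 + cost e + cost f
cost (e ⊗ f)   = 1 + cost e + cost f

-- Every value arising in the evaluation of an expression, including array
-- indices and intermediate results, is a machine word, i.e. is less than W.
mutual
  Fits : ℕ → State → Expr → Set
  Fits W σ e = ⟦ e ⟧ σ < W × SubFits W σ e

  SubFits : ℕ → State → Expr → Set
  SubFits W σ (lit a)   = ⊤
  SubFits W σ (var x)   = ⊤
  SubFits W σ (arr x e) = Fits W σ e
  SubFits W σ (e ⊕ f)   = Fits W σ e × Fits W σ f
  SubFits W σ (e ⊖ f)   = Fits W σ e × Fits W σ f
  SubFits W σ (e ⊗ f)   = Fits W σ e × Fits W σ f

-- Run W c σ τ t: started in σ, the program c halts in τ after t steps.  The
-- semantics is deterministic; a program that overflows a word gets stuck.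
data Run (W : ℕ) : Command → State → State → ℕ → Set where
  run-skip : ∀ {σ} → Run W skip σ σ 1

  run-setVar : ∀ {σ x e} → Fits W σ e →
    Run W (setVar x e) σ (writeVar σ x (⟦ e ⟧ σ)) (1 + cost e)

  run-setArr : ∀ {σ x i e} → Fits W σ i → Fits W σ e →
    Run W (setArr x i e) σ (writeArr σ x (⟦ i ⟧ σ) (⟦ e ⟧ σ))
        (1 + cost i + cost e)

  run-seq : ∀ {σ ρ τ c d s t} → Run W c σ ρ s → Run W d ρ τ t →
    Run W (seq c d) σ τ (s + t)

  run-if-nz : ∀ {σ τ e c d t} → Fits W σ e → ⟦ e ⟧ σ ≢ 0 →
    Run W c σ τ t → Run W (ifNZ e c d) σ τ (1 + cost e + t)

  run-if-z : ∀ {σ τ e c d t} → Fits W σ e → ⟦ e ⟧ σ ≡ 0 →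
    Run W d σ τ t → Run W (ifNZ e c d) σ τ (1 + cost e + t)

  run-while-nz : ∀ {σ ρ τ e c s t} → Fits W σ e → ⟦ e ⟧ σ ≢ 0 →
    Run W c σ ρ s → Run W (whileNZ e c) ρ τ t →
    Run W (whileNZ e c) σ τ (1 + cost e + s + t)

  run-while-z : ∀ {σ e c} → Fits W σ e → ⟦ e ⟧ σ ≡ 0 →
    Run W (whileNZ e c) σ σ (1 + cost e)

-- Words of d · log₂ (2 + n) bits, i.e. of O(log n) bits for constant d.
wordBound : ℕ → ℕ → ℕ
wordBound d n = (2 + n) ^ d

_∈O_ : (ℕ → ℕ) → (ℕ → ℕ) → Set
f ∈O g = ∃₂ λ c n₀ → ∀ n → n₀ ≤ n → f n ≤ c * g n

-- n × n matrices are stored in row-major order: the entry (u , v) is in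
-- cell toℕ (combine u v) = n * toℕ u + toℕ v.

matrixCells : ∀ {n} → (Fin n → Fin n → Bool) → ℕ → ℕ
matrixCells {n} M i with i <? n * n
... | yes i<n² = if uncurry M (remQuot n (fromℕ< i<n²)) then 1 else 0
... | no  _    = 0

-- Variable 0 holds n, array 0 the adjacency matrix; all else is zero.
input : ∀ {n} → Graph n → State
input {n} G = state (update (λ _ → 0) 0 n)
                    (update (λ _ _ → 0) 0 (matrixCells (Graph.adj G)))

-- The colour of the edge uv with u < v is read off entry (u , v) of the
-- matrix in array 1; other entries are ignored.
OutputsColouring : ∀ {n} (G : Graph n) {k : ℕ} → (Edge G → Fin k) → State → Set
OutputsColouring G φ σ =
  ∀ e → arrs σ 1 (toℕ (combine (Edge.lo e) (Edge.hi e))) ≡ toℕ (φ e)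

OutputsOptimalStrongEdgeColouring : ∀ {n} → Graph n → State → Set
OutputsOptimalStrongEdgeColouring G σ =
  ∃ λ k → IsStrongChromaticIndex G k ×
  ∃ λ (φ : Edge G → Fin k) → IsStrongEdgeColouring φ × OutputsColouring G φ σ

{-# OPTIONS --safe #-}

-- Two edges of a permutation graph may share a colour iff one of them lies to
-- the left of the other on both lines, so the strong edge colourings are the
-- partitions of the edges into chains of this order.  Sweep over the edges by
-- their left ends on the first line and give each edge, among the colours whose
-- last edge lies to its left, the one reaching furthest to the right on the
-- second line, or else a new colour.  Exchanging tails of colour classes turns
-- any colouring into this one without using more colours; and scanning all
-- colours for each of the O(n²) edges takes time O(n⁴).
--
-- The positions on the lines are not part of the input, but any realisation of
-- the adjacency matrix will do.  Orient the lexicographically least undecided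
-- pair of vertices, edge or non-edge, propagate this choice to all pairs that it
-- forces, and repeat (Hell and Huang).  By the triangle lemma no monochromatic
-- triangle becomes cyclic, so this orientation, and likewise the one with the
-- edges reversed, is a linear order; these two orders form a diagram.
module Submission where

open import Defs
open import Data.Bool using (Bool; true; false; T; not; _∧_; if_then_else_)
open import Data.Bool.Properties using (T?)
open import Data.Empty using (⊥; ⊥-elim)
open import Data.Fin as Fin using (Fin; toℕ; fromℕ<; combine; remQuot; punchOut)
import Data.Fin.Properties as Fin
open import Data.Nat
open import Data.Nat.Properties
open import Data.Product using (Σ; ∃; ∃₂; _×_; _,_; proj₁; proj₂; uncurry)
open import Data.Rational as ℚ using (ℚ; 0ℚ; 1ℚ)
import Data.Rational.Properties as ℚ
open import Data.Rational.Solver using (module +-*-Solver)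
open import Data.Sum as Sum using (_⊎_; inj₁; inj₂; [_,_]′)
open import Data.Unit using (tt)
open import Function using (_∘_; id)
open import Function.Bundles using (module Equivalence)
open import Relation.Binary.Definitions using (tri<; tri≈; tri>)
open import Relation.Binary.PropositionalEquality
open import Relation.Nullary using (¬_; Dec; yes; no; contradiction; recompute)
open import Relation.Nullary.Decidable using (_×-dec_; _⊎-dec_)

-- Structured programs with bounded loops

-- The promised diagram enters the correctness proof through a single order `_⊏_` of the vertices,
-- by first abscissae. Its task is to show that propagation never forces a pair both ways. The sweep
-- works with ranks in the computed orientation, which may come from a different diagram. Closure
-- under forcing does not make an orientation acyclic: in a complete graph nothing is forced, and
-- three free choices can form a cycle. Lexicographic seeds exclude this for monochromatic
-- triangles. A cyclic triangle with two colours already contradicts forcing. The orientation costs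
-- only n³ steps: a pair enters the queue at most once and is propagated along n third vertices. For
-- this, the search over seeds and the propagation share one loop of 2n² rounds; nested loops with
-- the same worst-case bounds would give n⁵. Optimality is carried through the sweep as an
-- invariant: every valid colouring can be changed, within its colours, into one that agrees with
-- the greedy colouring on all edges treated so far.

infixr 5 _⨾_
infix 6 _≔_

-- For x e a k p runs p with x = 0, 1, ..., ⟦ e ⟧ ∸ 1; the numbers a and k
-- promise that ⟦ e ⟧ is at most a * n ^ k.
data Prog : Set where
  skip   : Prog
  _≔_    : ℕ → Expr → Prog
  _[_]≔_ : ℕ → Expr → Expr → Prog
  _⨾_    : Prog → Prog → Prog
  If     : Expr → Prog → Prog → Prog
  For    : ℕ → Expr → ℕ → ℕ → Prog → Prog

loop : ℕ → Expr → Command → Command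
loop x e c = whileNZ (e ⊖ var x) (seq c (setVar x (var x ⊕ lit 1)))

compile : Prog → Command
compile skip           = skip
compile (x ≔ e)        = setVar x e
compile (x [ i ]≔ e)   = setArr x i e
compile (p ⨾ q)        = seq (compile p) (compile q)
compile (If e p q)     = ifNZ e (compile p) (compile q)
compile (For x e a k p) = seq (setVar x (lit 0)) (loop x e (compile p))

module _ (n : ℕ) where

  -- A round costs 7 besides `e` and the body: 3 for the test of `e ⊖ var x` and 4 for the
  -- increment. The closing 5 pays for the initialisation and the last, failing test. Both branches
  -- of `If` are added, which keeps the bound a plain sum.
  time : Prog → ℕ
  time skip            = 1
  time (x ≔ e)         = 1 + cost e
  time (x [ i ]≔ e)    = 1 + cost i + cost e
  time (p ⨾ q)         = time p + time q
  time (If e p q)      = 1 + cost e + (time p + time q)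
  time (For x e a k p) = a * n ^ k * (7 + cost e + time p) + (5 + cost e)

degree : Prog → ℕ
degree skip            = 0
degree (x ≔ e)         = 0
degree (x [ i ]≔ e)    = 0
degree (p ⨾ q)         = degree p ⊔ degree q
degree (If e p q)      = degree p ⊔ degree q
degree (For x e a k p) = k + degree p

coefficient : Prog → ℕ
coefficient skip            = 1
coefficient (x ≔ e)         = 1 + cost e
coefficient (x [ i ]≔ e)    = 1 + cost i + cost e
coefficient (p ⨾ q)         = coefficient p + coefficient q
coefficient (If e p q)      = 1 + cost e + (coefficient p + coefficient q)
coefficient (For x e a k p) = a * (7 + cost e + coefficient p) + (5 + cost e)

module _ {n : ℕ} (1≤n : 1 ≤ n) where

  private instance
    n≢0 : NonZero n
    n≢0 = >-nonZero 1≤n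

  constant≤ : ∀ a d → a ≤ a * n ^ d
  constant≤ a d = m≤m*n a (n ^ d) ⦃ m^n≢0 n d ⦄

  raise-degree : ∀ {t} a {d d′} → d ≤ d′ → t ≤ a * n ^ d → t ≤ a * n ^ d′
  raise-degree a d≤d′ t≤ = ≤-trans t≤ (*-monoʳ-≤ a (^-monoʳ-≤ n d≤d′))

  add-bounds : ∀ {s t} a b d d′ → s ≤ a * n ^ d → t ≤ b * n ^ d′ →
    s + t ≤ (a + b) * n ^ (d ⊔ d′)
  add-bounds a b d d′ s≤ t≤ = ≤-trans
    (+-mono-≤ (raise-degree a (m≤m⊔n d d′) s≤) (raise-degree b (m≤n⊔m d d′) t≤))
    (≤-reflexive (sym (*-distribʳ-+ (n ^ (d ⊔ d′)) a b)))

  -- Lower powers of `n` are absorbed into the highest one, whence `1 ≤ n`; a loop multiplies, so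
  -- its exponent is added.
  time≤ : ∀ p → time n p ≤ coefficient p * n ^ degree p
  time≤ skip            = ≤-refl
  time≤ (x ≔ e)         = constant≤ (1 + cost e) 0
  time≤ (x [ i ]≔ e)    = constant≤ (1 + cost i + cost e) 0
  time≤ (p ⨾ q)         =
    add-bounds (coefficient p) (coefficient q) (degree p) (degree q) (time≤ p) (time≤ q)
  time≤ (If e p q)      = add-bounds (1 + cost e) (coefficient p + coefficient q)
    0 (degree p ⊔ degree q) (constant≤ (1 + cost e) 0)
    (add-bounds (coefficient p) (coefficient q) (degree p) (degree q) (time≤ p) (time≤ q))
  time≤ (For x e a k p) = ≤-trans
    (+-mono-≤
      (≤-trans (*-monoʳ-≤ (a * n ^ k)
                 (add-bounds (7 + cost e) (coefficient p) 0 (degree p)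
                   (constant≤ (7 + cost e) 0) (time≤ p)))
               (≤-reflexive (rearrange a (n ^ k) (7 + cost e + coefficient p) (n ^ degree p))))
      (constant≤ (5 + cost e) (k + degree p)))
    (≤-reflexive (trans
      (cong (λ m → a * (7 + cost e + coefficient p) * m + (5 + cost e) * n ^ (k + degree p))
        (sym (^-distribˡ-+-* n k (degree p))))
      (sym (*-distribʳ-+ (n ^ (k + degree p)) (a * (7 + cost e + coefficient p)) (5 + cost e)))))
    where
    rearrange : ∀ a x b y → a * x * (b * y) ≡ a * b * (x * y)
    rearrange a x b y = begin
      a * x * (b * y)   ≡⟨ *-assoc a x (b * y) ⟩
      a * (x * (b * y)) ≡⟨ cong (a *_) (trans (sym (*-assoc x b y))
                             (trans (cong (_* y) (*-comm x b)) (*-assoc b x y))) ⟩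
      a * (b * (x * y)) ≡⟨ *-assoc a b (x * y) ⟨
      a * b * (x * y)   ∎
      where open ≡-Reasoning

size : Expr → ℕ
size (lit a)   = 1
size (var x)   = 1
size (arr x e) = 1 + size e
size (e ⊕ f)   = 1 + size e + size f
size (e ⊖ f)   = 1 + size e + size f
size (e ⊗ f)   = 1 + size e + size f

smallLiterals : Expr → Bool
smallLiterals (lit a)   = a ≤ᵇ 2
smallLiterals (var x)   = true
smallLiterals (arr x e) = smallLiterals e
smallLiterals (e ⊕ f)   = smallLiterals e ∧ smallLiterals f
smallLiterals (e ⊖ f)   = smallLiterals e ∧ smallLiterals f
smallLiterals (e ⊗ f)   = smallLiterals e ∧ smallLiterals f

-- If all cells are at most M, then an expression of size s has value at most
-- M ^ s; the bound 100 covers every expression of the algorithm.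
small : Expr → Bool
small e = (size e ≤ᵇ 100) ∧ smallLiterals e

T-∧ˡ : ∀ {a b} → T (a ∧ b) → T a
T-∧ˡ {true} _ = tt

T-∧ʳ : ∀ {a b} → T (a ∧ b) → T b
T-∧ʳ {true} t = t

-- A syntactic test that evaluates to `true` or `false` for a concrete program, so frame conditions
-- are later discharged by `_`.
keepsVar : ℕ → Prog → Bool
keepsVar y skip            = true
keepsVar y (x ≔ e)         = not (x ≡ᵇ y)
keepsVar y (x [ i ]≔ e)    = true
keepsVar y (p ⨾ q)         = keepsVar y p ∧ keepsVar y q
keepsVar y (If e p q)      = keepsVar y p ∧ keepsVar y q
keepsVar y (For x e a k p) = not (x ≡ᵇ y) ∧ keepsVar y p

keepsArr : ℕ → Prog → Bool
keepsArr y skip            = true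
keepsArr y (x ≔ e)         = true
keepsArr y (x [ i ]≔ e)    = not (x ≡ᵇ y)
keepsArr y (p ⨾ q)         = keepsArr y p ∧ keepsArr y q
keepsArr y (If e p q)      = keepsArr y p ∧ keepsArr y q
keepsArr y (For x e a k p) = keepsArr y p

record Frame (p : Prog) (σ τ : State) : Set where
  constructor frame
  field
    fv : ∀ y → T (keepsVar y p) → vars τ y ≡ vars σ y
    fa : ∀ y → T (keepsArr y p) → arrs τ y ≡ arrs σ y
open Frame public

update-≡ : ∀ {A : Set} (f : ℕ → A) i {a j} → i ≡ j → update f i a j ≡ a
update-≡ f i refl with i ≡ᵇ i | ≡⇒≡ᵇ i i refl
... | true | _ = refl

update-≢ : ∀ {A : Set} (f : ℕ → A) i {a j} → i ≢ j → update f i a j ≡ f j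
update-≢ f i {a} {j} i≢j with i ≡ᵇ j in eq
... | false = refl
... | true  = ⊥-elim (i≢j (≡ᵇ⇒≡ i j (subst T (sym eq) tt)))

update-not : ∀ {A : Set} (f : ℕ → A) i {a j} → T (not (i ≡ᵇ j)) → update f i a j ≡ f j
update-not f i {a} {j} t with i ≡ᵇ j
... | false = refl

-- Rules for total correctness with time, word size and framing

module Verification (n M W : ℕ) (2≤M : 2 ≤ M) (M^100<W : M ^ 100 < W) where

  record Bounded (σ : State) : Set where
    constructor bounded
    field
      vars≤ : ∀ x → vars σ x ≤ M
      arrs≤ : ∀ x i → arrs σ x i ≤ M
  open Bounded public

  private instance
    M≢0 : NonZero M
    M≢0 = >-nonZero (≤-trans (s≤s z≤n) 2≤M)

  M≤M^ : ∀ s → M ≤ M ^ suc s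
  M≤M^ s = m≤m*n M (M ^ s) ⦃ m^n≢0 M s ⦄

  M^≤ : ∀ {s t} → s ≤ t → M ^ s ≤ M ^ t
  M^≤ = ^-monoʳ-≤ M

  product≤ : ∀ {a b} s t → a ≤ M ^ s → b ≤ M ^ t → a * b ≤ M ^ (1 + s + t)
  product≤ s t a≤ b≤ = ≤-trans (*-mono-≤ a≤ b≤)
    (≤-trans (≤-reflexive (sym (^-distribˡ-+-* M s t))) (M^≤ (n≤1+n (s + t))))

  sum≤ : ∀ {a b} s t → a ≤ M ^ s → b ≤ M ^ t → a + b ≤ M ^ (1 + s + t)
  sum≤ s t a≤ b≤ = ≤-trans
    (+-mono-≤ (≤-trans a≤ (M^≤ (m≤m+n s t))) (≤-trans b≤ (M^≤ (m≤n+m t s))))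
    (≤-trans (≤-reflexive (cong (M ^ (s + t) +_) (sym (+-identityʳ _))))
             (*-monoˡ-≤ (M ^ (s + t)) 2≤M))

  value≤ : ∀ {σ} → Bounded σ → ∀ e → T (smallLiterals e) → ⟦ e ⟧ σ ≤ M ^ size e
  value≤ b (lit a)   ok = ≤-trans (≤ᵇ⇒≤ a 2 ok) (≤-trans 2≤M (M≤M^ 0))
  value≤ b (var x)   ok = ≤-trans (vars≤ b x) (M≤M^ 0)
  value≤ b (arr x e) ok = ≤-trans (arrs≤ b x _) (M≤M^ (size e))
  value≤ b (e ⊕ f)   ok = sum≤ (size e) (size f) (value≤ b e (T-∧ˡ ok)) (value≤ b f (T-∧ʳ ok))
  value≤ b (e ⊖ f)   ok = ≤-trans (m∸n≤m (⟦ e ⟧ _) (⟦ f ⟧ _))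
    (≤-trans (value≤ b e (T-∧ˡ ok)) (M^≤ (≤-trans (n≤1+n _) (m≤m+n (1 + size e) (size f)))))
  value≤ b (e ⊗ f)   ok = product≤ (size e) (size f) (value≤ b e (T-∧ˡ ok)) (value≤ b f (T-∧ʳ ok))

  mutual
    fits′ : ∀ {σ} → Bounded σ → ∀ e → size e ≤ 100 → T (smallLiterals e) → Fits W σ e
    fits′ b e s ok = ≤-<-trans (≤-trans (value≤ b e ok) (M^≤ s)) M^100<W , subFits b e s ok

    subFits : ∀ {σ} → Bounded σ → ∀ e → size e ≤ 100 → T (smallLiterals e) → SubFits W σ e
    subFits b (lit a)   s ok = tt
    subFits b (var x)   s ok = tt
    subFits b (arr x e) s ok = fits′ b e (≤-trans (n≤1+n _) s) ok
    subFits b (e ⊕ f)   s ok = both b e f s ok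
    subFits b (e ⊖ f)   s ok = both b e f s ok
    subFits b (e ⊗ f)   s ok = both b e f s ok

    both : ∀ {σ} → Bounded σ → ∀ e f → 1 + size e + size f ≤ 100 →
      T (smallLiterals e ∧ smallLiterals f) → Fits W σ e × Fits W σ f
    both b e f s ok =
      fits′ b e (≤-trans (≤-trans (n≤1+n _) (m≤m+n (1 + size e) (size f))) s) (T-∧ˡ ok) ,
      fits′ b f (≤-trans (m≤n+m (size f) (1 + size e)) s) (T-∧ʳ ok)

  fits : ∀ {σ} → Bounded σ → ∀ e → T (small e) → Fits W σ e
  fits b e ok = fits′ b e (≤ᵇ⇒≤ (size e) 100 (T-∧ˡ ok)) (T-∧ʳ {size e ≤ᵇ 100} ok)

  bounded-writeVar : ∀ {σ} → Bounded σ → ∀ x {a} → a ≤ M → Bounded (writeVar σ x a)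
  bounded-writeVar {σ} b x {a} a≤M = bounded bv (arrs≤ b)
    where
    bv : ∀ y → update (vars σ) x a y ≤ M
    bv y with x ≡ᵇ y
    ... | true  = a≤M
    ... | false = vars≤ b y

  bounded-writeArr : ∀ {σ} → Bounded σ → ∀ x i {a} → a ≤ M → Bounded (writeArr σ x i a)
  bounded-writeArr {σ} b x i {a} a≤M = bounded (vars≤ b) ba
    where
    ba : ∀ y j → update (arrs σ) x (update (arrs σ x) i a) y j ≤ M
    ba y j with x ≡ᵇ y
    ... | false = arrs≤ b y j
    ... | true with i ≡ᵇ j
    ...   | true  = a≤M
    ...   | false = arrs≤ b x j

  record Terminates (p : Prog) (σ : State) (Q : State → Set) : Set where
    constructor terminates
    field
      {final}       : State
      {steps}       : ℕ
      run           : Run W (compile p) σ final steps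
      in-time       : steps ≤ time n p
      final-bounded : Bounded final
      framed        : Frame p σ final
      post          : Q final

  -- Kept as a record so that p and Q can be inferred from the type.
  record Spec (p : Prog) (σ : State) (Q : State → Set) : Set where
    constructor spec
    field outcome : Bounded σ → Terminates p σ Q
  open Spec public

  do-skip : ∀ {σ Q} → Q σ → Spec skip σ Q
  do-skip q .outcome b = terminates run-skip ≤-refl b (frame (λ _ _ → refl) (λ _ _ → refl)) q

  do-var : ∀ {x e σ Q} {_ : T (small e)} → (Bounded σ → ⟦ e ⟧ σ ≤ M) →
    Q (writeVar σ x (⟦ e ⟧ σ)) → Spec (x ≔ e) σ Q
  do-var {x} {e} {σ} {Q} {ok} e≤M q .outcome b = terminates
    (run-setVar (fits b e ok)) ≤-refl (bounded-writeVar b x (e≤M b))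
    (frame (λ _ t → update-not (vars σ) x t) (λ _ _ → refl)) q

  do-arr : ∀ {x i e σ Q} {_ : T (small i)} {_ : T (small e)} → (Bounded σ → ⟦ e ⟧ σ ≤ M) →
    Q (writeArr σ x (⟦ i ⟧ σ) (⟦ e ⟧ σ)) → Spec (x [ i ]≔ e) σ Q
  do-arr {x} {i} {e} {σ} {Q} {ok} {ok′} e≤M q .outcome b = terminates
    (run-setArr (fits b i ok) (fits b e ok′)) ≤-refl (bounded-writeArr b x (⟦ i ⟧ σ) (e≤M b))
    (frame (λ _ _ → refl) (λ _ t → update-not (arrs σ) x t)) q

  -- The postcondition of `p` is the specification of `q`, so a proof follows the program text
  -- without naming intermediate assertions.
  do-seq : ∀ {p q σ Q} → Spec p σ (λ ρ → Spec q ρ Q) → Spec (p ⨾ q) σ Q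
  do-seq {p} {q} s .outcome b with s .outcome b
  ... | terminates r t≤ b′ f s′ with s′ .outcome b′
  ...   | terminates r′ t≤′ b″ f′ Qτ = terminates (run-seq r r′) (+-mono-≤ t≤ t≤′) b″
    (frame (λ y t → trans (fv f′ y (T-∧ʳ {keepsVar y p} t)) (fv f y (T-∧ˡ t)))
           (λ y t → trans (fa f′ y (T-∧ʳ {keepsArr y p} t)) (fa f y (T-∧ˡ t)))) Qτ

  do-if : ∀ {e p q σ Q} {_ : T (small e)} → (⟦ e ⟧ σ ≢ 0 → Spec p σ Q) →
    (⟦ e ⟧ σ ≡ 0 → Spec q σ Q) → Spec (If e p q) σ Q
  do-if {e} {p} {q} {σ} {Q} {ok} sp sq .outcome b with ⟦ e ⟧ σ ≟ 0
  ... | yes e≡0 with sq e≡0 .outcome b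
  ...   | terminates r t≤ b′ f Qτ = terminates (run-if-z (fits b e ok) e≡0 r)
    (+-monoʳ-≤ (1 + cost e) (≤-trans t≤ (m≤n+m _ _))) b′
    (frame (λ y t → fv f y (T-∧ʳ {keepsVar y p} t)) (λ y t → fa f y (T-∧ʳ {keepsArr y p} t))) Qτ
  do-if {e} {p} {q} {σ} {Q} {ok} sp sq .outcome b
      | no e≢0 with sp e≢0 .outcome b
  ...   | terminates r t≤ b′ f Qτ = terminates (run-if-nz (fits b e ok) e≢0 r)
    (+-monoʳ-≤ (1 + cost e) (≤-trans t≤ (m≤m+n _ _))) b′
    (frame (λ y t → fv f y (T-∧ˡ t)) (λ y t → fa f y (T-∧ˡ t))) Qτ

  framed-post : ∀ {p σ Q} → Spec p σ Q → Spec p σ (λ τ → Frame p σ τ × Q τ)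
  framed-post s .outcome b with s .outcome b
  ... | terminates r t≤ b′ f q = terminates r t≤ b′ f (f , q)

  weaken : ∀ {p σ Q R} → (∀ {τ} → Bounded τ → Q τ → R τ) → Spec p σ Q → Spec p σ R
  weaken QR s .outcome b with s .outcome b
  ... | terminates r t≤ b′ f q = terminates r t≤ b′ f (QR b′ q)

  module _ {x : ℕ} {e : Expr} {a k : ℕ} {p : Prog} {σ : State} {Q : State → Set}
    {ok : T (small (e ⊖ var x))} {x-kept : T (keepsVar x p)}
    (N : ℕ) (Inv : ℕ → State → Set) (N≤a*n^k : N ≤ a * n ^ k) (N≤M : N ≤ M)
    (bound : ∀ τ → Frame (For x e a k p) σ τ → ⟦ e ⟧ τ ≡ N)
    (start : Inv 0 (writeVar σ x 0))
    (body : ∀ i τ → i < N → vars τ x ≡ i → Frame (For x e a k p) σ τ → Inv i τ →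
      Spec p τ (λ ρ → Inv (suc i) (writeVar ρ x (suc i))))
    (finish : ∀ τ → Frame (For x e a k p) σ τ → Inv N τ → Q τ)
    where

    private
      condition = e ⊖ var x
      iteration = 7 + cost e + time n p

      step-frame : ∀ {τ ρ} c → Frame (For x e a k p) σ τ → Frame p τ ρ →
        Frame (For x e a k p) σ (writeVar ρ x c)
      step-frame {τ} {ρ} c f g = frame
        (λ y t → trans (update-not (vars ρ) x (T-∧ˡ t))
          (trans (fv g y (T-∧ʳ {not (x ≡ᵇ y)} t)) (fv f y t)))
        (λ y t → trans (fa g y t) (fa f y t))

      -- Induction on the number `j` of rounds left.
      go : ∀ j i τ → i + j ≡ N → vars τ x ≡ i → Bounded τ → Frame (For x e a k p) σ τ →
        Inv i τ → ∃₂ λ ρ t → Run W (loop x e (compile p)) τ ρ t ×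
          t ≤ j * iteration + (3 + cost e) × Bounded ρ × Frame (For x e a k p) σ ρ × Q ρ
      go zero i τ i+0≡N x≡i b f inv = τ , _ ,
        run-while-z (fits b condition ok) eq ,
        ≤-trans (≤-reflexive (cong (2 +_) (+-comm (cost e) 1))) ≤-refl , b , f ,
        finish τ f (subst (λ i → Inv i τ) i≡N inv)
        where
        i≡N : i ≡ N
        i≡N = trans (sym (+-identityʳ i)) i+0≡N
        eq : ⟦ condition ⟧ τ ≡ 0
        eq = trans (cong₂ _∸_ (bound τ f) (trans x≡i i≡N)) (n∸n≡0 N)
      go (suc j) i τ i+j≡N x≡i b f inv with body i τ i<N x≡i f inv .outcome b
        where
        i<N : i < N
        i<N = subst (i <_) i+j≡N (m<m+n i (s≤s z≤n))
      ... | terminates {ρ} {s} r s≤ b′ g inv′ with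
        go j (suc i) (writeVar ρ x (suc i)) (trans (sym (+-suc i j)) i+j≡N)
          (update-≡ (vars ρ) x refl)
          (bounded-writeVar b′ x (≤-trans i<N N≤M))
          (step-frame (suc i) f g) inv′
        where
        i<N : i < N
        i<N = subst (i <_) i+j≡N (m<m+n i (s≤s z≤n))
      ...   | τ′ , t , r′ , t≤ , b″ , f′ , q =
        τ′ , _ , run-while-nz (fits b condition ok) neq
          (run-seq r (subst (λ c → Run W (setVar x (var x ⊕ lit 1)) ρ (writeVar ρ x c) 4) value
            (run-setVar (fits b′ (var x ⊕ lit 1) tt)))) r′ , time-bound , b″ , f′ , q
        where
        i<N : i < N
        i<N = subst (i <_) i+j≡N (m<m+n i (s≤s z≤n))
        neq : ⟦ condition ⟧ τ ≢ 0
        neq eq = <⇒≱ i<N (m∸n≡0⇒m≤n (trans (sym (cong₂ _∸_ (bound τ f) x≡i)) eq))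
        value : vars ρ x + 1 ≡ suc i
        value = trans (cong (_+ 1) (trans (fv g x x-kept) x≡i)) (+-comm i 1)
        time-bound : 1 + (1 + cost e + 1) + (s + 4) + t ≤
          iteration + j * iteration + (3 + cost e)
        time-bound = begin
          1 + (1 + cost e + 1) + (s + 4) + t
            ≤⟨ +-mono-≤ (+-monoʳ-≤ (1 + (1 + cost e + 1)) (+-monoˡ-≤ 4 s≤)) t≤ ⟩
          1 + (1 + cost e + 1) + (time n p + 4) + (j * iteration + (3 + cost e))
            ≡⟨ cong (_+ (j * iteration + (3 + cost e))) (shuffle (cost e) (time n p)) ⟩
          iteration + (j * iteration + (3 + cost e))
            ≡⟨ +-assoc iteration (j * iteration) (3 + cost e) ⟨
          iteration + j * iteration + (3 + cost e) ∎
          where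
          open ≤-Reasoning
          shuffle : ∀ c t → 1 + (1 + c + 1) + (t + 4) ≡ 7 + c + t
          shuffle c t = cong (2 +_) (trans (cong₂ _+_ (+-comm c 1) (+-comm t 4))
            (cong suc (trans (+-comm c (4 + t)) (cong (4 +_) (+-comm t c)))))

    -- The compiled loop evaluates `e` anew in every round, so `bound` speaks of all states within
    -- the frame. `Inv i` describes the state in which the counter already holds `i`.
    do-for : Spec (For x e a k p) σ Q
    do-for .outcome b with go N 0 (writeVar σ x 0) refl (update-≡ (vars σ) x refl)
      (bounded-writeVar b x z≤n)
      (frame (λ y t → update-not (vars σ) x (T-∧ˡ t)) (λ _ _ → refl)) start
    ... | τ , t , r , t≤ , b′ , f , q = terminates
      (run-seq (run-setVar (fits b (lit 0) tt)) r)
      (≤-trans (+-monoʳ-≤ 2 (≤-trans t≤ (+-monoˡ-≤ (3 + cost e) (*-monoˡ-≤ iteration N≤a*n^k))))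
        (≤-reflexive (trans (+-comm 2 _) (trans (+-assoc (a * n ^ k * iteration) (3 + cost e) 2)
          (cong (a * n ^ k * iteration +_) (+-comm (3 + cost e) 2))))))
      b′ f q

-- Codes of pairs and counting

code-≤ : ∀ {n x x′ y y′} → y′ < n → n * x + y ≤ n * x′ + y′ → x ≤ x′
code-≤ {n} {x} {x′} {y} {y′} y′<n le = ≮⇒≥ λ x′<x → <⇒≱ (begin-strict
  n * x′ + y′ <⟨ +-monoʳ-< (n * x′) y′<n ⟩
  n * x′ + n  ≡⟨ trans (+-comm (n * x′) n) (sym (*-suc n x′)) ⟩
  n * suc x′  ≤⟨ *-monoʳ-≤ n x′<x ⟩
  n * x       ≤⟨ m≤m+n (n * x) y ⟩
  n * x + y   ∎) le
  where open ≤-Reasoning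

code-injective : ∀ {n x x′ y y′} → y < n → y′ < n → n * x + y ≡ n * x′ + y′ →
  x ≡ x′ × y ≡ y′
code-injective {n} {x} {x′} y<n y′<n eq with
  ≤-antisym (code-≤ {n} {x} {x′} y′<n (≤-reflexive eq)) (code-≤ {n} {x′} {x} y<n (≤-reflexive (sym eq)))
... | refl = refl , +-cancelˡ-≡ (n * x) _ _ eq

code<n² : ∀ {n x y} → x < n → y < n → n * x + y < n * n
code<n² {n} {x} {y} x<n y<n = begin-strict
  n * x + y  <⟨ +-monoʳ-< (n * x) y<n ⟩
  n * x + n  ≡⟨ trans (+-comm (n * x) n) (sym (*-suc n x)) ⟩
  n * suc x  ≤⟨ *-monoʳ-≤ n x<n ⟩
  n * n      ∎
  where open ≤-Reasoning

sumTo : ℕ → (ℕ → ℕ) → ℕ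
sumTo zero    f = 0
sumTo (suc i) f = sumTo i f + f i

sumTo-mono-≤ : ∀ m {f g} → (∀ i → i < m → f i ≤ g i) → sumTo m f ≤ sumTo m g
sumTo-mono-≤ zero    f≤g = z≤n
sumTo-mono-≤ (suc m) f≤g =
  +-mono-≤ (sumTo-mono-≤ m λ i i<m → f≤g i (m<n⇒m<1+n i<m)) (f≤g m ≤-refl)

sumTo-mono-< : ∀ m {f g} → (∀ i → i < m → f i ≤ g i) → ∀ j → j < m → f j < g j →
  sumTo m f < sumTo m g
sumTo-mono-< (suc m) f≤g j (s≤s j≤m) fj<gj with j ≟ m
... | yes refl = +-mono-≤-< (sumTo-mono-≤ m λ i i<m → f≤g i (m<n⇒m<1+n i<m)) fj<gj
... | no j≢m   = +-mono-<-≤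
  (sumTo-mono-< m (λ i i<m → f≤g i (m<n⇒m<1+n i<m)) j (≤∧≢⇒< j≤m j≢m) fj<gj) (f≤g m ≤-refl)

sumTo-1 : ∀ m → sumTo m (λ _ → 1) ≡ m
sumTo-1 zero    = refl
sumTo-1 (suc m) = trans (cong (_+ 1) (sumTo-1 m)) (+-comm m 1)

sg : ℕ → ℕ
sg k = 1 ∸ (1 ∸ k)

sg-≢0 : ∀ {k} → k ≢ 0 → sg k ≡ 1
sg-≢0 {zero}  k≢0 = contradiction refl k≢0
sg-≢0 {suc k} _   = cong (1 ∸_) (0∸n≡0 k)

-- Pigeonhole: if `r` were missed, punching it out of the codomain would leave an injection of
-- `Fin (suc m)` into `Fin m`.
injective⇒surjective : ∀ {n} (f : Fin n → Fin n) → (∀ {i j} → f i ≡ f j → i ≡ j) →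
  ∀ r → ∃ λ i → f i ≡ r
injective⇒surjective {suc m} f f-injective r with Fin.any? (λ i → f i Fin.≟ r)
... | yes hit = hit
... | no miss = contradiction
  (Fin.injective⇒≤ {f = λ i → punchOut (avoid i)} λ {i} {j} e →
    f-injective (Fin.punchOut-injective (avoid i) (avoid j) e))
  1+n≰n
  where
  avoid : ∀ i → r ≢ f i
  avoid i e = miss (i , sym e)

-- Forced and lexicographic orientations

-- A colouring of all pairs of vertices: 1 for edges, 0 for non-edges, and 2
-- on the diagonal, which spares distinctness hypotheses in what follows.
record Colour : Set where
  field
    col     : ℕ → ℕ → ℕ
    col-sym : ∀ x y → col x y ≡ col y x
    col≤2   : ∀ x y → col x y ≤ 2
    diag    : ∀ x → col x x ≡ 2
    off     : ∀ {x y} → col x y ≡ 2 → x ≡ y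

module Forcing (n : ℕ) (C : Colour) where
  open Colour C

  -- Orienting a → b forces x → y: in a transitive orientation of both colour
  -- classes, two arcs of one colour whose free ends are joined in the other
  -- colour both leave or both enter their common end.
  data Forces (a b : ℕ) : ℕ → ℕ → Set where
    same-tail : ∀ {c} → c < n → col a b ≡ col a c → col a b ≢ col b c → Forces a b a c
    same-head : ∀ {c} → c < n → col a b ≡ col c b → col a b ≢ col a c → Forces a b c b

  forces-< : ∀ {a b x y} → a < n → b < n → Forces a b x y → x < n × y < n
  forces-< a<n b<n (same-tail c<n _ _) = a<n , c<n
  forces-< a<n b<n (same-head c<n _ _) = c<n , b<n

  forces-sym : ∀ {a b x y} → a < n → b < n → Forces a b x y → Forces x y a b
  forces-sym a<n b<n (same-tail {c} _ e ne) =
    same-tail b<n (sym e) (λ e′ → ne (trans e (trans e′ (col-sym c _))))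
  forces-sym a<n b<n (same-head {c} _ e ne) =
    same-head a<n (sym e) (λ e′ → ne (trans e (trans e′ (col-sym c _))))

  forces-reverse : ∀ {a b x y} → Forces a b x y → Forces b a y x
  forces-reverse {a} {b} (same-tail {c} c<n e ne) =
    same-head c<n (trans (col-sym b a) (trans e (col-sym a c))) (λ e′ → ne (trans (col-sym a b) e′))
  forces-reverse {a} {b} (same-head {c} c<n e ne) =
    same-tail c<n (trans (col-sym b a) (trans e (col-sym c b))) (λ e′ → ne (trans (col-sym a b) e′))

  forces-col : ∀ {a b x y} → Forces a b x y → col x y ≡ col a b
  forces-col (same-tail _ e _) = sym e
  forces-col (same-head _ e _) = sym e

  data Reach (s t : ℕ) : ℕ → ℕ → Set where
    here  : Reach s t s t
    _then_ : ∀ {a b x y} → Reach s t a b → Forces a b x y → Reach s t x y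

  reach-< : ∀ {s t x y} → s < n → t < n → Reach s t x y → x < n × y < n
  reach-< s<n t<n here       = s<n , t<n
  reach-< s<n t<n (r then f) = let a<n , b<n = reach-< s<n t<n r in forces-< a<n b<n f

  -- lab x y ≡ suc k says that x → y, and that this arc was forced by the arc
  -- with code k, the code of (s , t) being n * s + t.
  record Seeded (lab : ℕ → ℕ → ℕ) (x y k : ℕ) : Set where
    constructor seeded
    field
      {s t}   : ℕ
      s<n     : s < n
      t<n     : t < n
      is-code : k ≡ n * s + t
      reach   : Reach s t x y
      self    : lab s t ≡ suc k
      least   : k ≤ n * y + x

  -- What the search leaves behind. All arcs of a forcing class carry one label, and by the field
  -- `least` of `seed` the code of the seed does not exceed that of the reverse of any arc in the
  -- class. This is the form in which the triangle argument uses the lexicographic choice.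
  record Orientation (lab : ℕ → ℕ → ℕ) : Set where
    field
      total  : ∀ {x y} → x < n → y < n → x ≢ y → lab x y ≢ 0 ⊎ lab y x ≢ 0
      anti   : ∀ {x y} → x < n → y < n → lab x y ≢ 0 → lab y x ≡ 0
      closed : ∀ {a b x y} → a < n → b < n → lab a b ≢ 0 → Forces a b x y → lab x y ≡ lab a b
      seed   : ∀ {x y k} → x < n → y < n → lab x y ≡ suc k → Seeded lab x y k

  -- Common interface of the orders on the two lines. Only monochromatic cyclic triangles are
  -- excluded by assumption; `forced` takes care of the others, and transitivity follows by
  -- totality.
  record Coherent (_▷_ : ℕ → ℕ → Set) : Set where
    field
      total   : ∀ {x y} → x < n → y < n → x ≢ y → x ▷ y ⊎ y ▷ x
      asym    : ∀ {x y} → x < n → y < n → x ▷ y → ¬ y ▷ x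
      forced  : ∀ {a b x y} → a < n → b < n → a ▷ b → Forces a b x y → x ▷ y
      acyclic : ∀ {a b c} → a < n → b < n → c < n → a ▷ b → b ▷ c → c ▷ a →
                col a b ≡ col b c → col b c ≢ col c a

    irrefl : ∀ {x y} → x < n → x ▷ y → x ≢ y
    irrefl x<n x▷x refl = asym x<n x<n x▷x x▷x

    private
      -- If the third side differed in colour from the other two, `a → b` would force `c → b`.
      half : ∀ {a b c} → a < n → b < n → c < n → a ▷ b → b ▷ c → c ▷ a → col a b ≢ col b c
      half {a} {b} {c} a<n b<n c<n ab bc ca e with col b c ≟ col c a
      ... | yes e′ = acyclic a<n b<n c<n ab bc ca e e′
      ... | no ne  = asym b<n c<n bc
        (forced a<n b<n ab (same-head c<n (trans e (col-sym b c))
          (λ e′ → ne (trans (sym e) (trans e′ (col-sym a c))))))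

      two-valued : ∀ {x y} → x ≢ y → col x y ≡ 0 ⊎ col x y ≡ 1
      two-valued {x} {y} x≢y with col x y in eq | col≤2 x y
      ... | 0 | _ = inj₁ refl
      ... | 1 | _ = inj₂ refl
      ... | 2 | _ = contradiction (off eq) x≢y
      ... | suc (suc (suc _)) | s≤s (s≤s ())

    -- Two of the three sides share a colour, and any two arcs of a cyclic triangle are consecutive,
    -- so `half` applies to a rotation.
    no-cycle : ∀ {a b c} → a < n → b < n → c < n → a ▷ b → b ▷ c → ¬ c ▷ a
    no-cycle {a} {b} {c} a<n b<n c<n ab bc ca
      with two-valued (irrefl a<n ab) | two-valued (irrefl b<n bc) | two-valued (irrefl c<n ca)
    ... | inj₁ p | inj₁ q | _      = half a<n b<n c<n ab bc ca (trans p (sym q))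
    ... | inj₂ p | inj₂ q | _      = half a<n b<n c<n ab bc ca (trans p (sym q))
    ... | _      | inj₁ p | inj₁ q = half b<n c<n a<n bc ca ab (trans p (sym q))
    ... | _      | inj₂ p | inj₂ q = half b<n c<n a<n bc ca ab (trans p (sym q))
    ... | inj₁ q | _      | inj₁ p = half c<n a<n b<n ca ab bc (trans p (sym q))
    ... | inj₂ q | _      | inj₂ p = half c<n a<n b<n ca ab bc (trans p (sym q))

    transitive : ∀ {a b c} → a < n → b < n → c < n → a ▷ b → b ▷ c → a ▷ c
    transitive {a} {b} {c} a<n b<n c<n ab bc with a ≟ c
    ... | yes refl = ⊥-elim (asym a<n b<n ab bc)
    ... | no a≢c with total a<n c<n a≢c
    ...   | inj₁ ac = ac
    ...   | inj₂ ca = ⊥-elim (no-cycle a<n b<n c<n ab bc ca)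

    -- `g` is the characteristic function of the order in the arithmetic form summed by the program;
    -- the rank of a vertex counts its predecessors.
    module Rank (g : ℕ → ℕ → ℕ) (g-1 : ∀ {x y} → x < n → y < n → x ▷ y → g x y ≡ 1)
      (g-0 : ∀ {x y} → x < n → y < n → ¬ x ▷ y → g x y ≡ 0) where

      rank : ℕ → ℕ
      rank v = sumTo n (λ u → g u v)

      private
        decide : ∀ {x y} → x < n → y < n → x ▷ y ⊎ ¬ x ▷ y
        decide {x} {y} x<n y<n with x ≟ y
        ... | yes refl = inj₂ (λ xx → asym x<n x<n xx xx)
        ... | no x≢y with total x<n y<n x≢y
        ...   | inj₁ xy = inj₁ xy
        ...   | inj₂ yx = inj₂ (asym y<n x<n yx)

      rank-mono : ∀ {x y} → x < n → y < n → x ▷ y → rank x < rank y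
      rank-mono {x} {y} x<n y<n x▷y = sumTo-mono-< n pointwise x x<n
        (subst₂ _<_ (sym (g-0 x<n x<n λ xx → asym x<n x<n xx xx)) (sym (g-1 x<n y<n x▷y)) (s≤s z≤n))
        where
        pointwise : ∀ w → w < n → g w x ≤ g w y
        pointwise w w<n with decide w<n x<n
        ... | inj₁ wx = ≤-reflexive (trans (g-1 w<n x<n wx)
                          (sym (g-1 w<n y<n (transitive w<n x<n y<n wx x▷y))))
        ... | inj₂ ¬wx = ≤-trans (≤-reflexive (g-0 w<n x<n ¬wx)) z≤n

      rank-reflects : ∀ {x y} → x < n → y < n → rank x < rank y → x ▷ y
      rank-reflects {x} {y} x<n y<n lt with x ≟ y
      ... | yes refl = ⊥-elim (<-irrefl refl lt)
      ... | no x≢y with total x<n y<n x≢y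
      ...   | inj₁ xy = xy
      ...   | inj₂ yx = ⊥-elim (<-asym lt (rank-mono y<n x<n yx))

      rank-injective : ∀ {x y} → x < n → y < n → rank x ≡ rank y → x ≡ y
      rank-injective {x} {y} x<n y<n e with x ≟ y
      ... | yes x≡y = x≡y
      ... | no x≢y with total x<n y<n x≢y
      ...   | inj₁ xy = ⊥-elim (<-irrefl e (rank-mono x<n y<n xy))
      ...   | inj₂ yx = ⊥-elim (<-irrefl (sym e) (rank-mono y<n x<n yx))

      g≤1 : ∀ {x y} → x < n → y < n → g x y ≤ 1
      g≤1 x<n y<n with decide x<n y<n
      ... | inj₁ xy  = ≤-reflexive (g-1 x<n y<n xy)
      ... | inj₂ ¬xy = ≤-trans (≤-reflexive (g-0 x<n y<n ¬xy)) z≤n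

      partial-rank≤ : ∀ {m y} → m ≤ n → y < n → sumTo m (λ u → g u y) ≤ m
      partial-rank≤ {m} {y} m≤n y<n = subst (sumTo m (λ u → g u y) ≤_) (sumTo-1 m)
        (sumTo-mono-≤ m λ w w<m → g≤1 (<-≤-trans w<m m≤n) y<n)

      rank<n : ∀ {x} → x < n → rank x < n
      rank<n {x} x<n = subst (rank x <_) (sumTo-1 n) (sumTo-mono-< n (λ w w<n → g≤1 w<n x<n) x x<n
        (subst (_< 1) (sym (g-0 x<n x<n λ xx → asym x<n x<n xx xx)) (s≤s z≤n)))

      rank-surjective : ∀ {r} → r < n → ∃ λ v → v < n × rank v ≡ r
      rank-surjective {r} r<n = let i , e = injective⇒surjective rank-Fin rank-Fin-injective (fromℕ< r<n) in
        toℕ i , Fin.toℕ<n i ,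
        trans (sym (Fin.toℕ-fromℕ< (rank<n (Fin.toℕ<n i)))) (trans (cong toℕ e) (Fin.toℕ-fromℕ< r<n))
        where
        rank-Fin : Fin n → Fin n
        rank-Fin i = fromℕ< (rank<n (Fin.toℕ<n i))
        rank-Fin-injective : ∀ {i j} → rank-Fin i ≡ rank-Fin j → i ≡ j
        rank-Fin-injective {i} {j} e = Fin.toℕ-injective (rank-injective (Fin.toℕ<n i) (Fin.toℕ<n j)
          (Fin.fromℕ<-injective _ _ (rank<n (Fin.toℕ<n i)) (rank<n (Fin.toℕ<n j)) e))

  -- The triangle lemma and the two linear orders

  module _ {lab : ℕ → ℕ → ℕ} (O : Orientation lab) where
    open Orientation O

    record Cycle (a b c : ℕ) : Set where
      constructor cycle
      field
        a<n : a < n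
        b<n : b < n
        c<n : c < n
        ab  : lab a b ≢ 0
        bc  : lab b c ≢ 0
        ca  : lab c a ≢ 0
        ab-bc : col a b ≡ col b c
        bc-ca : col b c ≡ col c a

    rotate : ∀ {a b c} → Cycle a b c → Cycle b c a
    rotate (cycle a<n b<n c<n ab bc ca e e′) = cycle b<n c<n a<n bc ca ab e′ (sym (trans e e′))

    -- The triangle lemma: the apex of a monochromatic cyclic triangle may be
    -- kept while the opposite arc moves within its forcing class.
    move-step : ∀ {a b c b′ c′} → Cycle a b c → Forces b c b′ c′ →
      Cycle a b′ c′ × lab a b′ ≡ lab a b × lab c′ a ≡ lab c a
    move-step {a} {b} {c} {_} {c′} (cycle a<n b<n c<n ab bc ca e e′) f@(same-tail c′<n g ne)
      with col c′ a ≟ col b c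
    -- If the new side `c′ a` differed in colour from `b c`, then `b → c′` would force `b → a`.
    -- Otherwise it is forced by `c → a` and inherits its label. The case of a moving `b` is the
    -- mirror image.
    ... | no ne′ = contradiction (anti a<n b<n ab) λ ba → bc′ (trans (sym (closed b<n c′<n bc′ f′)) ba)
      where
      bc′ : lab b c′ ≢ 0
      bc′ z = bc (trans (sym (closed b<n c<n bc f)) z)
      f′ : Forces b c′ b a
      f′ = same-tail a<n (trans (sym g) (trans (sym e) (col-sym a b))) (λ h → ne′ (trans (sym h) (sym g)))
    ... | yes h = cycle a<n b<n c′<n ab (λ z → bc (trans (sym (closed b<n c<n bc f)) z))
        (λ z → ca (trans (sym eq) z)) (trans e g) (trans (sym g) (sym h)) , refl , eq
      where
      eq : lab c′ a ≡ lab c a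
      eq = closed c<n a<n ca (same-head c′<n (trans (sym e′) (sym h)) (λ k → ne (trans e′ k)))
    move-step {a} {b} {c} {b′} {_} (cycle a<n b<n c<n ab bc ca e e′) f@(same-head b′<n g ne)
      with col a b′ ≟ col b c
    ... | no ne′ = contradiction (anti c<n a<n ca) λ ac → b′c (trans (sym (closed b′<n c<n b′c f′)) ac)
      where
      b′c : lab b′ c ≢ 0
      b′c z = bc (trans (sym (closed b<n c<n bc f)) z)
      f′ : Forces b′ c a c
      f′ = same-head a<n (trans (sym g) (trans e′ (col-sym c a)))
             (λ h → ne′ (trans (col-sym a b′) (trans (sym h) (sym g))))
    ... | yes h = cycle a<n b′<n c<n (λ z → ab (trans (sym eq) z))
        (λ z → bc (trans (sym (closed b<n c<n bc f)) z)) ca (trans h g) (trans (sym g) e′) , eq , refl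
      where
      eq : lab a b′ ≡ lab a b
      eq = closed a<n b<n ab (same-tail b′<n (trans e (sym h)) (λ k → ne (trans (sym e) k)))

    move : ∀ {a b c s t} → s < n → t < n → Cycle a b c → Reach s t b c →
      Cycle a s t × lab a s ≡ lab a b × lab t a ≡ lab c a
    move s<n t<n C here = C , refl , refl
    move s<n t<n C (r then f) =
      let x<n , y<n    = reach-< s<n t<n r
          C′ , p , q   = move-step C (forces-sym x<n y<n f)
          C″ , p′ , q′ = move s<n t<n C′ r
      in  C″ , trans p′ p , trans q′ q

    -- Move the arc b → c to its seed (s , t). As the arc a → s has a later
    -- seed, but one before (s , a), that seed is of the form (s , q).
    no-cycle-≤ : ∀ {a b c} → Cycle a b c → ¬ lab b c ≤ lab a b
    no-cycle-≤ {a} {b} {c} C le with lab b c in eqB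
    ... | zero  = Cycle.bc C eqB
    ... | suc k with seed (Cycle.b<n C) (Cycle.c<n C) eqB
    ...   | seeded {s} {t} s<n t<n k≡ r self _ with move s<n t<n C r
    ...     | C′ , as≡ab , _ with lab a s in eqA
    ...       | zero   = Cycle.ab C′ eqA
    ...       | suc k′ with seed (Cycle.a<n C) s<n eqA
    ...         | seeded {p} {q} p<n q<n k′≡ r′ self′ least =
      contradiction (anti s<n t<n (λ z → 1+n≢0 (trans (sym self) z)))
        (subst (λ p → lab t p ≢ 0) p≡s (Cycle.ab C″))
      where
      s≤p : s ≤ p
      s≤p = code-≤ {n} {s} {p} {t} q<n
        (subst₂ _≤_ k≡ k′≡ (s≤s⁻¹ (subst (suc k ≤_) (sym as≡ab) le)))
      p≤s : p ≤ s
      p≤s = code-≤ {n} {p} {s} {q} (Cycle.a<n C) (subst (_≤ n * s + a) k′≡ least)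
      p≡s : p ≡ s
      p≡s = ≤-antisym p≤s s≤p
      -- Moving `a → s` to its own seed `p → q` keeps the apex `t`, so `t → p` is an arc. As `p` is
      -- `s`, it reverses the seed `s → t`.
      C″ : Cycle t p q
      C″ = proj₁ (move p<n q<n (rotate (rotate C′)) r′)

    -- Labels cannot increase strictly all the way round, so some arc has a label at most that of
    -- its predecessor, and `no-cycle-≤` applies to a rotation.
    no-mono-cycle : ∀ {a b c} → ¬ Cycle a b c
    no-mono-cycle {a} {b} {c} C with lab b c ≤? lab a b | lab c a ≤? lab b c
    ... | yes le | _      = no-cycle-≤ C le
    ... | no _   | yes le = no-cycle-≤ (rotate C) le
    ... | no ¬p  | no ¬q  = no-cycle-≤ (rotate (rotate C)) (<⇒≤ (<-trans (≰⇒> ¬p) (≰⇒> ¬q)))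

    _▷₁_ _▷₂_ : ℕ → ℕ → Set
    x ▷₁ y = lab x y ≢ 0
    x ▷₂ y = (col x y ≡ 1 × y ▷₁ x) ⊎ (col x y ≢ 1 × x ▷₁ y)

    -- In `g₂` the colour, 1 or 0, selects the reversed or the original arc. The colour 2 of the
    -- diagonal does no harm, since `lab x x` is 0 by `anti`.
    g₁ g₂ : ℕ → ℕ → ℕ
    g₁ x y = sg (lab x y)
    g₂ x y = col x y * sg (lab y x) + (1 ∸ col x y) * sg (lab x y)

    private
      respects : ∀ {a b x y} → a < n → b < n → a ▷₁ b → Forces a b x y → x ▷₁ y
      respects a<n b<n ab f z = ab (trans (sym (closed a<n b<n ab f)) z)

    coherent₁ : Coherent _▷₁_
    coherent₁ = record
      { total   = total
      ; asym    = λ x<n y<n xy yx → yx (anti x<n y<n xy)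
      ; forced  = respects
      ; acyclic = λ a<n b<n c<n ab bc ca e e′ → no-mono-cycle (cycle a<n b<n c<n ab bc ca e e′)
      }

    -- Arcs force only arcs of their own colour, and forcing commutes with reversal, so reversing
    -- all edges preserves `forced`. A monochromatic triangle is reversed as a whole or kept as a
    -- whole.
    coherent₂ : Coherent _▷₂_
    coherent₂ = record { total = tot ; asym = asy ; forced = forc ; acyclic = acyc }
      where
      tot : ∀ {x y} → x < n → y < n → x ≢ y → x ▷₂ y ⊎ y ▷₂ x
      tot {x} {y} x<n y<n x≢y with col x y ≟ 1 | total x<n y<n x≢y
      ... | yes e | inj₁ xy = inj₂ (inj₁ (trans (col-sym y x) e , xy))
      ... | yes e | inj₂ yx = inj₁ (inj₁ (e , yx))
      ... | no ne | inj₁ xy = inj₁ (inj₂ (ne , xy))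
      ... | no ne | inj₂ yx = inj₂ (inj₂ ((λ e → ne (trans (col-sym x y) e)) , yx))
      asy : ∀ {x y} → x < n → y < n → x ▷₂ y → ¬ y ▷₂ x
      asy x<n y<n (inj₁ (_ , yx)) (inj₁ (_ , xy)) = yx (anti x<n y<n xy)
      asy {x} {y} x<n y<n (inj₁ (e , _)) (inj₂ (ne , _)) = ne (trans (col-sym y x) e)
      asy {x} {y} x<n y<n (inj₂ (ne , _)) (inj₁ (e , _)) = ne (trans (col-sym x y) e)
      asy x<n y<n (inj₂ (_ , xy)) (inj₂ (_ , yx)) = yx (anti x<n y<n xy)
      forc : ∀ {a b x y} → a < n → b < n → a ▷₂ b → Forces a b x y → x ▷₂ y
      forc a<n b<n (inj₁ (e , ba)) f =
        inj₁ (trans (forces-col f) e , respects b<n a<n ba (forces-reverse f))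
      forc a<n b<n (inj₂ (ne , ab)) f =
        inj₂ ((λ e → ne (trans (sym (forces-col f)) e)) , respects a<n b<n ab f)
      acyc : ∀ {a b c} → a < n → b < n → c < n → a ▷₂ b → b ▷₂ c → c ▷₂ a →
        col a b ≡ col b c → col b c ≢ col c a
      acyc {a} {b} {c} a<n b<n c<n (inj₁ (_ , ba)) (inj₁ (_ , cb)) (inj₁ (_ , ac)) e e′ =
        no-mono-cycle (cycle a<n c<n b<n ac cb ba
          (trans (col-sym a c) (trans (sym e′) (col-sym b c)))
          (trans (col-sym c b) (trans (sym e) (col-sym a b))))
      acyc a<n b<n c<n (inj₂ (_ , ab)) (inj₂ (_ , bc)) (inj₂ (_ , ca)) e e′ =
        no-mono-cycle (cycle a<n b<n c<n ab bc ca e e′)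
      acyc a<n b<n c<n (inj₁ (p , _)) (inj₂ (q , _)) _ e e′ = q (trans (sym e) p)
      acyc a<n b<n c<n (inj₂ (q , _)) (inj₁ (p , _)) _ e e′ = q (trans e p)
      acyc a<n b<n c<n _ (inj₁ (p , _)) (inj₂ (q , _)) e e′ = q (trans (sym e′) p)
      acyc a<n b<n c<n _ (inj₂ (q , _)) (inj₁ (p , _)) e e′ = q (trans e′ p)

    g₁-1 : ∀ {x y} → x < n → y < n → x ▷₁ y → g₁ x y ≡ 1
    g₁-1 _ _ = sg-≢0

    g₁-0 : ∀ {x y} → x < n → y < n → ¬ x ▷₁ y → g₁ x y ≡ 0
    g₁-0 {x} {y} _ _ ¬xy with lab x y
    ... | zero  = refl
    ... | suc _ = contradiction (λ ()) ¬xy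

    g₂-1 : ∀ {x y} → x < n → y < n → x ▷₂ y → g₂ x y ≡ 1
    g₂-1 {x} {y} x<n y<n (inj₁ (e , yx)) rewrite e = cong (λ k → k + 0 + 0) (sg-≢0 yx)
    g₂-1 {x} {y} x<n y<n (inj₂ (ne , xy)) with col x y | col≤2 x y | off {x} {y}
    ... | 0 | _ | _ = cong (_+ 0) (sg-≢0 xy)
    ... | 1 | _ | _ = contradiction refl ne
    ... | 2 | _ | h with h refl
    ...   | refl = contradiction (anti x<n x<n xy) xy
    g₂-1 {x} {y} x<n y<n (inj₂ (ne , xy)) | suc (suc (suc _)) | s≤s (s≤s ()) | _

    g₂-0 : ∀ {x y} → x < n → y < n → ¬ x ▷₂ y → g₂ x y ≡ 0
    g₂-0 {x} {y} x<n y<n ¬xy with x ≟ y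
    ... | yes refl with lab x x ≟ 0
    ...   | yes e rewrite e = trans (cong₂ _+_ (*-zeroʳ (col x x)) (*-zeroʳ (1 ∸ col x x))) refl
    ...   | no ne = contradiction (anti x<n x<n ne) ne
    g₂-0 {x} {y} x<n y<n ¬xy | no x≢y with col x y in eq | col≤2 x y | off {x} {y}
    ... | 0 | _ | _ with lab x y
    ...   | zero  = refl
    ...   | suc _ = contradiction (inj₂ ((λ e → 0≢1+n e) , λ ())) ¬xy
    g₂-0 {x} {y} x<n y<n ¬xy | no x≢y | 1 | _ | _ with lab y x
    ...   | zero  = refl
    ...   | suc _ = contradiction (inj₁ (refl , λ ())) ¬xy
    g₂-0 {x} {y} x<n y<n ¬xy | no x≢y | 2 | _ | h = contradiction (h refl) x≢y
    g₂-0 {x} {y} x<n y<n ¬xy | no x≢y | suc (suc (suc _)) | s≤s (s≤s ()) | _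

-- The lexicographic search and its invariant

module LexSearch (n : ℕ) (C : Colour) (_⊏_ : ℕ → ℕ → Set)
  (⊏-total : ∀ {x y} → x < n → y < n → x ≢ y → x ⊏ y ⊎ y ⊏ x)
  (⊏-asym : ∀ {x y} → x < n → y < n → x ⊏ y → ¬ y ⊏ x)
  (⊏-forced : ∀ {a b x y} → a < n → b < n → a ⊏ b → Forcing.Forces n C a b x y → x ⊏ y)
  where

  open Colour C
  open Forcing n C

  at : (ℕ → ℕ) → ℕ → ℕ → ℕ
  at L x y = L (n * x + y)

  -- The queue holds the labelled pairs (qa i , qb i), i < tl, of which those
  -- with i < h have been processed; p is the code of the next seed candidate.
  record Search (L qa qb : ℕ → ℕ) (h tl p : ℕ) : Set where
    field
      h≤tl    : h ≤ tl
      q-lt    : ∀ {i} → i < tl → qa i < n × qb i < n × at L (qa i) (qb i) ≢ 0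
      q-inj   : ∀ {i j} → i < tl → j < tl → qa i ≡ qa j → qb i ≡ qb j → i ≡ j
      q-all   : ∀ {x y} → x < n → y < n → at L x y ≢ 0 → ∃ λ i → i < tl × qa i ≡ x × qb i ≡ y
      anti    : ∀ {x y} → x < n → y < n → at L x y ≢ 0 → at L y x ≡ 0
      seed    : ∀ {x y k} → x < n → y < n → at L x y ≡ suc k → Seeded (at L) x y k
      seed<p  : ∀ {x y k} → x < n → y < n → at L x y ≡ suc k → k < p
      closed  : ∀ {i x y} → i < h → Forces (qa i) (qb i) x y → at L x y ≡ at L (qa i) (qb i)
      current : ∀ {i j} → h ≤ i → i < tl → h ≤ j → j < tl →
                at L (qa i) (qb i) ≡ at L (qa j) (qb j)
      decided : ∀ {x y} → x < n → y < n → x ≢ y → n * x + y < p → at L x y ≢ 0 ⊎ at L y x ≢ 0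

  Relaxed : (ℕ → ℕ) → ℕ → ℕ → ℕ → ℕ → Set
  Relaxed L a b x y = Forces a b x y → at L x y ≡ at L a b

  module _ {L : ℕ → ℕ} {x y a : ℕ} (at≡0 : at L x y ≡ 0) where

    private L′ = update L (n * x + y) a

    at-keep : ∀ {u v} → at L u v ≢ 0 → at L′ u v ≡ at L u v
    at-keep {u} {v} uv = update-≢ L (n * x + y) (λ e → uv (trans (cong L (sym e)) at≡0))

    at-keep-≢0 : ∀ {u v} → at L u v ≢ 0 → at L′ u v ≢ 0
    at-keep-≢0 uv z = uv (trans (sym (at-keep uv)) z)

    at-new : at L′ x y ≡ a
    at-new = update-≡ L (n * x + y) refl

    at-cases : ∀ {u v} → y < n → v < n → (x ≡ u × y ≡ v) ⊎ (at L′ u v ≡ at L u v)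
    at-cases {u} {v} y<n v<n with n * x + y ≟ n * u + v
    ... | yes e = inj₁ (code-injective y<n v<n e)
    ... | no ne = inj₂ (update-≢ L (n * x + y) ne)

    seeded-keep : ∀ {u v k} → Seeded (at L) u v k → Seeded (at L′) u v k
    seeded-keep (seeded s<n t<n e r self least) =
      seeded s<n t<n e r (trans (at-keep (λ z → 1+n≢0 (trans (sym self) z))) self) least

    relaxed-keep : ∀ {c d u v} → at L c d ≢ 0 → Relaxed L c d u v → Relaxed L′ c d u v
    relaxed-keep cd r f =
      trans (at-keep (λ z → cd (trans (sym (r f)) z))) (trans (r f) (sym (at-keep cd)))

  module _ {L qa qb : ℕ → ℕ} {h tl p : ℕ} (S : Search L qa qb h tl p) where
    open Search S

    labelled-≢ : ∀ {x y} → x < n → y < n → at L x y ≢ 0 → x ≢ y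
    labelled-≢ x<n y<n xy refl = xy (anti x<n y<n xy)

    -- The queued pairs are distinct, by `q-inj`. The bound keeps the queue pointers within words
    -- and limits the number of rounds of the search.
    tl≤n² : tl ≤ n * n
    tl≤n² = Fin.injective⇒≤ {f = pair} pair-injective
      where
      fst< : ∀ (i : Fin tl) → qa (toℕ i) < n
      fst< i = proj₁ (q-lt (Fin.toℕ<n i))
      snd< : ∀ (i : Fin tl) → qb (toℕ i) < n
      snd< i = proj₁ (proj₂ (q-lt (Fin.toℕ<n i)))
      pair : Fin tl → Fin (n * n)
      pair i = combine (fromℕ< (fst< i)) (fromℕ< (snd< i))
      pair-injective : ∀ {i j} → pair i ≡ pair j → i ≡ j
      pair-injective {i} {j} e =
        let ea , eb = Fin.combine-injective (fromℕ< (fst< i)) (fromℕ< (snd< i)) _ _ e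
        in  Fin.toℕ-injective (q-inj (Fin.toℕ<n i) (Fin.toℕ<n j)
              (Fin.fromℕ<-injective _ _ (fst< i) (fst< j) ea)
              (Fin.fromℕ<-injective _ _ (snd< i) (snd< j) eb))

    module _ {x y k p′ : ℕ} (x<n : x < n) (y<n : y < n) (x≢y : x ≢ y)
      (xy≡0 : at L x y ≡ 0) (yx≡0 : at L y x ≡ 0) (k<p′ : k < p′) (p≤p′ : p ≤ p′)
      (seeded-xy : Seeded (at (update L (n * x + y) (suc k))) x y k)
      (current-k : ∀ {i} → h ≤ i → i < tl → at L (qa i) (qb i) ≡ suc k)
      (decided′ : ∀ {u v} → u < n → v < n → u ≢ v → n * u + v < p′ →
        at (update L (n * x + y) (suc k)) u v ≢ 0 ⊎ at (update L (n * x + y) (suc k)) v u ≢ 0)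
      where

      private
        L′  = update L (n * x + y) (suc k)
        qa′ = update qa tl x
        qb′ = update qb tl y

        qa-old : ∀ {i} → i < tl → qa′ i ≡ qa i
        qa-old i<tl = update-≢ qa tl (<⇒≢ i<tl ∘ sym)
        qb-old : ∀ {i} → i < tl → qb′ i ≡ qb i
        qb-old i<tl = update-≢ qb tl (<⇒≢ i<tl ∘ sym)
        qa-new : qa′ tl ≡ x
        qa-new = update-≡ qa tl refl
        qb-new : qb′ tl ≡ y
        qb-new = update-≡ qb tl refl

        q-old : ∀ {i} → i < tl → at L′ (qa′ i) (qb′ i) ≡ at L (qa i) (qb i)
        q-old i<tl = trans (cong₂ (at L′) (qa-old i<tl) (qb-old i<tl))
          (at-keep {L} {x} {y} xy≡0 (proj₂ (proj₂ (q-lt i<tl))))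
        q-new : at L′ (qa′ tl) (qb′ tl) ≡ suc k
        q-new = trans (cong₂ (at L′) qa-new qb-new) (at-new {L} {x} {y} xy≡0)

        last? : ∀ {i} → i < suc tl → i < tl ⊎ i ≡ tl
        last? (s≤s i≤tl) = m≤n⇒m<n∨m≡n i≤tl

        not-new : ∀ {i} → i < tl → qa′ i ≡ x → qb′ i ≡ y → ⊥
        not-new i<tl ea eb = proj₂ (proj₂ (q-lt i<tl))
          (trans (cong₂ (at L) (trans (sym (qa-old i<tl)) ea) (trans (sym (qb-old i<tl)) eb)) xy≡0)

      -- Common part of two moves: a forced pair takes the label of the head, with `p′` equal to
      -- `p`; a new seed takes its own code plus one, with `p′` equal to `suc p`.
      push : Search L′ qa′ qb′ h (suc tl) p′
      push .Search.h≤tl = m≤n⇒m≤1+n h≤tl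
      push .Search.q-lt {i} i<tl′ with last? i<tl′
      ... | inj₁ i<tl = let a<n , b<n , ne = q-lt i<tl in
        subst (_< n) (sym (qa-old i<tl)) a<n , subst (_< n) (sym (qb-old i<tl)) b<n ,
        (λ z → ne (trans (sym (q-old i<tl)) z))
      ... | inj₂ refl = subst (_< n) (sym qa-new) x<n , subst (_< n) (sym qb-new) y<n ,
        (λ z → 1+n≢0 (trans (sym q-new) z))
      push .Search.q-inj {i} {j} i<tl′ j<tl′ ea eb with last? i<tl′ | last? j<tl′
      ... | inj₁ i<tl | inj₁ j<tl = q-inj i<tl j<tl
        (trans (sym (qa-old i<tl)) (trans ea (qa-old j<tl)))
        (trans (sym (qb-old i<tl)) (trans eb (qb-old j<tl)))
      ... | inj₁ i<tl | inj₂ refl = ⊥-elim (not-new i<tl (trans ea qa-new) (trans eb qb-new))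
      ... | inj₂ refl | inj₁ j<tl =
        ⊥-elim (not-new j<tl (trans (sym ea) qa-new) (trans (sym eb) qb-new))
      ... | inj₂ refl | inj₂ refl = refl
      push .Search.q-all {u} {v} u<n v<n uv with at-cases {L} {x} {y} xy≡0 {u} {v} y<n v<n
      ... | inj₁ (refl , refl) = tl , ≤-refl , qa-new , qb-new
      ... | inj₂ e = let i , i<tl , ea , eb = q-all u<n v<n (λ z → uv (trans e z)) in
        i , m<n⇒m<1+n i<tl , trans (qa-old i<tl) ea , trans (qb-old i<tl) eb
      push .Search.anti {u} {v} u<n v<n uv
        with at-cases {L} {x} {y} {suc k} xy≡0 {u} {v} y<n v<n
           | at-cases {L} {x} {y} {suc k} xy≡0 {v} {u} y<n u<n
      ... | inj₁ (refl , refl) | inj₁ (refl , _) = contradiction refl x≢y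
      ... | inj₁ (refl , refl) | inj₂ e = trans e yx≡0
      ... | inj₂ e | inj₁ (refl , refl) = contradiction (trans e yx≡0) uv
      ... | inj₂ e | inj₂ e′ = trans e′ (anti u<n v<n (λ z → uv (trans e z)))
      push .Search.seed {u} {v} u<n v<n eq with at-cases {L} {x} {y} {suc k} xy≡0 {u} {v} y<n v<n
      ... | inj₁ (refl , refl) = subst (Seeded (at L′) u v)
        (suc-injective (trans (sym (at-new {L} {x} {y} xy≡0)) eq)) seeded-xy
      ... | inj₂ e = seeded-keep {L} {x} {y} xy≡0 (seed u<n v<n (trans (sym e) eq))
      push .Search.seed<p {u} {v} u<n v<n eq with at-cases {L} {x} {y} {suc k} xy≡0 {u} {v} y<n v<n
      ... | inj₁ (refl , refl) = subst (_< p′)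
        (suc-injective (trans (sym (at-new {L} {x} {y} xy≡0)) eq)) k<p′
      ... | inj₂ e = <-≤-trans (seed<p u<n v<n (trans (sym e) eq)) p≤p′
      push .Search.closed {i} {u} {v} i<h f = trans
        (relaxed-keep {L} {x} {y} xy≡0 (proj₂ (proj₂ (q-lt i<tl))) (closed i<h)
          (subst₂ (λ a b → Forces a b u v) (qa-old i<tl) (qb-old i<tl) f))
        (cong₂ (at L′) (sym (qa-old i<tl)) (sym (qb-old i<tl)))
        where
        i<tl : i < tl
        i<tl = <-≤-trans i<h h≤tl
      push .Search.current {i} {j} h≤i i<tl′ h≤j j<tl′ = trans (label h≤i i<tl′) (sym (label h≤j j<tl′))
        where
        label : ∀ {i} → h ≤ i → i < suc tl → at L′ (qa′ i) (qb′ i) ≡ suc k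
        label h≤i i<tl′ with last? i<tl′
        ... | inj₁ i<tl = trans (q-old i<tl) (current-k h≤i i<tl)
        ... | inj₂ refl = q-new
      push .Search.decided = decided′

    module _ (h<tl : h < tl) where

      private
        a = qa h
        b = qb h
        a<n : a < n
        a<n = proj₁ (q-lt h<tl)
        b<n : b < n
        b<n = proj₁ (proj₂ (q-lt h<tl))

      head-≢0 : at L a b ≢ 0
      head-≢0 = proj₂ (proj₂ (q-lt h<tl))

      private
        ⊏-reach : ∀ {s t u v} → s < n → t < n → s ⊏ t → Reach s t u v → u ⊏ v
        ⊏-reach s<n t<n s⊏t here       = s⊏t
        ⊏-reach s<n t<n s⊏t (r then f) = let u<n , v<n = reach-< s<n t<n r in
          ⊏-forced u<n v<n (⊏-reach s<n t<n s⊏t r) f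

        reach-reverse : ∀ {s t u v} → Reach s t u v → Reach t s v u
        reach-reverse here       = here
        reach-reverse (r then f) = reach-reverse r then forces-reverse f

        -- The promised order agrees with a class or with its reverse.
        not-both : ∀ {u v} → u < n → v < n → Forces a b u v → at L v u ≢ at L a b
        not-both {u} {v} u<n v<n f e with at L a b in eq
        ... | zero  = head-≢0 eq
        ... | suc k with seed a<n b<n eq | seed v<n u<n e
        ...   | seeded {s} {t} s<n t<n k≡ r self _ | seeded {s′} {t′} s′<n t′<n k≡′ r′ _ _
          with code-injective {x = s} {s′} t<n t′<n (trans (sym k≡) k≡′)
        ...     | refl , refl with ⊏-total s<n t<n (labelled-≢ s<n t<n λ z → 1+n≢0 (trans (sym self) z))
        ...       | inj₁ st = ⊏-asym u<n v<n (⊏-forced a<n b<n (⊏-reach s<n t<n st r) f)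
                      (⊏-reach s<n t<n st r′)
        ...       | inj₂ ts = ⊏-asym v<n u<n
                      (⊏-forced b<n a<n (⊏-reach t<n s<n ts (reach-reverse r)) (forces-reverse f))
                      (⊏-reach t<n s<n ts (reach-reverse r′))

      -- A labelled pair sits in the queue. If it was processed before the head, it has already been
      -- compared with the head, since forcing is symmetric. If not, it has the label of the head by
      -- `current`. When the reverse pair is the labelled one, the first case contradicts `anti` and
      -- the second `not-both`.
      relaxed-already : ∀ {u v} → Forces a b u v → at L u v ≢ 0 ⊎ at L v u ≢ 0 → at L u v ≡ at L a b
      relaxed-already {u} {v} f (inj₁ uv) =
        let u<n , v<n = forces-< a<n b<n f
            i , i<tl , ea , eb = q-all u<n v<n uv
        in  [ (λ i<h → sym (trans
                  (closed i<h (subst₂ (λ u v → Forces u v a b) (sym ea) (sym eb) (forces-sym a<n b<n f)))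
                  (cong₂ (at L) ea eb)))
            , (λ h≤i → trans (cong₂ (at L) (sym ea) (sym eb)) (current h≤i i<tl ≤-refl h<tl))
            ]′ (<-≤-connex i h)
      relaxed-already {u} {v} f (inj₂ vu) =
        let u<n , v<n = forces-< a<n b<n f
            i , i<tl , ea , eb = q-all v<n u<n vu
            f′ = forces-reverse (forces-sym a<n b<n f)
        in  [ (λ i<h → ⊥-elim (vu (trans (cong₂ (at L) (sym ea) (sym eb)) (trans
                  (sym (closed i<h (subst₂ (λ v u → Forces v u b a) (sym ea) (sym eb) f′)))
                  (anti a<n b<n head-≢0)))))
            , (λ h≤i → ⊥-elim (not-both u<n v<n f
                  (trans (cong₂ (at L) (sym ea) (sym eb)) (current h≤i i<tl ≤-refl h<tl))))
            ]′ (<-≤-connex i h)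

      relax-push : ∀ {x y} → Forces a b x y → at L x y ≡ 0 → at L y x ≡ 0 →
        Search (update L (n * x + y) (at L a b)) (update qa tl x) (update qb tl y) h (suc tl) p
      relax-push {x} {y} f xy≡0 yx≡0 with at L a b in eq
      ... | zero  = ⊥-elim (head-≢0 eq)
      ... | suc k with seed a<n b<n eq
      ...   | seeded {s} {t} s<n t<n k≡ r self _ =
        push x<n y<n x≢y xy≡0 yx≡0 (seed<p a<n b<n eq) ≤-refl
          (seeded s<n t<n k≡ (r then f)
            (trans (at-keep {L} {x} {y} xy≡0 (λ z → 1+n≢0 (trans (sym self) z))) self)
            -- All pairs with codes below that of the seed are decided, so the reverse of a still
            -- undecided pair cannot precede the seed.
            (≮⇒≥ λ lt → [ (λ yx → yx yx≡0) , (λ xy → xy xy≡0) ]′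
              (decided y<n x<n (x≢y ∘ sym) (<-trans lt (seed<p a<n b<n eq)))))
          (λ h≤i i<tl → trans (current h≤i i<tl ≤-refl h<tl) eq)
          (λ u<n v<n u≢v lt → Sum.map (at-keep-≢0 {L} {x} {y} xy≡0) (at-keep-≢0 {L} {x} {y} xy≡0)
            (decided u<n v<n u≢v lt))
        where
        x<n = proj₁ (forces-< a<n b<n f)
        y<n = proj₂ (forces-< a<n b<n f)
        x≢y : x ≢ y
        x≢y refl = labelled-≢ a<n b<n head-≢0 (off (trans (sym (forces-col f)) (diag x)))

      processed : (∀ {c} → c < n → Relaxed L a b a c × Relaxed L a b c b) →
        Search L qa qb (suc h) tl p
      processed rel = record
        { h≤tl = h<tl ; q-lt = q-lt ; q-inj = q-inj ; q-all = q-all ; anti = anti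
        ; seed = seed ; seed<p = seed<p
        ; closed = λ {i} i<1+h f → [ (λ i<h → closed i<h f) , (λ { refl → rel-forces f }) ]′
            (m≤n⇒m<n∨m≡n (s≤s⁻¹ i<1+h))
        ; current = λ h<i i<tl h<j j<tl → current (<⇒≤ h<i) i<tl (<⇒≤ h<j) j<tl
        ; decided = decided }
        where
        rel-forces : ∀ {x y} → Forces a b x y → at L x y ≡ at L a b
        rel-forces f@(same-tail c<n _ _) = proj₁ (rel c<n) f
        rel-forces f@(same-head c<n _ _) = proj₂ (rel c<n) f

    private
      decide-next : ∀ {L′ s t} → s < n → t < n → p ≡ n * s + t →
        (∀ {u v} → at L u v ≢ 0 → at L′ u v ≢ 0) →
        (s ≢ t → at L′ s t ≢ 0 ⊎ at L′ t s ≢ 0) →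
        ∀ {x y} → x < n → y < n → x ≢ y → n * x + y < suc p → at L′ x y ≢ 0 ⊎ at L′ y x ≢ 0
      decide-next {L′} {s} {t} s<n t<n p≡ keep new {x} {y} x<n y<n x≢y (s≤s le)
        with m≤n⇒m<n∨m≡n le
      ... | inj₁ lt = Sum.map keep keep (decided x<n y<n x≢y lt)
      ... | inj₂ e with code-injective {x = x} {s} y<n t<n (trans e p≡)
      ...   | refl , refl = new x≢y

    seed-skip : ∀ {s t} → s < n → t < n → p ≡ n * s + t →
      (s ≢ t → at L s t ≢ 0 ⊎ at L t s ≢ 0) → Search L qa qb h tl (suc p)
    seed-skip s<n t<n p≡ d = record
      { h≤tl = h≤tl ; q-lt = q-lt ; q-inj = q-inj ; q-all = q-all ; anti = anti
      ; seed = seed ; seed<p = λ x<n y<n e → m<n⇒m<1+n (seed<p x<n y<n e)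
      ; closed = closed ; current = current
      ; decided = decide-next {L} s<n t<n p≡ id d }

    seed-push : ∀ {s t} → h ≡ tl → s < n → t < n → p ≡ n * s + t → s ≢ t →
      at L s t ≡ 0 → at L t s ≡ 0 →
      Search (update L (n * s + t) (suc p)) (update qa tl s) (update qb tl t) h (suc tl) (suc p)
    seed-push {s} {t} h≡tl s<n t<n p≡ s≢t st≡0 ts≡0 =
      push s<n t<n s≢t st≡0 ts≡0 ≤-refl (n≤1+n p)
        (seeded s<n t<n p≡ here (at-new {L} {s} {t} st≡0)
          (≮⇒≥ λ lt → [ (λ ts → ts ts≡0) , (λ st → st st≡0) ]′ (decided t<n s<n (s≢t ∘ sym) lt)))
        -- A seed is planted only when the queue is empty, so no waiting pair has another label.
        (λ h≤i i<tl → ⊥-elim (<⇒≱ i<tl (subst (_≤ _) h≡tl h≤i)))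
        (decide-next {L′} s<n t<n p≡ (at-keep-≢0 {L} {s} {t} st≡0)
          (λ _ → inj₁ (λ z → 1+n≢0 (trans (sym (at-new {L} {s} {t} st≡0)) z))))
      where L′ = update L (n * s + t) (suc p)

  empty : ∀ {L qa qb} → (∀ i → L i ≡ 0) → Search L qa qb 0 0 0
  empty L≡0 = record
    { h≤tl = z≤n ; q-lt = λ () ; q-inj = λ ()
    ; q-all = λ _ _ ne → contradiction (L≡0 _) ne
    ; anti = λ _ _ ne → contradiction (L≡0 _) ne
    ; seed = λ _ _ e → contradiction (trans (sym e) (L≡0 _)) 1+n≢0
    ; seed<p = λ _ _ e → contradiction (trans (sym e) (L≡0 _)) 1+n≢0
    ; closed = λ () ; current = λ _ () ; decided = λ _ _ _ () }

  oriented : ∀ {L qa qb h p} → Search L qa qb h h p → n * n ≤ p → Orientation (at L)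
  oriented {L} {h = h} S n²≤p = record
    { total  = λ x<n y<n x≢y → decided x<n y<n x≢y (<-≤-trans (code<n² x<n y<n) n²≤p)
    ; anti   = anti
    ; closed = λ {a} {b} {x} {y} a<n b<n ab f → let i , i<h , ea , eb = q-all a<n b<n ab in
        trans (closed i<h (subst₂ (λ a b → Forces a b x y) (sym ea) (sym eb) f)) (cong₂ (at L) ea eb)
    ; seed   = seed }
    where open Search S

-- The greedy sweep

swap : ℕ → ℕ → ℕ → ℕ
swap α β x with x ≟ α
... | yes _ = β
... | no _ with x ≟ β
...   | yes _ = α
...   | no _  = x

data SwapView (α β x : ℕ) : ℕ → Set where
  first  : x ≡ α → SwapView α β x β
  second : x ≢ α → x ≡ β → SwapView α β x α
  other  : x ≢ α → x ≢ β → SwapView α β x x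

swap-view : ∀ α β x → SwapView α β x (swap α β x)
swap-view α β x with x ≟ α
... | yes p = first p
... | no p with x ≟ β
...   | yes q = second p q
...   | no q  = other p q

swap-first : ∀ α β → swap α β α ≡ β
swap-first α β with α ≟ α
... | yes _ = refl
... | no ne = contradiction refl ne

swap-injective : ∀ α β {x y} → swap α β x ≡ swap α β y → x ≡ y
swap-injective α β {x} {y} eq with swap α β x | swap-view α β x | swap α β y | swap-view α β y
... | _ | first p    | _ | first q    = trans p (sym q)
... | _ | first p    | _ | second n q = contradiction (trans q eq) n
... | _ | first p    | _ | other n m  = contradiction (sym eq) m
... | _ | second n p | _ | first q    = contradiction (trans p (sym eq)) n
... | _ | second n p | _ | second m q = trans p (sym q)
... | _ | second n p | _ | other m q  = contradiction (sym eq) m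
... | _ | other n m  | _ | first q    = contradiction eq m
... | _ | other n m  | _ | second p q = contradiction eq n
... | _ | other n m  | _ | other p q  = eq

module Sweep (n : ℕ) (E : ℕ → ℕ → Set) (R₁ R₂ : ℕ → ℕ)
  (E-< : ∀ {u v} → E u v → u < n × v < n)
  (E-R₁ : ∀ {u v} → E u v → R₁ u < R₁ v)
  (E-R₂ : ∀ {u v} → E u v → R₂ v < R₂ u)
  (R₁-injective : ∀ {u v} → u < n → v < n → R₁ u ≡ R₁ v → u ≡ v)
  where

  -- An edge `E a b` has `a` as its left end on the first line but `b` on the second. Hence the
  -- right ends `b` and `a` are compared with the left ends `u` and `v`.
  Before : ℕ → ℕ → ℕ → ℕ → Set
  Before a b u v = R₁ b < R₁ u × R₂ a < R₂ v

  SameOrComparable : ℕ → ℕ → ℕ → ℕ → Set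
  SameOrComparable a b u v = (a ≡ u × b ≡ v) ⊎ Before a b u v ⊎ Before u v a b

  soc-sym : ∀ {a b u v} → SameOrComparable a b u v → SameOrComparable u v a b
  soc-sym (inj₁ (p , q)) = inj₁ (sym p , sym q)
  soc-sym (inj₂ c)       = inj₂ (Sum.swap c)

  record Valid (φ : ℕ → ℕ → ℕ) (j : ℕ) : Set where
    field
      range  : ∀ {a b} → E a b → φ a b < j
      proper : ∀ {a b u v} → E a b → E u v → φ a b ≡ φ u v → SameOrComparable a b u v

  -- The order in which the program meets the edges: by the rank of the left end, then by the name,
  -- not the position, of the other end.
  Earlier : ℕ → ℕ → ℕ → ℕ → Set
  Earlier r w a b = R₁ a < r ⊎ (R₁ a ≡ r × b < w)

  earlier? : ∀ r w a b → Dec (Earlier r w a b)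
  earlier? r w a b = (R₁ a <? r) ⊎-dec ((R₁ a ≟ r) ×-dec (b <? w))

  -- `top` and `≤top` say that one edge of each class is furthest to the right on both lines, which
  -- lets two numbers per colour stand for the whole class. `extend` is optimality in a form that
  -- can be proved edge by edge.
  record Greedy (r w : ℕ) (c : ℕ → ℕ → ℕ) (k : ℕ) (last₁ last₂ : ℕ → ℕ) : Set where
    field
      range  : ∀ {a b} → E a b → Earlier r w a b → c a b < k
      proper : ∀ {a b u v} → E a b → Earlier r w a b → E u v → Earlier r w u v →
               c a b ≡ c u v → SameOrComparable a b u v
      top    : ∀ {i} → i < k → ∃₂ λ a b → E a b × Earlier r w a b × c a b ≡ i ×
               last₁ i ≡ R₁ b × last₂ i ≡ R₂ a
      ≤top   : ∀ {a b} → E a b → Earlier r w a b →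
               R₁ b ≤ last₁ (c a b) × R₂ a ≤ last₂ (c a b)
      extend : ∀ {φ j} → Valid φ j →
               ∃ λ φ′ → Valid φ′ j × (∀ {a b} → E a b → Earlier r w a b → φ′ a b ≡ c a b)

  begin-greedy : ∀ {c last₁ last₂} → Greedy 0 0 c 0 last₁ last₂
  begin-greedy = record
    { range = λ { _ (inj₂ ()) } ; proper = λ { _ (inj₂ ()) } ; top = λ ()
    ; ≤top = λ { _ (inj₂ ()) } ; extend = λ {φ} V → φ , V , λ { _ (inj₂ ()) } }

  reindex : ∀ {r w r′ w′ c k last₁ last₂} →
    (∀ {a b} → E a b → Earlier r w a b → Earlier r′ w′ a b) →
    (∀ {a b} → E a b → Earlier r′ w′ a b → Earlier r w a b) →
    Greedy r w c k last₁ last₂ → Greedy r′ w′ c k last₁ last₂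
  reindex to from g = record
    { range  = λ e d → range e (from e d)
    ; proper = λ e d e′ d′ → proper e (from e d) e′ (from e′ d′)
    ; top    = λ i<k → let a , b , e , d , rest = top i<k in a , b , e , to e d , rest
    ; ≤top   = λ e d → ≤top e (from e d)
    ; extend = λ V → let φ′ , V′ , agree = extend V in φ′ , V′ , λ e d → agree e (from e d) }
    where open Greedy g

  next-row : ∀ {r c k last₁ last₂} → Greedy r n c k last₁ last₂ → Greedy (suc r) 0 c k last₁ last₂
  next-row = reindex
    (λ { _ (inj₁ lt) → inj₁ (m<n⇒m<1+n lt) ; _ (inj₂ (refl , _)) → inj₁ ≤-refl })
    (λ { e (inj₁ (s≤s le)) → [ inj₁ , (λ eq → inj₂ (eq , proj₂ (E-< e))) ]′ (m≤n⇒m<n∨m≡n le)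
       ; _ (inj₂ (_ , ())) })

  -- If `j < k`, the greedy colouring gives the colour `j` to some edge, by `top`; the colouring
  -- `φ′` obtained from `φ` agrees there, yet stays below `j`.
  optimal : ∀ {c k last₁ last₂ φ j} → Greedy n 0 c k last₁ last₂ → Valid φ j → k ≤ j
  optimal {j = j} g V with Greedy.extend g V
  ... | φ′ , V′ , agree = ≮⇒≥ λ j<k → let a , b , e , d , eq , _ = Greedy.top g j<k in
    <-irrefl (trans (agree e d) eq) (Valid.range V′ e)

  module Step {r u v : ℕ} {c : ℕ → ℕ → ℕ} {k : ℕ} {last₁ last₂ : ℕ → ℕ} (g : Greedy r v c k last₁ last₂)
    (v<n : v < n) where
    open Greedy g

    private
      split : R₁ u ≡ r → ∀ {a b} → u < n → E a b → Earlier r (suc v) a b →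
        Earlier r v a b ⊎ (a ≡ u × b ≡ v)
      split _ _ _ (inj₁ lt) = inj₁ (inj₁ lt)
      split Ru u<n e (inj₂ (eq , s≤s b≤v)) =
        [ (λ lt → inj₁ (inj₂ (eq , lt)))
        , (λ b≡v → inj₂ (R₁-injective (proj₁ (E-< e)) u<n (trans eq (sym Ru)) , b≡v))
        ]′ (m≤n⇒m<n∨m≡n b≤v)

      widen : ∀ {a b} → Earlier r v a b → Earlier r (suc v) a b
      widen = Sum.map₂ λ (eq , lt) → eq , m<n⇒m<1+n lt

    skip-pair : R₁ u ≡ r → u < n → ¬ E u v → Greedy r (suc v) c k last₁ last₂
    skip-pair Ru u<n ¬E = reindex (λ _ → widen)
      (λ e d → [ id , (λ { (refl , refl) → contradiction e ¬E }) ]′ (split Ru u<n e d)) g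

    Available : ℕ → Set
    Available i = last₁ i < r × last₂ i < R₂ v

    -- The index is the number of colours in use after the choice of `i`.
    data Choice (i : ℕ) : ℕ → Set where
      fresh  : i ≡ k → (∀ {i′} → i′ < k → ¬ Available i′) → Choice i (suc k)
      reused : i < k → Available i → (∀ {i′} → i′ < k → Available i′ → last₂ i′ ≤ last₂ i) →
               Choice i k

    private
      chosen-available : ∀ {i k′} → Choice i k′ → i < k → Available i
      chosen-available (fresh refl _)    i<k = contradiction i<k (<-irrefl refl)
      chosen-available (reused _ av _)   _   = av

      chosen-best : ∀ {i k′ i′} → Choice i k′ → i′ < k → Available i′ → i < k × last₂ i′ ≤ last₂ i
      chosen-best (fresh _ none)      i′<k av = contradiction av (none i′<k)
      chosen-best (reused i<k _ best) i′<k av = i<k , best i′<k av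

      i<k′ : ∀ {i k′} → Choice i k′ → i < k′
      i<k′ (fresh refl _)   = ≤-refl
      i<k′ (reused i<k _ _) = i<k

      k≤k′ : ∀ {i k′} → Choice i k′ → k ≤ k′
      k≤k′ (fresh _ _)    = n≤1+n k
      k≤k′ (reused _ _ _) = ≤-refl

      old-colour : ∀ {i k′ i′} → Choice i k′ → i ≢ i′ → i′ < k′ → i′ < k
      old-colour (fresh refl _)   i≢i′ i′<k′ = ≤∧≢⇒< (s≤s⁻¹ i′<k′) (i≢i′ ∘ sym)
      old-colour (reused _ _ _) _    i′<k′ = i′<k′

      -- If no old colour is available, the colour `α` of the current edge in the other colouring is
      -- not an old one either. So `k ≤ α < j`, and the fresh colour `k` fits.
      unless-fresh : ∀ {i k′ j α} → Choice i k′ → (i < k → i < j) →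
        (α < k → Available α) → α < j → i < j
      unless-fresh (fresh refl none) _ avail α<j = ≤-<-trans (≮⇒≥ λ α<k → none α<k (avail α<k)) α<j
      unless-fresh (reused i<k _ _)  f _     _   = f i<k

    module _ (Euv : E u v) (Ru : R₁ u ≡ r) {i k′ : ℕ} (ch : Choice i k′) {c′ : ℕ → ℕ → ℕ}
      (c′-new : c′ u v ≡ i) (c′-old : ∀ {a b} → E a b → Earlier r v a b → c′ a b ≡ c a b) where

      private
        u<n = proj₁ (E-< Euv)

        late : ¬ Earlier r v u v
        late (inj₁ lt)       = <-irrefl Ru lt
        late (inj₂ (_ , lt)) = <-irrefl refl lt

        late-≥ : ∀ {a b} → ¬ Earlier r v a b → r ≤ R₁ a
        late-≥ l = ≮⇒≥ (l ∘ inj₁)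

        earlier-≤ : ∀ {a b} → Earlier r v a b → R₁ a ≤ r
        earlier-≤ (inj₁ lt)       = <⇒≤ lt
        earlier-≤ (inj₂ (eq , _)) = ≤-reflexive eq

        -- The sweep visits left ends in increasing order, so a later edge cannot lie entirely to
        -- the left of an earlier one.
        forward : ∀ {a b x y} → E a b → E x y → Earlier r v a b → ¬ Earlier r v x y →
          SameOrComparable a b x y → Before a b x y
        forward _ _ d l (inj₁ (refl , refl)) = contradiction d l
        forward _ _ _ _ (inj₂ (inj₁ p))      = p
        forward _ ex d l (inj₂ (inj₂ (p , _))) =
          contradiction (<-≤-trans (<-≤-trans (<-trans (E-R₁ ex) p) (earlier-≤ d)) (late-≥ l)) (<-irrefl refl)

        chosen-before : ∀ {a b} → E a b → Earlier r v a b → c a b ≡ i → Before a b u v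
        chosen-before e d refl =
          let p , q = ≤top e d
              s , t = chosen-available ch (range e d)
          in  subst (_ <_) (sym Ru) (≤-<-trans p s) , ≤-<-trans q t

        last₁′ = update last₁ i (R₁ v)
        last₂′ = update last₂ i (R₂ u)

        top′ : ∀ {i′} → i′ < k′ → ∃₂ λ a b → E a b × Earlier r (suc v) a b × c′ a b ≡ i′ ×
          last₁′ i′ ≡ R₁ b × last₂′ i′ ≡ R₂ a
        top′ {i′} i′<k′ with i ≟ i′
        ... | yes i≡i′ = u , v , Euv , inj₂ (Ru , ≤-refl) , trans c′-new i≡i′ ,
          update-≡ last₁ i i≡i′ , update-≡ last₂ i i≡i′
        ... | no i≢i′ =
          let a , b , e , d , eq , l₁ , l₂ = top (old-colour ch i≢i′ i′<k′)
          in  a , b , e , widen d , trans (c′-old e d) eq ,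
              trans (update-≢ last₁ i i≢i′) l₁ , trans (update-≢ last₂ i i≢i′) l₂

        ≤top′ : ∀ {a b} → E a b → Earlier r (suc v) a b →
          R₁ b ≤ last₁′ (c′ a b) × R₂ a ≤ last₂′ (c′ a b)
        ≤top′ {a} {b} e d with split Ru u<n e d
        ... | inj₂ (refl , refl) =
          ≤-reflexive (sym (update-≡ last₁ i (sym c′-new))) ,
          ≤-reflexive (sym (update-≡ last₂ i (sym c′-new)))
        ... | inj₁ d′ with i ≟ c a b
        ...   | yes eq = let p , q = chosen-before e d′ (sym eq)
                             j≡ = trans eq (sym (c′-old e d′)) in
          subst (R₁ b ≤_) (sym (update-≡ last₁ i j≡))
            (<⇒≤ (<-trans p (E-R₁ Euv))) ,
          subst (R₂ a ≤_) (sym (update-≡ last₂ i j≡))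
            (<⇒≤ (<-trans q (E-R₂ Euv)))
        ...   | no ne = let p , q = ≤top e d′
                            ne′ = λ z → ne (trans z (c′-old e d′)) in
          subst (R₁ b ≤_) (trans (cong last₁ (sym (c′-old e d′))) (sym (update-≢ last₁ i ne′))) p ,
          subst (R₂ a ≤_) (trans (cong last₂ (sym (c′-old e d′))) (sym (update-≢ last₂ i ne′))) q

        proper′ : ∀ {a b x y} → E a b → Earlier r (suc v) a b → E x y → Earlier r (suc v) x y →
          c′ a b ≡ c′ x y → SameOrComparable a b x y
        proper′ e d e′ d′ eq with split Ru u<n e d | split Ru u<n e′ d′
        ... | inj₁ p | inj₁ q = proper e p e′ q (trans (sym (c′-old e p)) (trans eq (c′-old e′ q)))
        ... | inj₁ p | inj₂ (refl , refl) =
          inj₂ (inj₁ (chosen-before e p (trans (sym (c′-old e p)) (trans eq c′-new))))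
        ... | inj₂ (refl , refl) | inj₁ q =
          inj₂ (inj₂ (chosen-before e′ q (trans (sym (c′-old e′ q)) (trans (sym eq) c′-new))))
        ... | inj₂ (refl , refl) | inj₂ (refl , refl) = inj₁ (refl , refl)

        -- Exchange argument: in a colouring φ that agrees with the greedy one
        -- so far, swap the colours φ u v and i on all later edges.
        module Exchange {φ : ℕ → ℕ → ℕ} {j : ℕ} (V : Valid φ j)
          (agree : ∀ {a b} → E a b → Earlier r v a b → φ a b ≡ c a b) where

          α = φ u v

          φ′ : ℕ → ℕ → ℕ
          φ′ a b with earlier? r v a b
          ... | yes _ = φ a b
          ... | no _  = swap α i (φ a b)

          α-available : α < k → Available α
          α-available α<k =
            let a , b , e , d , eq , l₁ , l₂ = top α<k
                p , q = forward e Euv d late (Valid.proper V e Euv (trans (agree e d) eq))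
            in  subst₂ _<_ (sym l₁) Ru p , subst (_< R₂ v) (sym l₂) q

          i<j : i < j
          i<j = unless-fresh ch
            (λ i<k → let a , b , e , d , eq , _ = top i<k in
              subst (_< j) (trans (agree e d) eq) (Valid.range V e))
            α-available (Valid.range V Euv)

          range-φ′ : ∀ {a b} → E a b → φ′ a b < j
          range-φ′ {a} {b} e with earlier? r v a b
          ... | yes _ = Valid.range V e
          ... | no _ with swap α i (φ a b) | swap-view α i (φ a b)
          ...   | _ | first _    = i<j
          ...   | _ | second _ _ = Valid.range V Euv
          ...   | _ | other _ _  = Valid.range V e

          -- If `x y` changes from `α` to `i`, then `a b` precedes `u v` by the choice of `i`, and
          -- `u v` precedes or equals `x y` inside the class `α`. If it changes from `i` to `α`, the
          -- greedy choice matters: `a b` reaches at most to `last₂ α` on the second line, hence at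
          -- most to `last₂ i`, and the edge attaining `last₂ i` precedes `x y` inside the class
          -- `i`.
          across : ∀ {a b x y} → E a b → Earlier r v a b → E x y → ¬ Earlier r v x y →
            φ a b ≡ swap α i (φ x y) → SameOrComparable a b x y
          across {a} {b} {x} {y} e d e′ l eq with swap α i (φ x y) | swap-view α i (φ x y)
          ... | _ | other _ _ = Valid.proper V e e′ eq
          ... | _ | first φxy≡α with chosen-before e d (trans (sym (agree e d)) eq)
                                   | Valid.proper V Euv e′ (sym φxy≡α)
          ...   | before | inj₁ (refl , refl) = inj₂ (inj₁ before)
          ...   | p , q  | inj₂ (inj₁ (s , t)) =
            inj₂ (inj₁ (<-trans p (<-trans (E-R₁ Euv) s) , <-trans q (<-trans (E-R₂ Euv) t)))
          ...   | _      | inj₂ (inj₂ (s , _)) = contradiction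
            (≤-<-trans (late-≥ l) (<-trans (E-R₁ e′) (subst (_ <_) Ru s))) (<-irrefl refl)
          across {a} {b} {x} {y} e d e′ l eq | _ | second _ φxy≡i =
            let p , _       = forward e Euv d late (Valid.proper V e Euv eq)
                c≡α         = trans (sym (agree e d)) eq
                α<k         = subst (_< k) c≡α (range e d)
                i<k , l₂≤   = chosen-best ch α<k (α-available α<k)
                _ , q       = ≤top e d
                _ , _ , e″ , d″ , c≡i , _ , l₂ = top i<k
                _ , t       = forward e″ e′ d″ l
                                (Valid.proper V e″ e′ (trans (agree e″ d″) (trans c≡i (sym φxy≡i))))
            in  inj₂ (inj₁
                  ( <-≤-trans (subst (_ <_) Ru p) (late-≥ l)
                  , ≤-<-trans (≤-trans (subst (λ m → R₂ a ≤ last₂ m) c≡α q) l₂≤)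
                      (subst (_< R₂ y) (sym l₂) t)))

          proper-φ′ : ∀ {a b x y} → E a b → E x y → φ′ a b ≡ φ′ x y → SameOrComparable a b x y
          proper-φ′ {a} {b} {x} {y} e e′ eq with earlier? r v a b | earlier? r v x y
          ... | yes _ | yes _ = Valid.proper V e e′ eq
          ... | yes d | no l  = across e d e′ l eq
          ... | no l  | yes d = soc-sym (across e′ d e l (sym eq))
          ... | no _  | no _  = Valid.proper V e e′ (swap-injective α i eq)

          agree′ : ∀ {a b} → E a b → Earlier r (suc v) a b → φ′ a b ≡ c′ a b
          agree′ {a} {b} e d with split Ru u<n e d | earlier? r v a b
          ... | inj₁ d′ | yes _ = trans (agree e d′) (sym (c′-old e d′))
          ... | inj₁ d′ | no l  = contradiction d′ l
          ... | inj₂ (refl , refl) | yes d′ = contradiction d′ late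
          ... | inj₂ (refl , refl) | no _   = trans (swap-first α i) (sym c′-new)

      colour-pair : Greedy r (suc v) c′ k′ last₁′ last₂′
      colour-pair = record
        { range  = λ e d → [ (λ d′ → subst (_< k′) (sym (c′-old e d′)) (<-≤-trans (range e d′) (k≤k′ ch)))
                           , (λ { (refl , refl) → subst (_< k′) (sym c′-new) (i<k′ ch) }) ]′ (split Ru u<n e d)
        ; proper = proper′
        ; top    = top′
        ; ≤top   = ≤top′
        ; extend = λ V → let φ , V₁ , agree = extend V
                             open Exchange V₁ agree
                         in  φ′ , record { range = range-φ′ ; proper = proper-φ′ } , agree′ }

-- The programs

code : ℕ → ℕ → Expr
code x y = (var 0 ⊗ var x) ⊕ var y

unequal : Expr → Expr → Expr
unequal e f = (e ⊖ f) ⊕ (f ⊖ e)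

-- Variables: 0 holds n, 2 and 3 the ends h and tl of the queue, (4 , 5) the
-- next seed candidate.  Arrays: 0 holds the colours, 2 the labels, and 3 and
-- 4 the queue.
push-pair : ℕ → ℕ → Expr → Prog
push-pair x y l = 2 [ code x y ]≔ l ⨾ 3 [ var 3 ]≔ var x ⨾ 4 [ var 3 ]≔ var y ⨾ 3 ≔ var 3 ⊕ lit 1

unlabelled : ℕ → ℕ → Expr
unlabelled x y = lit 1 ⊖ (arr 2 (code x y) ⊕ arr 2 (code y x))

-- The pair `(x , y)` shares an end with the head of the queue, held in variables 6 and 7, and
-- `(z , w)` is the third side of their triangle. Products act as conjunctions of tests.
relax : ℕ → ℕ → ℕ → ℕ → Prog
relax x y z w =
  If ((unequal (arr 0 (code 6 7)) (arr 0 (code z w)) ⊗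
       (lit 1 ⊖ unequal (arr 0 (code 6 7)) (arr 0 (code x y)))) ⊗ unlabelled x y)
    (push-pair x y (arr 2 (code 6 7))) skip

process : Prog
process =
  6 ≔ arr 3 (var 2) ⨾ 7 ≔ arr 4 (var 2) ⨾
  For 8 (var 0) 1 1 (relax 6 8 7 8 ⨾ relax 8 7 6 8) ⨾ 2 ≔ var 2 ⊕ lit 1

next-candidate : Prog
next-candidate = 5 ≔ var 5 ⊕ lit 1 ⨾ If (var 0 ⊖ var 5) skip (5 ≔ lit 0 ⨾ 4 ≔ var 4 ⊕ lit 1)

try-seed : Prog
try-seed = If (unequal (arr 0 (code 4 5)) (lit 2) ⊗ unlabelled 4 5) (push-pair 4 5 (code 4 5 ⊕ lit 1)) skip

-- A round handles the head of the queue, or else tries the next seed candidate, or idles when both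
-- are exhausted. Each of the first two happens at most n² times, whence 2n² rounds.
search : Prog
search = For 1 (lit 2 ⊗ (var 0 ⊗ var 0)) 2 2
  (If (var 3 ⊖ var 2) process (If (var 0 ⊖ var 4) (try-seed ⨾ next-candidate) skip))

distance : ℕ → ℕ → ℕ
distance a b = (a ∸ b) + (b ∸ a)

distance≡0 : ∀ {a b} → distance a b ≡ 0 → a ≡ b
distance≡0 {a} {b} e = ≤-antisym (m∸n≡0⇒m≤n (m+n≡0⇒m≡0 (a ∸ b) e)) (m∸n≡0⇒m≤n (m+n≡0⇒n≡0 (a ∸ b) e))

≡⇒distance≡0 : ∀ {a b} → a ≡ b → distance a b ≡ 0
≡⇒distance≡0 {a} refl = cong₂ _+_ (n∸n≡0 a) (n∸n≡0 a)

≢0ˡ : ∀ {a b} → a * b ≢ 0 → a ≢ 0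
≢0ˡ ne refl = ne refl

≢0ʳ : ∀ {a b} → a * b ≢ 0 → b ≢ 0
≢0ʳ {a} ne refl = ne (*-zeroʳ a)

1∸≢0 : ∀ {a} → 1 ∸ a ≢ 0 → a ≡ 0
1∸≢0 {zero}  _  = refl
1∸≢0 {suc a} ne = contradiction (0∸n≡0 a) ne

1∸≡0 : ∀ {a} → 1 ∸ a ≡ 0 → a ≢ 0
1∸≡0 () refl

+≢0 : ∀ {a b} → a + b ≢ 0 → a ≢ 0 ⊎ b ≢ 0
+≢0 {zero}  ne = inj₂ ne
+≢0 {suc a} ne = inj₁ λ ()

-- Turns the adjacency matrix into the values of `col`, with colour 2 on the diagonal.
mark-diagonal : Prog
mark-diagonal = For 8 (var 0) 1 1 (0 [ code 8 8 ]≔ lit 2)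

signum : Expr → Expr
signum e = lit 1 ⊖ (lit 1 ⊖ e)

-- Arrays 5 and 6 receive the positions of the vertices on the two lines, and
-- array 7 the inverse of array 5.
count-one : Prog
count-one =
  11 ≔ var 11 ⊕ signum (arr 2 (code 10 9)) ⨾
  12 ≔ var 12 ⊕ ((arr 0 (code 10 9) ⊗ signum (arr 2 (code 9 10))) ⊕
                 ((lit 1 ⊖ arr 0 (code 10 9)) ⊗ signum (arr 2 (code 10 9))))

ranks : Prog
ranks = For 9 (var 0) 1 1
  (11 ≔ lit 0 ⨾ 12 ≔ lit 0 ⨾ For 10 (var 0) 1 1 count-one ⨾
   5 [ var 9 ]≔ var 11 ⨾ 6 [ var 9 ]≔ var 12 ⨾ 7 [ var 11 ]≔ var 9)

-- The edge (u , v), u = array 7 at r, is in variables 15 and 14; variable 16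
-- holds the number k of colours, and 17 the best colour so far, 18 its score:
-- the successor of its last position on the second line.  Arrays 8 and 9 hold
-- the last positions of the colour classes on the two lines.
consider : Prog
consider = If (((var 13 ⊖ arr 8 (var 19)) ⊗ (arr 6 (var 14) ⊖ arr 9 (var 19))) ⊗
               ((arr 9 (var 19) ⊕ lit 1) ⊖ var 18))
  (17 ≔ var 19 ⨾ 18 ≔ arr 9 (var 19) ⊕ lit 1) skip

best-colour : Prog
best-colour = 17 ≔ var 16 ⨾ 18 ≔ lit 0 ⨾ For 19 (var 16) 1 2 consider

-- Both orientations of the edge are written, because the output is read by names and the sweep goes
-- by positions. Variable 17 still equals `k` when no old colour was available, and exactly then the
-- last summand is 1.
assign-colour : Prog
assign-colour =
  1 [ code 15 14 ]≔ var 17 ⨾ 1 [ code 14 15 ]≔ var 17 ⨾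
  8 [ var 17 ]≔ arr 5 (var 14) ⨾ 9 [ var 17 ]≔ arr 6 (var 15) ⨾
  16 ≔ var 16 ⊕ (lit 1 ⊖ (var 16 ⊖ var 17))

colour-edge : Prog
colour-edge = If ((lit 1 ⊖ unequal (arr 0 (code 15 14)) (lit 1)) ⊗ (arr 5 (var 14) ⊖ var 13))
  (best-colour ⨾ assign-colour) skip

greedy : Prog
greedy = For 13 (var 0) 1 1 (15 ≔ arr 7 (var 13) ⨾ For 14 (var 0) 1 1 colour-edge)

-- Correctness of the programs

module Correctness (n M W : ℕ) (2≤M : 2 ≤ M) (M^100<W : M ^ 100 < W)
  (2n²<M : 2 * (n * n) < M) (n<M : n < M)
  (C : Colour) (_⊏_ : ℕ → ℕ → Set)
  (⊏-total : ∀ {x y} → x < n → y < n → x ≢ y → x ⊏ y ⊎ y ⊏ x)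
  (⊏-asym : ∀ {x y} → x < n → y < n → x ⊏ y → ¬ y ⊏ x)
  (⊏-forced : ∀ {a b x y} → a < n → b < n → a ⊏ b → Forcing.Forces n C a b x y → x ⊏ y)
  where

  open Colour C
  open Forcing n C
  open LexSearch n C _⊏_ ⊏-total ⊏-asym ⊏-forced
  open Verification n M W 2≤M M^100<W

  n²<M : n * n < M
  n²<M = ≤-<-trans (m≤m+n (n * n) _) 2n²<M

  record Context (τ : State) : Set where
    constructor context
    field
      n≡   : vars τ 0 ≡ n
      col≡ : ∀ {x y} → x < n → y < n → arrs τ 0 (n * x + y) ≡ col x y
  open Context

  context-frame : ∀ {σ τ} → vars τ 0 ≡ vars σ 0 → arrs τ 0 ≡ arrs σ 0 →
    Context σ → Context τ
  context-frame e e′ (context n≡ col≡) =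
    context (trans e n≡) λ {x} {y} x<n y<n → trans (cong (λ A → A (n * x + y)) e′) (col≡ x<n y<n)

  code≡ : ∀ {τ x y X Y} → vars τ 0 ≡ n → vars τ x ≡ X → vars τ y ≡ Y → ⟦ code x y ⟧ τ ≡ n * X + Y
  code≡ p q r = cong₂ _+_ (cong₂ _*_ p q) r

  colour≡ : ∀ {τ x y X Y} → Context τ → vars τ x ≡ X → vars τ y ≡ Y → X < n → Y < n →
    ⟦ arr 0 (code x y) ⟧ τ ≡ col X Y
  colour≡ {τ} ctx q r X<n Y<n = trans (cong (arrs τ 0) (code≡ {τ} (n≡ ctx) q r)) (col≡ ctx X<n Y<n)

  label≡ : ∀ {τ x y X Y} → Context τ → vars τ x ≡ X → vars τ y ≡ Y →
    ⟦ arr 2 (code x y) ⟧ τ ≡ at (arrs τ 2) X Y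
  label≡ {τ} ctx q r = cong (arrs τ 2) (code≡ {τ} (n≡ ctx) q r)

  pushed : State → ℕ → ℕ → ℕ → ℕ → State
  pushed τ X Y t l =
    writeVar (writeArr (writeArr (writeArr τ 2 (n * X + Y) l) 3 t X) 4 t Y) 3 (suc t)

  push-spec : ∀ {x y e τ Q X Y t l} {ok : T (small e)} → vars τ 0 ≡ n → ⟦ e ⟧ τ ≡ l →
    vars τ x ≡ X → vars τ y ≡ Y → vars τ 3 ≡ t → (Bounded τ → l ≤ M) → t < M →
    Q (pushed τ X Y t l) → Spec (push-pair x y e) τ Q
  push-spec {x} {y} {e} {τ} {Q} {ok = ok} n≡ refl refl refl refl l≤M t<M q =
    do-seq (do-arr {_} {code x y} {e} {_} {_} {_} {ok} l≤M
    (do-seq (do-arr (λ b → vars≤ b x)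
    (do-seq (do-arr (λ b → vars≤ b y)
    (do-var (λ _ → subst (_≤ M) (+-comm 1 _) t<M)
      (subst₂ (λ i t → Q (writeVar (writeArr (writeArr (writeArr τ 2 i (⟦ e ⟧ τ)) 3 (vars τ 3)
          (vars τ x)) 4 (vars τ 3) (vars τ y)) 3 t))
        (sym (cong (λ m → m * vars τ x + vars τ y) n≡)) (+-comm 1 _) q)))))))

  Searching : State → ℕ → ℕ → ℕ → Set
  Searching τ = Search (arrs τ 2) (arrs τ 3) (arrs τ 4)

  module _ {h p A B : ℕ} where

    record Relaxing (τ : State) : Set where
      constructor relaxing
      field
        searching : Searching τ h (vars τ 3) p
        h<tl      : h < vars τ 3
        a≡        : arrs τ 3 h ≡ A
        b≡        : arrs τ 4 h ≡ B
    open Relaxing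

    head-< : ∀ {τ} → Relaxing τ → A < n × B < n
    head-< (relaxing S h<tl refl refl) = let a , b , _ = Search.q-lt S h<tl in a , b

    record Relaxed⁺ (τ : State) (X Y : ℕ) (ρ : State) : Set where
      constructor relaxed⁺
      field
        still : Relaxing ρ
        new   : Relaxed (arrs ρ 2) A B X Y
        old   : ∀ {u v} → Relaxed (arrs τ 2) A B u v → Relaxed (arrs ρ 2) A B u v
    open Relaxed⁺

    relax-spec : ∀ {x y z w τ X Y Z V} → Context τ → Relaxing τ →
      vars τ 6 ≡ A → vars τ 7 ≡ B → vars τ x ≡ X → vars τ y ≡ Y → vars τ z ≡ Z → vars τ w ≡ V →
      X < n → Y < n → Z < n → V < n →
      (col A B ≡ col X Y → col A B ≢ col Z V → Forces A B X Y) →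
      (Forces A B X Y → col A B ≡ col X Y × col A B ≢ col Z V) →
      Spec (relax x y z w) τ (Relaxed⁺ τ X Y)
    relax-spec {x} {y} {z} {w} {τ} {X} {Y} {Z} {V} ctx R@(relaxing S h<tl refl refl)
      a≡ b≡ x≡ y≡ z≡ w≡ X<n Y<n Z<n V<n to from = do-if yes-case no-case
      where
      L = arrs τ 2
      ab≡ = colour≡ {τ} ctx a≡ b≡ (proj₁ (head-< R)) (proj₂ (head-< R))
      xy≡ = colour≡ {τ} ctx x≡ y≡ X<n Y<n
      zw≡ = colour≡ {τ} ctx z≡ w≡ Z<n V<n
      lxy≡ = label≡ {τ} ctx x≡ y≡
      lyx≡ = label≡ {τ} ctx y≡ x≡
      lab≡ = label≡ {τ} ctx a≡ b≡
      guard = (distance (col A B) (col Z V) * (1 ∸ distance (col A B) (col X Y))) *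
              (1 ∸ (at L X Y + at L Y X))
      guard≡ = cong₂ _*_
        (cong₂ _*_ (cong₂ distance ab≡ zw≡) (cong (1 ∸_) (cong₂ distance ab≡ xy≡)))
        (cong (1 ∸_) (cong₂ _+_ lxy≡ lyx≡))
      yes-case : _ → Spec (push-pair x y (arr 2 (code 6 7))) τ (Relaxed⁺ τ X Y)
      yes-case ne = push-spec (n≡ ctx) lab≡ x≡ y≡ refl (λ b → arrs≤ b 2 _)
        (≤-<-trans (tl≤n² S) n²<M)
        (relaxed⁺
          (relaxing (relax-push S h<tl f xy≡0 yx≡0) (m<n⇒m<1+n h<tl)
            (update-≢ (arrs τ 3) _ (<⇒≢ h<tl ∘ sym)) (update-≢ (arrs τ 4) _ (<⇒≢ h<tl ∘ sym)))
          (λ _ → trans (at-new {L} {X} {Y} xy≡0) (sym (at-keep {L} {X} {Y} xy≡0 (head-≢0 S h<tl))))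
          (relaxed-keep {L} {X} {Y} xy≡0 (head-≢0 S h<tl)))
        where
        g≢0 : guard ≢ 0
        g≢0 g≡0 = ne (trans guard≡ g≡0)
        factor : distance (col A B) (col Z V) * (1 ∸ distance (col A B) (col X Y)) ≢ 0
        factor = ≢0ˡ g≢0
        labels : at L X Y + at L Y X ≡ 0
        labels = 1∸≢0 (≢0ʳ {distance (col A B) (col Z V) * (1 ∸ distance (col A B) (col X Y))} g≢0)
        xy≡0 = m+n≡0⇒m≡0 (at L X Y) labels
        yx≡0 = m+n≡0⇒n≡0 (at L X Y) labels
        f : Forces A B X Y
        f = to (distance≡0 (1∸≢0 (≢0ʳ {distance (col A B) (col Z V)} factor)))
               (λ e → ≢0ˡ factor (≡⇒distance≡0 e))
      no-case : _ → Spec skip τ (Relaxed⁺ τ X Y)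
      no-case e = do-skip (relaxed⁺ R (λ f → relaxed-already S h<tl f (labelled f)) id)
        where
        labelled : Forces A B X Y → at L X Y ≢ 0 ⊎ at L Y X ≢ 0
        labelled f with m*n≡0⇒m≡0∨n≡0 (distance (col A B) (col Z V) * (1 ∸ distance (col A B) (col X Y)))
                          (trans (sym guard≡) e)
        ... | inj₂ l = +≢0 {at L X Y} (1∸≡0 l)
        ... | inj₁ l with m*n≡0⇒m≡0∨n≡0 (distance (col A B) (col Z V)) l
        ...   | inj₁ d = contradiction (distance≡0 d) (proj₂ (from f))
        ...   | inj₂ d = contradiction (≡⇒distance≡0 (proj₁ (from f))) (1∸≡0 d)

  record Processed (h p : ℕ) (τ : State) : Set where
    constructor processed-head
    field
      searching : Searching τ (suc h) (vars τ 3) p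
      head≡     : vars τ 2 ≡ suc h

  process-spec : ∀ {τ p} → Context τ → Searching τ (vars τ 2) (vars τ 3) p →
    vars τ 2 < vars τ 3 → Spec process τ (Processed (vars τ 2) p)
  process-spec {τ} {p} ctx S h<tl =
    do-seq (do-var (λ b → arrs≤ b 3 _) (do-seq (do-var (λ b → arrs≤ b 4 _)
    (do-seq (do-for n Inv (≤-reflexive (sym (trans (*-identityˡ (n ^ 1)) (*-identityʳ n)))) (<⇒≤ n<M)
      (λ ρ f → trans (fv f 0 _) (n≡ ctx))
      (relaxing S h<tl refl refl , λ ())
      step
      finish)))))
    where
    h = vars τ 2
    A = arrs τ 3 h
    B = arrs τ 4 h
    τ₂ = writeVar (writeVar τ 6 A) 7 B
    Inv : ℕ → State → Set
    Inv c ρ = Relaxing {h} {p} {A} {B} ρ ×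
      (∀ {c′} → c′ < c → Relaxed (arrs ρ 2) A B A c′ × Relaxed (arrs ρ 2) A B c′ B)
    A<n = proj₁ (head-< {h} {p} {A} {B} (relaxing {τ = τ} S h<tl refl refl))
    B<n = proj₂ (head-< {h} {p} {A} {B} (relaxing {τ = τ} S h<tl refl refl))
    step : ∀ c ρ → c < n → vars ρ 8 ≡ c →
      Frame (For 8 (var 0) 1 1 (relax 6 8 7 8 ⨾ relax 8 7 6 8)) τ₂ ρ → Inv c ρ →
      Spec (relax 6 8 7 8 ⨾ relax 8 7 6 8) ρ (λ ρ → Inv (suc c) (writeVar ρ 8 (suc c)))
    step c ρ c<n c≡ f (R , rel) =
      do-seq (weaken
        (λ {ρ₁} _ (f₁ , relaxed⁺ R₁ new₁ old₁) → weaken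
          (λ { _ (relaxed⁺ (relaxing S₂ lt₂ a₂ b₂) new₂ old₂) → relaxing S₂ lt₂ a₂ b₂ ,
            λ c′<1+c → [ (λ c′<c → let u , v = rel c′<c in old₂ (old₁ u) , old₂ (old₁ v))
                       , (λ { refl → old₂ new₁ , new₂ }) ]′ (m≤n⇒m<n∨m≡n (s≤s⁻¹ c′<1+c)) })
          (relax-spec {h} {p} {A} {B} {8} {7} {6} {8} (context-frame (fv f₁ 0 _) (fa f₁ 0 _) ctxρ) R₁
            (trans (fv f₁ 6 _) a≡) (trans (fv f₁ 7 _) b≡) (trans (fv f₁ 8 _) c≡)
            (trans (fv f₁ 7 _) b≡) (trans (fv f₁ 6 _) a≡) (trans (fv f₁ 8 _) c≡)
            c<n B<n A<n c<n
            (same-head c<n)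
            λ F → sym (forces-col F) , head-differs F))
        (framed-post (relax-spec {h} {p} {A} {B} {6} {8} {7} {8} ctxρ R a≡ b≡ a≡ c≡ b≡ c≡ A<n c<n B<n c<n
            (same-tail c<n)
            λ F → sym (forces-col F) , tail-differs F)))
      where
      ctxρ : Context ρ
      ctxρ = context-frame (fv f 0 _) (fa f 0 _) ctx
      a≡ : vars ρ 6 ≡ A
      a≡ = fv f 6 _
      b≡ : vars ρ 7 ≡ B
      b≡ = fv f 7 _
      A≢B : A ≢ B
      A≢B = labelled-≢ S A<n B<n (head-≢0 S h<tl)
      tail-differs : Forces A B A c → col A B ≢ col B c
      tail-differs F = go F refl
        where
        -- The tail is generalised so that the match can proceed. The pair `A → B` may also arise
        -- from `same-head`, with `c` equal to `B`; then the colour 2 of the diagonal decides.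
        go : ∀ {x} → Forces A B x c → x ≡ A → col A B ≢ col B c
        go (same-tail _ _ ne) _ = ne
        go (same-head _ e ne) refl e′ = A≢B (off (trans e′ (diag B)))
      head-differs : Forces A B c B → col A B ≢ col A c
      head-differs F = go F refl
        where
        go : ∀ {y} → Forces A B c y → y ≡ B → col A B ≢ col A c
        go (same-head _ _ ne) _ = ne
        go (same-tail _ e ne) refl e′ = A≢B (off (trans e′ (diag A)))
    finish : ∀ ρ → _ → Inv n ρ → Spec (2 ≔ var 2 ⊕ lit 1) ρ (Processed h p)
    finish ρ f (relaxing S′ h<tl′ a≡ b≡ , rel) = do-var
      (λ _ → subst (_≤ M) (+-comm 1 (vars ρ 2)) (subst (λ h → suc h ≤ M) (sym h≡)
        (≤-trans h<tl′ (≤-trans (tl≤n² S′) (<⇒≤ n²<M)))))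
      (processed-head (processed S′ h<tl′ (subst₂
          (λ A B → ∀ {c} → c < n → Relaxed (arrs ρ 2) A B A c × Relaxed (arrs ρ 2) A B c B)
          (sym a≡) (sym b≡) rel)) (trans (+-comm (vars ρ 2) 1) (cong suc h≡)))
      where
      h≡ : vars ρ 2 ≡ h
      h≡ = fv f 2 _

  -- The pair `(n , 0)`, with code n², marks the end of the candidates.
  Position : ℕ → ℕ → Set
  Position s t = (s < n × t < n) ⊎ (s ≡ n × t ≡ 0)

  record Advanced (p : ℕ) (τ : State) : Set where
    constructor advanced
    field
      next-code     : n * vars τ 4 + vars τ 5 ≡ suc p
      next-position : Position (vars τ 4) (vars τ 5)

  next-candidate-spec : ∀ {τ} → vars τ 0 ≡ n → vars τ 4 < n → vars τ 5 < n →
    Spec next-candidate τ (Advanced (n * vars τ 4 + vars τ 5))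
  next-candidate-spec {τ} n≡ s<n t<n =
    do-seq (do-var (λ _ → ≤-trans t+1≤n (<⇒≤ n<M)) (do-if
      (λ ne → do-skip (advanced t+1-code (inj₁ (s<n , ≤∧≢⇒< t+1≤n
        λ e → ne (trans (cong (_∸ (t + 1)) n≡) (trans (cong (n ∸_) e) (n∸n≡0 n)))))))
      (λ e → do-seq (do-var (λ _ → z≤n) (do-var (λ _ → ≤-trans s+1≤n (<⇒≤ n<M))
        (advanced
          (trans (+-identityʳ _) (trans (cong (n *_) (+-comm s 1)) (trans (*-suc n s)
            (trans (+-comm n (n * s)) (trans (cong (n * s +_) (t+1≡n e)) t+1-code)))))
          (next-row (m≤n⇒m<n∨m≡n s+1≤n))))))))
    where
    s = vars τ 4
    t = vars τ 5
    t+1≤n : t + 1 ≤ n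
    t+1≤n = subst (_≤ n) (+-comm 1 t) t<n
    s+1≤n : s + 1 ≤ n
    s+1≤n = subst (_≤ n) (+-comm 1 s) s<n
    t+1-code : n * s + (t + 1) ≡ suc (n * s + t)
    t+1-code = trans (cong (n * s +_) (+-comm t 1)) (+-suc (n * s) t)
    t+1≡n : vars τ 0 ∸ (t + 1) ≡ 0 → n ≡ t + 1
    t+1≡n e = ≤-antisym (m∸n≡0⇒m≤n (trans (cong (_∸ (t + 1)) (sym n≡)) e)) t+1≤n
    next-row : s + 1 < n ⊎ s + 1 ≡ n → Position (s + 1) 0
    next-row (inj₁ lt) = inj₁ (lt , ≤-<-trans z≤n lt)
    next-row (inj₂ e)  = inj₂ (e , refl)

  try-seed-spec : ∀ {τ} → Context τ → vars τ 2 ≡ vars τ 3 → vars τ 4 < n → vars τ 5 < n →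
    Searching τ (vars τ 2) (vars τ 3) (n * vars τ 4 + vars τ 5) →
    Spec try-seed τ (λ ρ → Searching ρ (vars ρ 2) (vars ρ 3)
      (suc (n * vars τ 4 + vars τ 5)))
  try-seed-spec {τ} ctx h≡tl s<n t<n S = do-if yes-case no-case
    where
    L = arrs τ 2
    s = vars τ 4
    t = vars τ 5
    guard = distance (col s t) 2 * (1 ∸ (at L s t + at L t s))
    guard≡ : _ ≡ guard
    guard≡ = cong₂ _*_ (cong (λ c → distance c 2) (colour≡ {τ} ctx refl refl s<n t<n))
      (cong (1 ∸_) (cong₂ _+_ (label≡ {τ} ctx refl refl) (label≡ {τ} ctx refl refl)))
    yes-case : _ → Spec (push-pair 4 5 (code 4 5 ⊕ lit 1)) τ _
    yes-case ne = push-spec (n≡ ctx)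
      (trans (+-comm _ 1) (cong suc (code≡ {τ} {4} {5} (n≡ ctx) refl refl))) refl refl refl
      (λ _ → ≤-trans (code<n² s<n t<n) (<⇒≤ n²<M)) (≤-<-trans (tl≤n² S) n²<M)
      (seed-push S h≡tl s<n t<n refl
        (λ s≡t → ≢0ˡ g≢0 (≡⇒distance≡0 (trans (cong (col s) (sym s≡t)) (diag s))))
        (m+n≡0⇒m≡0 (at L s t) labels) (m+n≡0⇒n≡0 (at L s t) labels))
      where
      g≢0 : guard ≢ 0
      g≢0 g≡0 = ne (trans guard≡ g≡0)
      labels : at L s t + at L t s ≡ 0
      labels = 1∸≢0 (≢0ʳ {distance (col s t) 2} g≢0)
    no-case : _ → Spec skip τ _
    no-case e = do-skip (seed-skip S s<n t<n refl λ s≢t →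
      [ (λ d → contradiction (off (distance≡0 d)) s≢t)
      , (λ l → +≢0 {at L s t} (1∸≡0 l)) ]′
      (m*n≡0⇒m≡0∨n≡0 (distance (col s t) 2) (trans (sym guard≡) e)))

  -- Every round that does not idle raises `h` or the candidate code by one. Both are at most n², so
  -- after 2n² rounds a sum equal to the counter means that both have reached n², and then the queue
  -- is empty as well.
  record Progress (i : ℕ) (τ : State) : Set where
    constructor progress
    field
      searching : Searching τ (vars τ 2) (vars τ 3) (n * vars τ 4 + vars τ 5)
      position  : Position (vars τ 4) (vars τ 5)
      steps     : vars τ 2 + (n * vars τ 4 + vars τ 5) ≡ i ⊎ (vars τ 2 ≡ vars τ 3 × vars τ 4 ≡ n)

  search-spec : ∀ {σ} → Context σ → (∀ i → arrs σ 2 i ≡ 0) →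
    vars σ 2 ≡ 0 → vars σ 3 ≡ 0 → vars σ 4 ≡ 0 → vars σ 5 ≡ 0 →
    Spec search σ (λ τ → Orientation (at (arrs τ 2)))
  search-spec {σ} ctx lab≡0 e₂ e₃ e₄ e₅ = do-for (2 * (n * n)) Progress
    (≤-reflexive (cong (λ m → 2 * (n * m)) (sym (*-identityʳ n)))) (<⇒≤ 2n²<M)
    (λ τ f → cong (λ m → 2 * (m * m)) (trans (fv f 0 _) (n≡ ctx)))
    start step finish
    where
    p≡0 : n * vars σ 4 + vars σ 5 ≡ 0
    p≡0 = cong₂ _+_ (trans (cong (n *_) e₄) (*-zeroʳ n)) e₅
    at-start : 0 < n ⊎ 0 ≡ n → Position 0 0
    at-start (inj₁ lt) = inj₁ (lt , lt)
    at-start (inj₂ e)  = inj₂ (e , refl)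
    start : Progress 0 (writeVar σ 1 0)
    start = progress
      (subst₂ (λ h tl → Searching σ h tl (n * vars σ 4 + vars σ 5)) (sym e₂) (sym e₃)
        (subst (Searching σ 0 0) (sym p≡0) (empty lab≡0)))
      (subst₂ Position (sym e₄) (sym e₅) (at-start (m≤n⇒m<n∨m≡n z≤n)))
      (inj₁ (cong₂ _+_ e₂ p≡0))
    step : ∀ i τ → i < 2 * (n * n) → vars τ 1 ≡ i → Frame search σ τ → Progress i τ →
      Spec _ τ (λ ρ → Progress (suc i) (writeVar ρ 1 (suc i)))
    step i τ _ _ f (progress S pos st) = do-if
      (λ ne → weaken
        (λ { {ρ} _ (f′ , processed-head S′ h≡) →
          let v₄ = fv f′ 4 _
              v₅ = fv f′ 5 _
              p≡ = cong₂ (λ s t → n * s + t) v₄ v₅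
          in  progress
            (subst₂ (λ h p → Searching ρ h (vars ρ 3) p) (sym h≡) (sym p≡) S′)
            (subst₂ Position (sym v₄) (sym v₅) pos)
            ([ (λ e → inj₁ (trans (cong₂ _+_ h≡ p≡) (cong suc e)))
             , (λ (h≡tl , _) → contradiction (trans (cong (vars τ 3 ∸_) h≡tl) (n∸n≡0 (vars τ 3))) ne)
             ]′ st) })
        (framed-post (process-spec ctxτ S (≰⇒> λ le → ne (m≤n⇒m∸n≡0 le)))))
      (λ tl∸h≡0 → let h≡tl = ≤-antisym (Search.h≤tl S) (m∸n≡0⇒m≤n tl∸h≡0) in do-if
        (λ ne → let s<n , t<n = candidate pos (λ s≡n → ne (trans (cong₂ _∸_ (n≡ ctxτ) s≡n) (n∸n≡0 n))) in
          do-seq (weaken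
            (λ {ρ} _ (f′ , S′) →
              let v₄ = fv f′ 4 _
                  v₅ = fv f′ 5 _
                  p≡ = cong₂ (λ s t → n * s + t) v₄ v₅
              in  weaken
                (λ { {ρ′} _ (f″ , advanced next-code next-position) →
                  progress
                    (subst (Search _ _ _ _ _) (sym (trans next-code (cong suc p≡)))
                      (subst₂ (λ h tl → Search (arrs ρ′ 2) (arrs ρ′ 3) (arrs ρ′ 4) h tl _)
                        (sym (fv f″ 2 _)) (sym (fv f″ 3 _))
                        (subst (λ A → Search A _ _ _ _ _) (sym (fa f″ 2 _))
                          (subst₂ (λ A B → Search _ A B _ _ _) (sym (fa f″ 3 _)) (sym (fa f″ 4 _)) S′))))
                    next-position
                    ([ (λ e → inj₁ (trans
                         (cong₂ _+_ (trans (fv f″ 2 _) (fv f′ 2 _)) (trans next-code (cong suc p≡)))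
                         (trans (+-suc (vars τ 2) _) (cong suc e))))
                     , (λ (_ , s≡n) → contradiction s<n (<-irrefl s≡n)) ]′ st) })
                (framed-post (next-candidate-spec (trans (fv f′ 0 _) (n≡ ctxτ))
                  (subst (_< n) (sym v₄) s<n) (subst (_< n) (sym v₅) t<n))))
            (framed-post (try-seed-spec ctxτ h≡tl s<n t<n S))))
        (λ n∸s≡0 → do-skip (progress S pos (inj₂ (h≡tl ,
          exhausted pos (m∸n≡0⇒m≤n (trans (cong (_∸ vars τ 4) (sym (n≡ ctxτ))) n∸s≡0)))))))
      where
      ctxτ : Context τ
      ctxτ = context-frame (fv f 0 _) (fa f 0 _) ctx
      candidate : ∀ {s t} → Position s t → s ≢ n → s < n × t < n
      candidate (inj₁ lt)      _   = lt
      candidate (inj₂ (e , _)) s≢n = contradiction e s≢n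
      exhausted : ∀ {s t} → Position s t → n ≤ s → s ≡ n
      exhausted (inj₁ (s<n , _)) n≤s = contradiction n≤s (<⇒≱ s<n)
      exhausted (inj₂ (e , _))   _   = e
    finish : ∀ τ → Frame search σ τ → Progress (2 * (n * n)) τ → Orientation (at (arrs τ 2))
    finish τ _ (progress S pos st) = conclude pos st
      where
      h≤n² : vars τ 2 ≤ n * n
      h≤n² = ≤-trans (Search.h≤tl S) (tl≤n² S)
      all-candidates : vars τ 4 ≡ n → n * n ≤ n * vars τ 4 + vars τ 5
      all-candidates e = ≤-trans (≤-reflexive (cong (n *_) (sym e))) (m≤m+n (n * vars τ 4) (vars τ 5))
      conclude : Position (vars τ 4) (vars τ 5) → _ → _
      conclude _ (inj₂ (h≡tl , s≡n)) =
        oriented (subst (λ tl → Searching τ (vars τ 2) tl (n * vars τ 4 + vars τ 5)) (sym h≡tl) S)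
          (all-candidates s≡n)
      conclude (inj₁ (s<n , t<n)) (inj₁ e) = contradiction e (<⇒≢ (begin-strict
        vars τ 2 + (n * vars τ 4 + vars τ 5) <⟨ +-mono-≤-< h≤n² (code<n² s<n t<n) ⟩
        n * n + n * n                        ≡⟨ cong (n * n +_) (+-identityʳ (n * n)) ⟨
        2 * (n * n)                          ∎))
        where open ≤-Reasoning
      conclude (inj₂ (s≡n , t≡0)) (inj₁ e) =
        oriented (subst (λ tl → Searching τ (vars τ 2) tl (n * vars τ 4 + vars τ 5)) tl≡h S)
          (all-candidates s≡n)
        where
        p≡n² : n * vars τ 4 + vars τ 5 ≡ n * n
        p≡n² = trans (cong₂ (λ s t → n * s + t) s≡n t≡0) (+-identityʳ (n * n))
        h≡n² : vars τ 2 ≡ n * n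
        h≡n² = +-cancelʳ-≡ (n * n) _ _ (trans (cong (vars τ 2 +_) (sym p≡n²))
          (trans e (cong (n * n +_) (+-identityʳ (n * n)))))
        tl≡h : vars τ 3 ≡ vars τ 2
        tl≡h = ≤-antisym (subst (vars τ 3 ≤_) (sym h≡n²) (tl≤n² S)) (Search.h≤tl S)

  n≤n^1 : n ≤ 1 * n ^ 1
  n≤n^1 = ≤-reflexive (sym (trans (*-identityˡ (n ^ 1)) (*-identityʳ n)))

  mark-diagonal-spec : ∀ {σ} → vars σ 0 ≡ n →
    (∀ {x y} → x < n → y < n → x ≢ y → arrs σ 0 (n * x + y) ≡ col x y) →
    Spec mark-diagonal σ Context
  mark-diagonal-spec {σ} n≡ off-diagonal = do-for n Inv n≤n^1 (<⇒≤ n<M)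
    (λ τ f → trans (fv f 0 _) n≡) (off-diagonal , λ ()) step
    (λ τ f (away , on) → context (trans (fv f 0 _) n≡) (everywhere (arrs τ 0) away on))
    where
    Inv : ℕ → State → Set
    Inv i τ = (∀ {x y} → x < n → y < n → x ≢ y → arrs τ 0 (n * x + y) ≡ col x y) ×
              (∀ {x} → x < i → arrs τ 0 (n * x + x) ≡ 2)
    everywhere : ∀ (A : ℕ → ℕ) →
      (∀ {x y} → x < n → y < n → x ≢ y → A (n * x + y) ≡ col x y) →
      (∀ {x} → x < n → A (n * x + x) ≡ 2) →
      ∀ {x y} → x < n → y < n → A (n * x + y) ≡ col x y
    everywhere A away on {x} {y} x<n y<n with x ≟ y
    ... | yes refl = trans (on x<n) (sym (diag x))
    ... | no x≢y   = away x<n y<n x≢y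
    step : ∀ i τ → i < n → vars τ 8 ≡ i → Frame mark-diagonal σ τ → Inv i τ →
      Spec (0 [ code 8 8 ]≔ lit 2) τ (λ ρ → Inv (suc i) (writeVar ρ 8 (suc i)))
    step i τ i<n i≡ f (away , on) = do-arr (λ _ → 2≤M)
      ( (λ {x} {y} x<n y<n x≢y → trans (update-≢ (arrs τ 0) _ λ e →
          let p , q = code-injective {x = i} {x} i<n y<n (trans (sym index) e) in
          x≢y (trans (sym p) q)) (away x<n y<n x≢y))
      , (λ {x} x<1+i → on-diagonal x (m≤n⇒m<n∨m≡n (s≤s⁻¹ x<1+i))) )
      where
      index : vars τ 0 * vars τ 8 + vars τ 8 ≡ n * i + i
      index = code≡ {τ} {8} {8} (trans (fv f 0 _) n≡) i≡ i≡
      on-diagonal : ∀ x → x < i ⊎ x ≡ i →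
        update (arrs τ 0) (vars τ 0 * vars τ 8 + vars τ 8) 2 (n * x + x) ≡ 2
      on-diagonal x (inj₂ refl) = update-≡ (arrs τ 0) _ index
      on-diagonal x (inj₁ x<i)  = trans (update-≢ (arrs τ 0) _ λ e →
        <⇒≢ x<i (sym (proj₁ (code-injective {x = i} {x} i<n (<-trans x<i i<n) (trans (sym index) e)))))
        (on x<i)

  module Ranked {L : ℕ → ℕ} (O : Orientation (at L)) where

    module O₁ = Coherent (coherent₁ O)
    module O₂ = Coherent (coherent₂ O)
    module K₁ = O₁.Rank (g₁ O) (g₁-1 O) (g₁-0 O)
    module K₂ = O₂.Rank (g₂ O) (g₂-1 O) (g₂-0 O)
    R₁ = K₁.rank
    R₂ = K₂.rank

    record RanksBelow (i : ℕ) (τ : State) : Set where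
      constructor ranks-below
      field
        rank₁≡  : ∀ {v} → v < i → arrs τ 5 v ≡ R₁ v
        rank₂≡  : ∀ {v} → v < i → arrs τ 6 v ≡ R₂ v
        vertex≡ : ∀ {v} → v < i → arrs τ 7 (R₁ v) ≡ v

    ranks-spec : ∀ {σ} → Context σ → arrs σ 2 ≡ L → Spec ranks σ (RanksBelow n)
    ranks-spec {σ} ctx L≡ = do-for n RanksBelow n≤n^1 (<⇒≤ n<M)
      (λ τ f → trans (fv f 0 _) (n≡ ctx))
      (ranks-below (λ ()) (λ ()) (λ ())) step (λ τ f r → r)
      where
      step : ∀ v τ → v < n → vars τ 9 ≡ v → Frame ranks σ τ → RanksBelow v τ →
        Spec _ τ (λ ρ → RanksBelow (suc v) (writeVar ρ 9 (suc v)))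
      step v τ v<n v≡ f (ranks-below r₁ r₂ p) =
        do-seq (do-var (λ _ → z≤n) (do-seq (do-var (λ _ → z≤n)
        (do-seq (do-for n Sums n≤n^1 (<⇒≤ n<M) (λ ρ f′ → trans (fv f′ 0 _) (trans (fv f 0 _) (n≡ ctx)))
          (refl , refl) count store)))))
        where
        τ₂ = writeVar (writeVar τ 11 0) 12 0
        Sums : ℕ → State → Set
        Sums u ρ = vars ρ 11 ≡ sumTo u (λ u → g₁ O u v) × vars ρ 12 ≡ sumTo u (λ u → g₂ O u v)
        count : ∀ u ρ → u < n → vars ρ 10 ≡ u → Frame (For 10 (var 0) 1 1 count-one) τ₂ ρ → Sums u ρ →
          Spec count-one ρ (λ ρ → Sums (suc u) (writeVar ρ 10 (suc u)))
        count u ρ u<n u≡ f′ (s₁ , s₂) =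
          do-seq (do-var (λ _ → subst (_≤ M) (sym t₁)
              (≤-trans (K₁.partial-rank≤ u<n v<n) (≤-trans u<n (<⇒≤ n<M))))
            (do-var (λ _ → subst (_≤ M) (sym t₂)
              (≤-trans (K₂.partial-rank≤ u<n v<n) (≤-trans u<n (<⇒≤ n<M))))
            (t₁ , t₂)))
          where
          ctxρ : Context ρ
          ctxρ = context-frame (trans (fv f′ 0 _) (fv f 0 _)) (trans (fa f′ 0 _) (fa f 0 _)) ctx
          v≡ρ : vars ρ 9 ≡ v
          v≡ρ = trans (fv f′ 9 _) v≡
          Lρ : arrs ρ 2 ≡ L
          Lρ = trans (fa f′ 2 _) (trans (fa f 2 _) L≡)
          labelled : ∀ {x y X Y} → vars ρ x ≡ X → vars ρ y ≡ Y → ⟦ arr 2 (code x y) ⟧ ρ ≡ at L X Y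
          labelled {X = X} {Y} p q = trans (label≡ {ρ} ctxρ p q) (cong (λ L → at L X Y) Lρ)
          t₁ : vars ρ 11 + sg (⟦ arr 2 (code 10 9) ⟧ ρ) ≡ sumTo (suc u) (λ u → g₁ O u v)
          t₁ = cong₂ _+_ s₁ (cong sg (labelled u≡ v≡ρ))
          t₂ : vars ρ 12 + (⟦ arr 0 (code 10 9) ⟧ ρ * sg (⟦ arr 2 (code 9 10) ⟧ ρ) +
                 (1 ∸ ⟦ arr 0 (code 10 9) ⟧ ρ) * sg (⟦ arr 2 (code 10 9) ⟧ ρ)) ≡
               sumTo (suc u) (λ u → g₂ O u v)
          t₂ = cong₂ _+_ s₂ (cong₂ _+_
            (cong₂ _*_ c≡ (cong sg (labelled v≡ρ u≡)))
            (cong₂ _*_ (cong (1 ∸_) c≡) (cong sg (labelled u≡ v≡ρ))))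
            where
            c≡ = colour≡ {ρ} ctxρ u≡ v≡ρ u<n v<n
        store : ∀ ρ → Frame (For 10 (var 0) 1 1 count-one) τ₂ ρ → Sums n ρ →
          Spec (5 [ var 9 ]≔ var 11 ⨾ 6 [ var 9 ]≔ var 12 ⨾ 7 [ var 11 ]≔ var 9) ρ
            (λ ρ → RanksBelow (suc v) (writeVar ρ 9 (suc v)))
        store ρ f′ (s₁ , s₂) = do-seq (do-arr (λ b → vars≤ b 11) (do-seq (do-arr (λ b → vars≤ b 12)
          (do-arr (λ b → vars≤ b 9) (ranks-below
            (λ {w} w<1+v → extend (arrs ρ 5) R₁ s₁ (λ w<v → trans (cong (λ A → A w) (fa f′ 5 _)) (r₁ w<v)) w<1+v)
            (λ {w} w<1+v → extend (arrs ρ 6) R₂ s₂ (λ w<v → trans (cong (λ A → A w) (fa f′ 6 _)) (r₂ w<v)) w<1+v)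
            (λ {w} w<1+v → inverse (m≤n⇒m<n∨m≡n (s≤s⁻¹ w<1+v))))))))
          where
          v≡ρ : vars ρ 9 ≡ v
          v≡ρ = trans (fv f′ 9 _) v≡
          extend : ∀ (A R : ℕ → ℕ) {s w} → s ≡ R v → (w < v → A w ≡ R w) → w < suc v →
            update A (vars ρ 9) s w ≡ R w
          extend A R s≡ old w<1+v with m≤n⇒m<n∨m≡n (s≤s⁻¹ w<1+v)
          ... | inj₂ refl = trans (update-≡ A _ v≡ρ) s≡
          ... | inj₁ w<v  = trans (update-≢ A _ λ e → <⇒≢ w<v (trans (sym e) v≡ρ)) (old w<v)
          inverse : ∀ {w} → w < v ⊎ w ≡ v → update (arrs ρ 7) (vars ρ 11) (vars ρ 9) (R₁ w) ≡ w
          inverse (inj₂ refl) = trans (update-≡ (arrs ρ 7) _ s₁) v≡ρ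
          inverse {w} (inj₁ w<v) = trans
            (update-≢ (arrs ρ 7) _ λ e → <⇒≢ w<v
              (K₁.rank-injective (<-trans w<v v<n) v<n (trans (sym e) s₁)))
            (trans (cong (λ A → A (R₁ w)) (fa f′ 7 _)) (p w<v))

  -- Correctness of the colouring sweep

  module Coloured {L : ℕ → ℕ} (O : Orientation (at L)) where
    open Ranked {L} O
    open RanksBelow

    E : ℕ → ℕ → Set
    E u v = (u < n × v < n) × col u v ≡ 1 × R₁ u < R₁ v

    E-R₂ : ∀ {u v} → E u v → R₂ v < R₂ u
    E-R₂ {u} {v} ((u<n , v<n) , c , lt) = K₂.rank-mono v<n u<n
      (inj₁ (trans (col-sym v u) c , K₁.rank-reflects u<n v<n lt))

    open Sweep n E R₁ R₂ proj₁ (λ e → proj₂ (proj₂ e)) E-R₂ K₁.rank-injective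

    -- The colours i < m have been considered.
    data Best (r s k : ℕ) (last₁ last₂ : ℕ → ℕ) (m : ℕ) : ℕ → ℕ → Set where
      none : (∀ {i} → i < m → ¬ (last₁ i < r × last₂ i < s)) → Best r s k last₁ last₂ m k 0
      some : ∀ {b} → b < k → last₁ b < r × last₂ b < s →
             (∀ {i} → i < m → last₁ i < r × last₂ i < s → last₂ i ≤ last₂ b) →
             Best r s k last₁ last₂ m b (suc (last₂ b))

    module _ {r s k : ℕ} {last₁ last₂ : ℕ → ℕ} {m : ℕ} (m<k : m < k) where

      private
        up-to : ∀ {P : ℕ → Set} → (∀ {i} → i < m → P i) → P m → ∀ {i} → i < suc m → P i
        up-to old new i<1+m = [ old , (λ { refl → new }) ]′ (m≤n⇒m<n∨m≡n (s≤s⁻¹ i<1+m))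

      best-take : ∀ {b z} → last₁ m < r → last₂ m < s → z < suc (last₂ m) →
        Best r s k last₁ last₂ m b z → Best r s k last₁ last₂ (suc m) m (suc (last₂ m))
      best-take p q _  (none no-av) =
        some m<k (p , q) (up-to {λ i → last₁ i < r × last₂ i < s → last₂ i ≤ last₂ m}
          (λ i<m av → contradiction av (no-av i<m)) (λ _ → ≤-refl))
      best-take p q lt (some _ _ best) =
        some m<k (p , q) (up-to {λ i → last₁ i < r × last₂ i < s → last₂ i ≤ last₂ m}
          (λ i<m av → ≤-trans (best i<m av) (<⇒≤ (s≤s⁻¹ lt))) (λ _ → ≤-refl))

      best-keep : ∀ {b z} → (last₁ m < r → last₂ m < s → suc (last₂ m) ≤ z) →
        Best r s k last₁ last₂ m b z → Best r s k last₁ last₂ (suc m) b z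
      best-keep worse (none no-av) =
        none (up-to {λ i → ¬ (last₁ i < r × last₂ i < s)} no-av (λ (p , q) → contradiction (worse p q) λ ()))
      best-keep {b} worse (some b<k av best) =
        some b<k av (up-to {λ i → last₁ i < r × last₂ i < s → last₂ i ≤ last₂ b} best
          (λ (p , q) → s≤s⁻¹ (worse p q)))

    best⇒choice : ∀ {r u v k last₁ last₂ b z} {c : ℕ → ℕ → ℕ} (g : Greedy r v c k last₁ last₂) (v<n : v < n) →
      Best r (R₂ v) k last₁ last₂ k b z → Step.Choice {u = u} g v<n b (k + (1 ∸ (k ∸ b)))
    best⇒choice {k = k} g v<n (none no-av) = subst (Step.Choice g v<n k)
      (sym (trans (cong (λ d → k + (1 ∸ d)) (n∸n≡0 k)) (+-comm k 1))) (Step.fresh refl no-av)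
    best⇒choice {k = k} {b = b} g v<n (some b<k av best) = subst (Step.Choice g v<n b)
      (sym (trans (cong (k +_) (m≤n⇒m∸n≡0 (m<n⇒0<n∸m b<k))) (+-identityʳ k))) (Step.reused b<k av best)

    best-colour-spec : ∀ {τ r v} → vars τ 13 ≡ r → vars τ 14 ≡ v → v < n → arrs τ 6 v ≡ R₂ v →
      vars τ 16 ≤ n * n →
      Spec best-colour τ (λ ρ → ∃ λ z →
        Best r (R₂ v) (vars τ 16) (arrs τ 8) (arrs τ 9) (vars τ 16) (vars ρ 17) z)
    best-colour-spec {τ} {r} {v} r≡ v≡ v<n R₂≡ k≤n² =
      do-seq (do-var (λ b → vars≤ b 16) (do-seq (do-var (λ _ → z≤n)
      (do-for k Inv (≤-trans k≤n² (≤-reflexive (sym (trans (*-identityˡ (n * (n * 1))) (cong (n *_) (*-identityʳ n))))))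
        (≤-trans k≤n² (<⇒≤ n²<M)) (λ ρ f → fv f 16 _) (none λ ()) step (λ ρ f inv → _ , inv)))))
      where
      k = vars τ 16
      last₁ = arrs τ 8
      last₂ = arrs τ 9
      τ₂ = writeVar (writeVar τ 17 k) 18 0
      Inv : ℕ → State → Set
      Inv m ρ = Best r (R₂ v) k last₁ last₂ m (vars ρ 17) (vars ρ 18)
      step : ∀ m ρ → m < k → vars ρ 19 ≡ m → Frame (For 19 (var 16) 1 2 consider) τ₂ ρ → Inv m ρ →
        Spec consider ρ (λ ρ → Inv (suc m) (writeVar ρ 19 (suc m)))
      step m ρ m<k m≡ f inv = do-if
        (λ ne → let g≢0 = λ z → ne (trans guard≡ z)
                    pq  = ≢0ˡ g≢0
                    p   = m∸n≢0⇒n<m (≢0ˡ pq)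
                    q   = m∸n≢0⇒n<m (≢0ʳ {r ∸ last₁ m} pq)
                    z<  = m∸n≢0⇒n<m (≢0ʳ {(r ∸ last₁ m) * (R₂ v ∸ last₂ m)} g≢0)
                    l≤  = ≤-trans (≤-trans q (<⇒≤ (K₂.rank<n v<n))) (<⇒≤ n<M)
          in do-seq (do-var (λ b → vars≤ b 19) (do-var (λ _ → subst (_≤ M) (sym score≡) l≤)
            (subst₂ (Best r (R₂ v) k last₁ last₂ (suc m)) (sym m≡) (sym score≡)
              (best-take m<k p q z< inv)))))
        (λ e → do-skip (best-keep m<k
          (λ p q → ≮⇒≥ λ z< → zero-product (trans (sym guard≡) e) (m<n⇒0<n∸m p) (m<n⇒0<n∸m q) (m<n⇒0<n∸m z<))
          inv))
        where
        last₂≡ : arrs ρ 9 (vars ρ 19) ≡ last₂ m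
        last₂≡ = cong₂ (λ A i → A i) (fa f 9 _) m≡
        score≡ : arrs ρ 9 (vars ρ 19) + 1 ≡ suc (last₂ m)
        score≡ = trans (+-comm _ 1) (cong suc last₂≡)
        guard≡ : ((vars ρ 13 ∸ arrs ρ 8 (vars ρ 19)) * (arrs ρ 6 (vars ρ 14) ∸ arrs ρ 9 (vars ρ 19))) *
                   ((arrs ρ 9 (vars ρ 19) + 1) ∸ vars ρ 18) ≡
                 ((r ∸ last₁ m) * (R₂ v ∸ last₂ m)) * (suc (last₂ m) ∸ vars ρ 18)
        guard≡ = cong₂ _*_
          (cong₂ _*_
            (cong₂ _∸_ (trans (fv f 13 _) r≡) (cong₂ (λ A i → A i) (fa f 8 _) m≡))
            (cong₂ _∸_ (trans (cong₂ (λ A i → A i) (fa f 6 _) (trans (fv f 14 _) v≡)) R₂≡) last₂≡))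
          (cong (_∸ vars ρ 18) score≡)
        zero-product : ∀ {a b c} → (a * b) * c ≡ 0 → 0 < a → 0 < b → 0 < c → ⊥
        zero-product {a} {b} e 0<a 0<b 0<c with m*n≡0⇒m≡0∨n≡0 (a * b) e
        ... | inj₂ refl = <-irrefl refl 0<c
        ... | inj₁ e′ with m*n≡0⇒m≡0∨n≡0 a e′
        ...   | inj₁ refl = <-irrefl refl 0<a
        ...   | inj₂ refl = <-irrefl refl 0<b

    -- At most one colour is added per visited pair; `k≤` thus bounds the scan over the colours by
    -- n² and keeps `k` within a word.
    record Painted (r w : ℕ) (τ : State) : Set where
      constructor painted
      field
        greedily  : Greedy r w (at (arrs τ 1)) (vars τ 16) (arrs τ 8) (arrs τ 9)
        symmetric : ∀ {a b} → E a b → Earlier r w a b → at (arrs τ 1) b a ≡ at (arrs τ 1) a b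
        k≤        : vars τ 16 ≤ n * r + w

    assign-colour-spec : ∀ {τ r u v} → vars τ 0 ≡ n → vars τ 15 ≡ u → vars τ 14 ≡ v → R₁ u ≡ r → E u v →
      r < n → arrs τ 5 v ≡ R₁ v → arrs τ 6 u ≡ R₂ u → Painted r v τ →
      (∃ λ z → Best r (R₂ v) (vars τ 16) (arrs τ 8) (arrs τ 9) (vars τ 16) (vars τ 17) z) →
      Spec assign-colour τ (Painted r (suc v))
    assign-colour-spec {τ} {r} {u} {v} n≡ u≡ v≡ Ru Euv@((u<n , v<n) , _ , _) r<n r₁≡ r₂≡
      (painted g sym-g k≤) (z , best) =
      do-seq (do-arr (λ b → vars≤ b 17) (do-seq (do-arr (λ b → vars≤ b 17)
      (do-seq (do-arr (λ b → arrs≤ b 5 _) (do-seq (do-arr (λ b → arrs≤ b 6 _)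
      (do-var (λ _ → ≤-trans k′≤ (≤-trans (code<n² r<n v<n) (<⇒≤ n²<M)))
        (painted
          (subst₂ (λ p q → Greedy r (suc v) (at out′) k′ (update last₁ c p) (update last₂ c q))
            (sym (trans (cong (arrs τ 5) v≡) r₁≡)) (sym (trans (cong (arrs τ 6) u≡) r₂≡))
            (Step.colour-pair g v<n Euv Ru (best⇒choice g v<n best) out′-new out′-old))
          sym′
          (≤-trans k′≤ (≤-reflexive (sym (+-suc (n * r) v)))))))))))))
      where
      k = vars τ 16
      c = vars τ 17
      k′ = k + (1 ∸ (k ∸ c))
      last₁ = arrs τ 8
      last₂ = arrs τ 9
      i₁ = vars τ 0 * vars τ 15 + vars τ 14
      i₂ = vars τ 0 * vars τ 14 + vars τ 15
      out = arrs τ 1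
      out₁ = update out i₁ c
      out′ = update out₁ i₂ c
      i₁≡ : i₁ ≡ n * u + v
      i₁≡ = code≡ {τ} {15} {14} n≡ u≡ v≡
      i₂≡ : i₂ ≡ n * v + u
      i₂≡ = code≡ {τ} {14} {15} n≡ v≡ u≡
      k′≤ : k′ ≤ suc (n * r + v)
      k′≤ = ≤-trans (+-mono-≤ k≤ (m∸n≤m 1 (k ∸ c))) (≤-reflexive (+-comm (n * r + v) 1))
      u≢v : u ≢ v
      u≢v refl = <-irrefl refl (proj₂ (proj₂ Euv))
      out′-new : at out′ u v ≡ c
      out′-new = trans (update-≢ out₁ i₂ λ e →
        u≢v (sym (proj₁ (code-injective {x = v} {u} u<n v<n (trans (sym i₂≡) e)))))
        (update-≡ out i₁ i₁≡)
      elsewhere : ∀ {a b} → a < n → b < n → ¬ (u ≡ a × v ≡ b) → ¬ (v ≡ a × u ≡ b) → at out′ a b ≡ at out a b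
      elsewhere {a} {b} a<n b<n p q = trans
        (update-≢ out₁ i₂ λ e → q (code-injective {x = v} {a} u<n b<n (trans (sym i₂≡) e)))
        (update-≢ out i₁ λ e → p (code-injective {x = u} {a} v<n b<n (trans (sym i₁≡) e)))
      not-late : ¬ Earlier r v u v
      not-late (inj₁ lt)       = <-irrefl Ru lt
      not-late (inj₂ (_ , lt)) = <-irrefl refl lt
      not-reversed : ¬ E v u
      not-reversed (_ , _ , lt) = <-asym lt (proj₂ (proj₂ Euv))
      out′-old : ∀ {a b} → E a b → Earlier r v a b → at out′ a b ≡ at out a b
      out′-old e d = elsewhere (proj₁ (proj₁ e)) (proj₂ (proj₁ e))
        (λ { (refl , refl) → not-late d }) (λ { (refl , refl) → not-reversed e })
      sym′ : ∀ {a b} → E a b → Earlier r (suc v) a b → at out′ b a ≡ at out′ a b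
      sym′ {a} {b} e d with u ≟ a | v ≟ b
      ... | yes refl | yes refl = trans (update-≡ out₁ i₂ i₂≡) (sym out′-new)
      ... | no u≢a   | _        = trans
        (elsewhere (proj₂ (proj₁ e)) (proj₁ (proj₁ e))
          (λ { (refl , refl) → not-reversed e }) (λ { (_ , u≡a) → u≢a u≡a }))
        (trans (sym-g e d′) (sym (out′-old e d′)))
        where
        d′ = earlier-unless d λ eq → u≢a (sym (K₁.rank-injective (proj₁ (proj₁ e)) u<n (trans eq (sym Ru))))
          where
          earlier-unless : Earlier r (suc v) a b → R₁ a ≢ r → Earlier r v a b
          earlier-unless (inj₁ lt)       _  = inj₁ lt
          earlier-unless (inj₂ (eq , _)) ne = contradiction eq ne
      ... | yes refl | no v≢b   = trans
        (elsewhere (proj₂ (proj₁ e)) (proj₁ (proj₁ e))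
          (λ { (refl , refl) → not-reversed e }) (λ { (v≡b , _) → v≢b v≡b }))
        (trans (sym-g e d′) (sym (out′-old e d′)))
        where
        d′ : Earlier r v a b
        d′ = Sum.map₂ (λ (eq , lt) → eq , ≤∧≢⇒< (s≤s⁻¹ lt) (v≢b ∘ sym)) d

    colour-edge-spec : ∀ {τ r u v} → Context τ → vars τ 13 ≡ r → vars τ 15 ≡ u → vars τ 14 ≡ v →
      u < n → v < n → r < n → R₁ u ≡ r → RanksBelow n τ → Painted r v τ →
      Spec colour-edge τ (Painted r (suc v))
    colour-edge-spec {τ} {r} {u} {v} ctx r≡ u≡ v≡ u<n v<n r<n Ru rk P@(painted g sym-g k≤) =
      do-if yes-case no-case
      where
      guard = (1 ∸ distance (col u v) 1) * (R₁ v ∸ r)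
      guard≡ : (1 ∸ distance (⟦ arr 0 (code 15 14) ⟧ τ) 1) * (arrs τ 5 (vars τ 14) ∸ vars τ 13) ≡ guard
      guard≡ = cong₂ _*_ (cong (λ d → 1 ∸ distance d 1) (colour≡ {τ} ctx u≡ v≡ u<n v<n))
        (cong₂ _∸_ (trans (cong (arrs τ 5) v≡) (rank₁≡ rk v<n)) r≡)
      yes-case : _ → Spec (best-colour ⨾ assign-colour) τ (Painted r (suc v))
      yes-case ne = do-seq (weaken
        (λ { {ρ} _ (f , z , best) → assign-colour-spec
          (trans (fv f 0 _) (n≡ ctx)) (trans (fv f 15 _) u≡) (trans (fv f 14 _) v≡) Ru Euv r<n
          (trans (cong (λ A → A v) (fa f 5 _)) (rank₁≡ rk v<n))
          (trans (cong (λ A → A u) (fa f 6 _)) (rank₂≡ rk u<n))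
          (painted
            (subst (λ o → Greedy r v (at o) (vars ρ 16) (arrs ρ 8) (arrs ρ 9)) (sym (fa f 1 _))
              (subst (λ k → Greedy r v (at (arrs τ 1)) k (arrs ρ 8) (arrs ρ 9)) (sym (fv f 16 _))
                (subst₂ (Greedy r v (at (arrs τ 1)) (vars τ 16)) (sym (fa f 8 _)) (sym (fa f 9 _)) g)))
            (subst (λ o → ∀ {a b} → E a b → Earlier r v a b → at o b a ≡ at o a b) (sym (fa f 1 _)) sym-g)
            (subst (_≤ n * r + v) (sym (fv f 16 _)) k≤))
          (z , subst (λ k → Best r (R₂ v) k (arrs ρ 8) (arrs ρ 9) k (vars ρ 17) z) (sym (fv f 16 _))
            (subst₂ (λ A B → Best r (R₂ v) (vars τ 16) A B (vars τ 16) (vars ρ 17) z)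
              (sym (fa f 8 _)) (sym (fa f 9 _)) best)) })
        (framed-post (best-colour-spec r≡ v≡ v<n (rank₂≡ rk v<n)
          (≤-trans k≤ (<⇒≤ (code<n² r<n v<n))))))
        where
        g≢0 : guard ≢ 0
        g≢0 z = ne (trans guard≡ z)
        Euv : E u v
        Euv = (u<n , v<n) , distance≡0 (1∸≢0 (≢0ˡ g≢0)) ,
          subst (_< R₁ v) (sym Ru) (m∸n≢0⇒n<m (≢0ʳ {1 ∸ distance (col u v) 1} g≢0))
      no-case : _ → Spec skip τ (Painted r (suc v))
      no-case e = do-skip (painted (Step.skip-pair g v<n Ru u<n not-E)
        (λ e d → sym-g e (narrow e d))
        (≤-trans k≤ (+-monoʳ-≤ (n * r) (n≤1+n v))))
        where
        not-E : ¬ E u v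
        not-E (_ , c , lt) with m*n≡0⇒m≡0∨n≡0 (1 ∸ distance (col u v) 1) (trans (sym guard≡) e)
        ... | inj₁ d = 1∸≡0 d (≡⇒distance≡0 c)
        ... | inj₂ d = <⇒≱ lt (≤-trans (m∸n≡0⇒m≤n d) (≤-reflexive (sym Ru)))
        narrow : ∀ {a b} → E a b → Earlier r (suc v) a b → Earlier r v a b
        narrow _ (inj₁ lt) = inj₁ lt
        narrow e (inj₂ (eq , lt)) with m≤n⇒m<n∨m≡n (s≤s⁻¹ lt)
        ... | inj₁ b<v = inj₂ (eq , b<v)
        ... | inj₂ refl = contradiction
          (subst (λ a → E a v) (K₁.rank-injective (proj₁ (proj₁ e)) u<n (trans eq (sym Ru))) e) not-E

    greedy-spec : ∀ {σ} → Context σ → RanksBelow n σ → vars σ 16 ≡ 0 → Spec greedy σ (Painted n 0)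
    greedy-spec {σ} ctx rk k≡0 = do-for n (λ r → Painted r 0) n≤n^1 (<⇒≤ n<M)
      (λ τ f → trans (fv f 0 _) (n≡ ctx))
      (painted (subst (λ k → Greedy 0 0 _ k _ _) (sym k≡0) begin-greedy) (λ { _ (inj₂ ()) })
        (≤-trans (≤-reflexive k≡0) z≤n))
      row (λ _ _ P → P)
      where
      row : ∀ r τ → r < n → vars τ 13 ≡ r → Frame greedy σ τ → Painted r 0 τ →
        Spec _ τ (λ ρ → Painted (suc r) 0 (writeVar ρ 13 (suc r)))
      row r τ r<n r≡ f (painted g s k≤) = do-seq (do-var (λ b → arrs≤ b 7 _)
        (do-for n (λ v → Painted r v) n≤n^1 (<⇒≤ n<M)
          (λ ρ f′ → trans (fv f′ 0 _) (trans (fv f 0 _) (n≡ ctx)))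
          (painted g s k≤)
          (λ v ρ v<n v≡ f′ P → weaken (λ { _ (painted g s k≤) → painted g s k≤ })
            (colour-edge-spec
              (context-frame (trans (fv f′ 0 _) (fv f 0 _)) (trans (fa f′ 0 _) (fa f 0 _)) ctx)
              (trans (fv f′ 13 _) r≡) (trans (fv f′ 15 _) u≡) v≡ u<n v<n r<n Ru
              (ranks-below
                (λ {w} w<n → trans (cong (λ A → A w) (trans (fa f′ 5 _) (fa f 5 _))) (rank₁≡ rk w<n))
                (λ {w} w<n → trans (cong (λ A → A w) (trans (fa f′ 6 _) (fa f 6 _))) (rank₂≡ rk w<n))
                (λ {w} w<n → trans (cong (λ A → A (R₁ w)) (trans (fa f′ 7 _) (fa f 7 _))) (vertex≡ rk w<n)))
              P))
          (λ { ρ _ (painted g s k≤) → painted (next-row g) (λ e d → s e (previous-row e d))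
            (≤-trans k≤ (≤-reflexive (trans (+-comm (n * r) n) (trans (sym (*-suc n r)) (sym (+-identityʳ _)))))) })))
        where
        u = proj₁ (K₁.rank-surjective r<n)
        u<n = proj₁ (proj₂ (K₁.rank-surjective r<n))
        Ru : R₁ u ≡ r
        Ru = proj₂ (proj₂ (K₁.rank-surjective r<n))
        u≡ : arrs τ 7 (vars τ 13) ≡ u
        u≡ = trans (cong₂ (λ A i → A i) (fa f 7 _) (trans r≡ (sym Ru))) (vertex≡ rk u<n)
        previous-row : ∀ {a b} → E a b → Earlier (suc r) 0 a b → Earlier r n a b
        previous-row e (inj₁ (s≤s le)) =
          [ inj₁ , (λ eq → inj₂ (eq , proj₂ (proj₁ e))) ]′ (m≤n⇒m<n∨m≡n le)
        previous-row _ (inj₂ (_ , ()))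

-- Permutation diagrams

module _ {n : ℕ} (D : PermutationDiagram n) where
  open PermutationDiagram D

  -- A common point has one height, so both parameters agree. For a positive parameter the
  -- second-line terms are strictly ordered and the others weakly; at 0 the first line decides.
  parallel⇒disjoint : ∀ {u v} → x₁ u ℚ.< x₁ v → x₂ u ℚ.< x₂ v → ¬ Intersect u v
  parallel⇒disjoint {u} {v} lt₁ lt₂ (_ , (t , 0≤t , t≤1 , refl) , (s , _ , _ , eq)) with cong proj₂ eq
  ... | refl with ℚ.<-cmp 0ℚ t
  ...   | tri< 0<t _ _ = ℚ.<⇒≢ (ℚ.+-mono-≤-<
            (ℚ.*-monoˡ-≤-nonNeg (1ℚ ℚ.- t) ⦃ ℚ.nonNegative 0≤1-t ⦄ (ℚ.<⇒≤ lt₁))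
            (ℚ.*-monoʳ-<-pos t ⦃ ℚ.positive 0<t ⦄ lt₂)) (cong proj₁ eq)
    where
    0≤1-t : 0ℚ ℚ.≤ 1ℚ ℚ.- t
    0≤1-t = subst (ℚ._≤ 1ℚ ℚ.- t) (ℚ.+-inverseʳ t) (ℚ.+-monoˡ-≤ (ℚ.- t) t≤1)
  ...   | tri≈ _ refl _ = ℚ.<⇒≢ lt₁ (trans (sym (at-0 (x₁ u) (x₂ u))) (trans (cong proj₁ eq) (at-0 (x₁ v) (x₂ v))))
    where
    at-0 : ∀ a b → (1ℚ ℚ.- 0ℚ) ℚ.* a ℚ.+ 0ℚ ℚ.* b ≡ a
    at-0 a b = trans (cong₂ ℚ._+_ (ℚ.*-identityˡ a) (ℚ.*-zeroˡ b)) (ℚ.+-identityʳ a)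
  ...   | tri> _ _ t<0 = contradiction (ℚ.≤-<-trans 0≤t t<0) (ℚ.<-irrefl refl)

  -- The signed gap from `u` to `v` changes linearly from `p` on the first line to the negative of
  -- `q` on the second, hence vanishes at height p / (p + q).
  crossing⇒intersect : ∀ {u v} → x₁ u ℚ.< x₁ v → x₂ v ℚ.< x₂ u → Intersect u v
  crossing⇒intersect {u} {v} lt₁ lt₂ =
    point u t , (t , 0≤t , t≤1 , refl) , (t , 0≤t , t≤1 , cong (_, t) meet)
    where
    p = x₁ v ℚ.- x₁ u
    q = x₂ u ℚ.- x₂ v
    difference-pos : ∀ {a b} → a ℚ.< b → 0ℚ ℚ.< b ℚ.- a
    difference-pos {a} {b} lt = subst (ℚ._< b ℚ.- a) (ℚ.+-inverseʳ a) (ℚ.+-monoˡ-< (ℚ.- a) lt)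
    p+q>0 : 0ℚ ℚ.< p ℚ.+ q
    p+q>0 = ℚ.+-mono-< (difference-pos lt₁) (difference-pos lt₂)
    instance
      p+q-pos : ℚ.Positive (p ℚ.+ q)
      p+q-pos = ℚ.positive p+q>0
      p+q≢0 : ℚ.NonZero (p ℚ.+ q)
      p+q≢0 = ℚ.pos⇒nonZero (p ℚ.+ q)
      inverse-nonNeg : ℚ.NonNegative (ℚ.1/ (p ℚ.+ q))
      inverse-nonNeg = ℚ.pos⇒nonNeg (ℚ.1/ (p ℚ.+ q)) ⦃ ℚ.1/pos⇒pos (p ℚ.+ q) ⦄
    i = ℚ.1/ (p ℚ.+ q)
    t = p ℚ.* i
    0≤t : 0ℚ ℚ.≤ t
    0≤t = subst (ℚ._≤ t) (ℚ.*-zeroˡ i) (ℚ.*-monoʳ-≤-nonNeg i (ℚ.<⇒≤ (difference-pos lt₁)))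
    t≤1 : t ℚ.≤ 1ℚ
    t≤1 = subst (t ℚ.≤_) (ℚ.*-inverseʳ (p ℚ.+ q)) (ℚ.*-monoʳ-≤-nonNeg i
      (subst (ℚ._≤ p ℚ.+ q) (ℚ.+-identityʳ p) (ℚ.+-monoʳ-≤ p (ℚ.<⇒≤ (difference-pos lt₂)))))
    open +-*-Solver
    meet : (1ℚ ℚ.- t) ℚ.* x₁ u ℚ.+ t ℚ.* x₂ u ≡ (1ℚ ℚ.- t) ℚ.* x₁ v ℚ.+ t ℚ.* x₂ v
    meet = begin
      (1ℚ ℚ.- t) ℚ.* x₁ u ℚ.+ t ℚ.* x₂ u
        -- The sides differ by p ((p + q) i - 1), an identity valid for every `i`; that `i` is the
        -- inverse of p + q enters in the next step.
        ≡⟨ solve 5 (λ a a′ b b′ i →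
             (con 1ℚ :- (a′ :- a) :* i) :* a :+ ((a′ :- a) :* i) :* b
             := ((con 1ℚ :- (a′ :- a) :* i) :* a′ :+ ((a′ :- a) :* i) :* b′)
                :+ (a′ :- a) :* ((((a′ :- a) :+ (b :- b′)) :* i) :- con 1ℚ))
             refl (x₁ u) (x₁ v) (x₂ u) (x₂ v) i ⟩
      ((1ℚ ℚ.- t) ℚ.* x₁ v ℚ.+ t ℚ.* x₂ v) ℚ.+ p ℚ.* ((p ℚ.+ q) ℚ.* i ℚ.- 1ℚ)
        ≡⟨ cong (λ z → ((1ℚ ℚ.- t) ℚ.* x₁ v ℚ.+ t ℚ.* x₂ v) ℚ.+ p ℚ.* (z ℚ.- 1ℚ)) (ℚ.*-inverseʳ (p ℚ.+ q)) ⟩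
      ((1ℚ ℚ.- t) ℚ.* x₁ v ℚ.+ t ℚ.* x₂ v) ℚ.+ p ℚ.* (1ℚ ℚ.- 1ℚ)
        ≡⟨ cong (((1ℚ ℚ.- t) ℚ.* x₁ v ℚ.+ t ℚ.* x₂ v) ℚ.+_) (ℚ.*-zeroʳ p) ⟩
      ((1ℚ ℚ.- t) ℚ.* x₁ v ℚ.+ t ℚ.* x₂ v) ℚ.+ 0ℚ
        ≡⟨ ℚ.+-identityʳ _ ⟩
      (1ℚ ℚ.- t) ℚ.* x₁ v ℚ.+ t ℚ.* x₂ v ∎
      where open ≡-Reasoning

-- The coloured pairs of a graph and the order promised by a diagram

bit : Bool → ℕ
bit b = if b then 1 else 0

bit≤1 : ∀ b → bit b ≤ 1
bit≤1 true  = ≤-refl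
bit≤1 false = z≤n

bit≡1 : ∀ {b} → bit b ≡ 1 → T b
bit≡1 {true} _ = tt

T⇒bit≡1 : ∀ {b} → T b → bit b ≡ 1
T⇒bit≡1 {true} _ = refl

as-Fin : ∀ {n x} → x < n → ∃ λ (i : Fin n) → toℕ i ≡ x
as-Fin x<n = fromℕ< x<n , Fin.toℕ-fromℕ< x<n

extend : ∀ {n} {A : Set} → A → (Fin n → A) → ℕ → A
extend {n} a f x with x <? n
... | yes x<n = f (fromℕ< x<n)
... | no _    = a

extend-toℕ : ∀ {n} {A : Set} (a : A) (f : Fin n → A) i → extend a f (toℕ i) ≡ f i
extend-toℕ {n} a f i with toℕ i <? n
... | yes i<n = cong f (Fin.fromℕ<-toℕ i i<n)
... | no i≮n  = contradiction (Fin.toℕ<n i) i≮n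

module _ {n : ℕ} (G : Graph n) where
  open Graph G hiding (sym)

  private
    entry : ℕ → ℕ → ℕ
    entry x y with x <? n | y <? n
    ... | yes x<n | yes y<n = bit (adj (fromℕ< x<n) (fromℕ< y<n))
    ... | yes _   | no _    = 0
    ... | no _    | _       = 0

    entry-sym : ∀ x y → entry x y ≡ entry y x
    entry-sym x y with x <? n | y <? n
    ... | yes x<n | yes y<n = cong bit (Graph.sym G (fromℕ< x<n) (fromℕ< y<n))
    ... | yes _   | no _    = refl
    ... | no _    | yes _   = refl
    ... | no _    | no _    = refl

    entry≤1 : ∀ x y → entry x y ≤ 1
    entry≤1 x y with x <? n | y <? n
    ... | yes x<n | yes y<n = bit≤1 _
    ... | yes _   | no _    = z≤n
    ... | no _    | _       = z≤n

    entry-toℕ : ∀ u v → entry (toℕ u) (toℕ v) ≡ bit (adj u v)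
    entry-toℕ u v with toℕ u <? n | toℕ v <? n
    ... | yes u<n | yes v<n = cong₂ (λ u v → bit (adj u v)) (Fin.fromℕ<-toℕ u u<n) (Fin.fromℕ<-toℕ v v<n)
    ... | yes _   | no v≮n  = contradiction (Fin.toℕ<n v) v≮n
    ... | no u≮n  | _       = contradiction (Fin.toℕ<n u) u≮n

    colouring : ℕ → ℕ → ℕ
    colouring x y with x ≟ y
    ... | yes _ = 2
    ... | no _  = entry x y

    colouring-sym : ∀ x y → colouring x y ≡ colouring y x
    colouring-sym x y with x ≟ y | y ≟ x
    ... | yes _   | yes _   = refl
    ... | yes x≡y | no y≢x  = contradiction (sym x≡y) y≢x
    ... | no x≢y  | yes y≡x = contradiction (sym y≡x) x≢y
    ... | no _    | no _    = entry-sym x y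

    colouring≤2 : ∀ x y → colouring x y ≤ 2
    colouring≤2 x y with x ≟ y
    ... | yes _ = ≤-refl
    ... | no _  = ≤-trans (entry≤1 x y) (n≤1+n 1)

    colouring-diag : ∀ x → colouring x x ≡ 2
    colouring-diag x with x ≟ x
    ... | yes _  = refl
    ... | no x≢x = contradiction refl x≢x

    colouring-off : ∀ {x y} → colouring x y ≡ 2 → x ≡ y
    colouring-off {x} {y} e with x ≟ y
    ... | yes x≡y = x≡y
    ... | no _    = contradiction (≤-trans (≤-reflexive (sym e)) (entry≤1 x y)) (<⇒≱ ≤-refl)

  adjacency : Colour
  adjacency = record
    { col = colouring ; col-sym = colouring-sym ; col≤2 = colouring≤2
    ; diag = colouring-diag ; off = colouring-off }

  open Colour adjacency

  col-toℕ : ∀ {u v} → u ≢ v → col (toℕ u) (toℕ v) ≡ bit (adj u v)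
  col-toℕ {u} {v} u≢v with toℕ u ≟ toℕ v
  ... | yes e = contradiction (Fin.toℕ-injective e) u≢v
  ... | no _  = entry-toℕ u v

  Adj⇒≢ : ∀ {u v} → Adj u v → u ≢ v
  Adj⇒≢ a refl = irrefl _ a

  Adj⇒col : ∀ {u v} → Adj u v → col (toℕ u) (toℕ v) ≡ 1
  Adj⇒col a = trans (col-toℕ (Adj⇒≢ a)) (T⇒bit≡1 a)

  col⇒Adj : ∀ {u v} → col (toℕ u) (toℕ v) ≡ 1 → Adj u v
  col⇒Adj {u} {v} e = bit≡1 (trans (sym (col-toℕ u≢v)) e)
    where
    u≢v : u ≢ v
    u≢v refl = contradiction (trans (sym (diag (toℕ u))) e) λ ()

  Adj-sym : ∀ {u v} → Adj u v → Adj v u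
  Adj-sym {u} {v} = subst T (Graph.sym G u v)

  matrixCells-combine : ∀ u v → matrixCells adj (n * toℕ u + toℕ v) ≡ bit (adj u v)
  matrixCells-combine u v rewrite sym (Fin.toℕ-combine u v) with toℕ (combine u v) <? n * n
  ... | yes lt = cong bit (trans
    (cong (λ i → uncurry adj (remQuot n i)) (Fin.fromℕ<-toℕ (combine u v) lt))
    (cong (uncurry adj) (Fin.remQuot-combine u v)))
  ... | no nlt = contradiction (Fin.toℕ<n (combine u v)) nlt

  matrixCells≤1 : ∀ i → matrixCells adj i ≤ 1
  matrixCells≤1 i with i <? n * n
  ... | yes _ = bit≤1 _
  ... | no _  = z≤n

  module Promise (P : IsPermutationGraph G) where
    private D = proj₁ P
    open PermutationDiagram D

    private
      crosses : ∀ {u v} → Adj u v → x₁ u ℚ.< x₁ v → x₂ v ℚ.< x₂ u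
      crosses {u} {v} a lt with ℚ.<-cmp (x₂ u) (x₂ v)
      ... | tri< lt′ _ _ = contradiction (proj₂ (Equivalence.to (proj₂ P u v) a)) (parallel⇒disjoint D lt lt′)
      ... | tri≈ _ e _   = contradiction (x₂-injective e) (Adj⇒≢ a)
      ... | tri> _ _ gt  = gt

      avoids : ∀ {u v} → ¬ Adj u v → x₁ u ℚ.< x₁ v → x₂ u ℚ.< x₂ v
      avoids {u} {v} ¬a lt with ℚ.<-cmp (x₂ u) (x₂ v)
      ... | tri< lt′ _ _ = lt′
      ... | tri≈ _ e _   = contradiction (cong x₁ (x₂-injective e)) (ℚ.<⇒≢ lt)
      ... | tri> _ _ gt  = contradiction
        (Equivalence.from (proj₂ P u v) ((λ e → ℚ.<⇒≢ lt (cong x₁ e)) , crossing⇒intersect D lt gt)) ¬a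

      -- Along the first line edges reverse the order of the second line and non-edges preserve it,
      -- so both classes are transitive.
      between : ∀ {u v w} → x₁ u ℚ.< x₁ v → x₁ v ℚ.< x₁ w →
        bit (adj u v) ≡ bit (adj v w) → bit (adj u v) ≡ bit (adj u w)
      between {u} {v} {w} uv vw e with adj u v in a | adj v w in b | adj u w in c
      ... | true  | true  | true  = refl
      ... | false | false | false = refl
      ... | true  | true  | false = contradiction
        (ℚ.<-trans (avoids (subst T c) (ℚ.<-trans uv vw)) (crosses (subst T (sym b) tt) vw))
        (ℚ.<-asym (crosses (subst T (sym a) tt) uv))
      ... | false | false | true  = contradiction
        (ℚ.<-trans (avoids (subst T a) uv) (avoids (subst T b) vw))
        (ℚ.<-asym (crosses (subst T (sym c) tt) (ℚ.<-trans uv vw)))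

    abscissa : ℕ → ℚ
    abscissa = extend 0ℚ x₁

    _⊏_ : ℕ → ℕ → Set
    x ⊏ y = abscissa x ℚ.< abscissa y

    private
      on-Fin : ∀ {u v} → toℕ u ⊏ toℕ v → x₁ u ℚ.< x₁ v
      on-Fin {u} {v} = subst₂ ℚ._<_ (extend-toℕ 0ℚ x₁ u) (extend-toℕ 0ℚ x₁ v)

      between-ℕ : ∀ {x y z} → x < n → y < n → z < n → x ⊏ y → y ⊏ z → col x y ≡ col y z → col x y ≡ col x z
      between-ℕ x<n y<n z<n xy yz e with as-Fin x<n | as-Fin y<n | as-Fin z<n
      ... | u , refl | v , refl | w , refl =
        trans (col-toℕ (≢ xy)) (trans (between (on-Fin xy) (on-Fin yz)
          (trans (sym (col-toℕ (≢ xy))) (trans e (col-toℕ (≢ yz)))))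
          (sym (col-toℕ (≢ (ℚ.<-trans xy yz)))))
        where
        ≢ : ∀ {u v} → toℕ u ⊏ toℕ v → u ≢ v
        ≢ lt refl = ℚ.<-irrefl refl lt

    ⊏-total : ∀ {x y} → x < n → y < n → x ≢ y → x ⊏ y ⊎ y ⊏ x
    ⊏-total {x} {y} x<n y<n x≢y with ℚ.<-cmp (abscissa x) (abscissa y)
    ... | tri< lt _ _ = inj₁ lt
    ... | tri> _ _ gt = inj₂ gt
    ... | tri≈ _ e _ with as-Fin x<n | as-Fin y<n
    ...   | u , refl | v , refl = contradiction
      (cong toℕ (x₁-injective (trans (sym (extend-toℕ 0ℚ x₁ u)) (trans e (extend-toℕ 0ℚ x₁ v))))) x≢y

    ⊏-asym : ∀ {x y} → x < n → y < n → x ⊏ y → ¬ y ⊏ x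
    ⊏-asym _ _ = ℚ.<-asym

    private
      ⊏-compare : ∀ {x y} → x < n → y < n → x ≡ y ⊎ x ⊏ y ⊎ y ⊏ x
      ⊏-compare {x} {y} x<n y<n with x ≟ y
      ... | yes x≡y = inj₁ x≡y
      ... | no x≢y  = inj₂ (⊏-total x<n y<n x≢y)

    -- Were the forced pair ordered the other way, the common end would lie between the two free
    -- ends, and by `between-ℕ` the third side would have the same colour as the other two.
    ⊏-forced : ∀ {a b x y} → a < n → b < n → a ⊏ b → Forcing.Forces n adjacency a b x y → x ⊏ y
    ⊏-forced {a} {b} a<n b<n ab (Forcing.same-tail {c} c<n e ne) with ⊏-compare a<n c<n
    ... | inj₁ refl      = contradiction ab (ℚ.<-irrefl (cong abscissa (off (trans e (diag a)))))
    ... | inj₂ (inj₁ ac) = ac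
    ... | inj₂ (inj₂ ca) = contradiction
      (trans e (trans (col-sym a c) (trans (between-ℕ c<n a<n b<n ca ab (trans (col-sym c a) (sym e))) (col-sym c b)))) ne
    ⊏-forced {a} {b} a<n b<n ab (Forcing.same-head {c} c<n e ne) with ⊏-compare c<n b<n
    ... | inj₁ refl      = contradiction ab (ℚ.<-irrefl (cong abscissa (off (trans e (diag b)))))
    ... | inj₂ (inj₁ cb) = cb
    ... | inj₂ (inj₂ bc) = contradiction (between-ℕ a<n b<n c<n ab bc (trans e (col-sym c b))) ne

-- Strong edge colourings

module StrongColouring {n : ℕ} (G : Graph n) (E : ℕ → ℕ → Set) (R₁ R₂ : ℕ → ℕ)
  (E-< : ∀ {u v} → E u v → u < n × v < n)
  (E-R₁ : ∀ {u v} → E u v → R₁ u < R₁ v)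
  (E-R₂ : ∀ {u v} → E u v → R₂ v < R₂ u)
  (R₁-injective : ∀ {u v} → u < n → v < n → R₁ u ≡ R₁ v → u ≡ v)
  (E⇒Adj : ∀ {u v} → E (toℕ u) (toℕ v) → Graph.Adj G u v)
  (Adj⇒E : ∀ {u v} → Graph.Adj G u v → R₁ (toℕ u) < R₁ (toℕ v) → E (toℕ u) (toℕ v))
  (avoids : ∀ {u v} → u ≢ v → ¬ Graph.Adj G u v → R₁ (toℕ u) < R₁ (toℕ v) → R₂ (toℕ u) < R₂ (toℕ v))
  where

  open Graph G hiding (sym)
  open Sweep n E R₁ R₂ E-< E-R₁ E-R₂ R₁-injective

  private
    _◁_ : Fin n → Fin n → Set
    u ◁ v = R₁ (toℕ u) < R₁ (toℕ v)

    ◁-total : ∀ {u v} → u ≢ v → u ◁ v ⊎ v ◁ u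
    ◁-total {u} {v} u≢v with <-cmp (R₁ (toℕ u)) (R₁ (toℕ v))
    ... | tri< lt _ _ = inj₁ lt
    ... | tri≈ _ e _  = contradiction (Fin.toℕ-injective (R₁-injective (Fin.toℕ<n u) (Fin.toℕ<n v) e)) u≢v
    ... | tri> _ _ gt = inj₂ gt

    crosses : ∀ {u v} → Adj u v → u ◁ v → R₂ (toℕ v) < R₂ (toℕ u)
    crosses a lt = E-R₂ (Adj⇒E a lt)

  edge-≡ : {e f : Edge G} → Edge.lo e ≡ Edge.lo f → Edge.hi e ≡ Edge.hi f → e ≡ f
  edge-≡ {edge _ _ _ _} {edge _ _ _ _} refl refl = refl

  -- The irrelevant proof can be recovered because adjacency is decidable.
  endpoints-adjacent : (e : Edge G) → Adj (Edge.lo e) (Edge.hi e)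
  endpoints-adjacent (edge lo hi _ a) = recompute (T? (adj lo hi)) a

  lo<hi′ : (e : Edge G) → Edge.lo e Fin.< Edge.hi e
  lo<hi′ (edge lo hi lt _) = recompute (lo Fin.<? hi) lt

  -- The endpoints of e from left to right on the first line.
  record Oriented (e : Edge G) : Set where
    constructor oriented-edge
    field
      {left right} : Fin n
      is-E : E (toℕ left) (toℕ right)
      ends : (left ≡ Edge.lo e × right ≡ Edge.hi e) ⊎ (left ≡ Edge.hi e × right ≡ Edge.lo e)
  open Oriented

  orient : ∀ e → Oriented e
  orient e with ◁-total {Edge.lo e} {Edge.hi e} (λ eq → Adj⇒≢ G (endpoints-adjacent e) eq)
  ... | inj₁ lt = oriented-edge (Adj⇒E (endpoints-adjacent e) lt) (inj₁ (refl , refl))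
  ... | inj₂ gt = oriented-edge (Adj⇒E (Adj-sym G (endpoints-adjacent e)) gt) (inj₂ (refl , refl))

  is-end : ∀ {e v} (o : Oriented e) → v IsEndOf e → v ≡ left o ⊎ v ≡ right o
  is-end (oriented-edge _ (inj₁ (refl , refl))) h        = h
  is-end (oriented-edge _ (inj₂ (refl , refl))) (inj₁ h) = inj₂ h
  is-end (oriented-edge _ (inj₂ (refl , refl))) (inj₂ h) = inj₁ h

  left-end : ∀ {e} (o : Oriented e) → left o IsEndOf e
  left-end (oriented-edge _ (inj₁ (refl , refl))) = inj₁ refl
  left-end (oriented-edge _ (inj₂ (refl , refl))) = inj₂ refl

  right-end : ∀ {e} (o : Oriented e) → right o IsEndOf e
  right-end (oriented-edge _ (inj₁ (refl , refl))) = inj₂ refl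
  right-end (oriented-edge _ (inj₂ (refl , refl))) = inj₁ refl

  oriented-injective : ∀ {e f} (o : Oriented e) (p : Oriented f) → left o ≡ left p → right o ≡ right p → e ≡ f
  oriented-injective (oriented-edge _ (inj₁ (refl , refl))) (oriented-edge _ (inj₁ (refl , refl))) refl refl = edge-≡ refl refl
  oriented-injective (oriented-edge _ (inj₂ (refl , refl))) (oriented-edge _ (inj₂ (refl , refl))) refl refl = edge-≡ refl refl
  oriented-injective {e} {f} (oriented-edge _ (inj₁ (refl , refl))) (oriented-edge _ (inj₂ (refl , refl))) refl refl =
    contradiction (lo<hi′ e) (<-asym (lo<hi′ f))
  oriented-injective {e} {f} (oriented-edge _ (inj₂ (refl , refl))) (oriented-edge _ (inj₁ (refl , refl))) refl refl =
    contradiction (lo<hi′ e) (<-asym (lo<hi′ f))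

  oriented-unique : ∀ {e f} → e ≡ f → (o : Oriented e) (p : Oriented f) → left o ≡ left p × right o ≡ right p
  oriented-unique refl (oriented-edge _ (inj₁ (refl , refl))) (oriented-edge _ (inj₁ (refl , refl))) = refl , refl
  oriented-unique refl (oriented-edge _ (inj₂ (refl , refl))) (oriented-edge _ (inj₂ (refl , refl))) = refl , refl
  oriented-unique refl (oriented-edge E₁ (inj₁ (refl , refl))) (oriented-edge E₂ (inj₂ (refl , refl))) =
    contradiction (E-R₁ E₁) (<-asym (E-R₁ E₂))
  oriented-unique refl (oriented-edge E₁ (inj₂ (refl , refl))) (oriented-edge E₂ (inj₁ (refl , refl))) =
    contradiction (E-R₁ E₁) (<-asym (E-R₁ E₂))

  ends-adjacent : ∀ {e x y} → x IsEndOf e → y IsEndOf e → x ≢ y → Adj x y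
  ends-adjacent (inj₁ refl) (inj₁ refl) x≢y = contradiction refl x≢y
  ends-adjacent {e} (inj₁ refl) (inj₂ refl) _ = endpoints-adjacent e
  ends-adjacent {e} (inj₂ refl) (inj₁ refl) _ = Adj-sym G (endpoints-adjacent e)
  ends-adjacent (inj₂ refl) (inj₂ refl) x≢y = contradiction refl x≢y

  private
    R₁-between : ∀ {e v} (o : Oriented e) → v IsEndOf e →
      R₁ (toℕ (left o)) ≤ R₁ (toℕ v) × R₁ (toℕ v) ≤ R₁ (toℕ (right o))
    R₁-between o h with is-end o h
    ... | inj₁ refl = ≤-refl , <⇒≤ (E-R₁ (is-E o))
    ... | inj₂ refl = <⇒≤ (E-R₁ (is-E o)) , ≤-refl

    R₂-between : ∀ {e v} (o : Oriented e) → v IsEndOf e →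
      R₂ (toℕ (right o)) ≤ R₂ (toℕ v) × R₂ (toℕ v) ≤ R₂ (toℕ (left o))
    R₂-between o h with is-end o h
    ... | inj₁ refl = <⇒≤ (E-R₂ (is-E o)) , ≤-refl
    ... | inj₂ refl = ≤-refl , <⇒≤ (E-R₂ (is-E o))

  BeforeEdge : ∀ {e f} → Oriented e → Oriented f → Set
  BeforeEdge o p = Before (toℕ (left o)) (toℕ (right o)) (toℕ (left p)) (toℕ (right p))

  before-ends : ∀ {e f} (o : Oriented e) (p : Oriented f) → BeforeEdge o p →
    ∀ {x y} → x IsEndOf e → y IsEndOf f → x ◁ y × R₂ (toℕ x) < R₂ (toℕ y)
  before-ends o p (lt₁ , lt₂) hx hy =
    ≤-<-trans (proj₂ (R₁-between o hx)) (<-≤-trans lt₁ (proj₁ (R₁-between p hy))) ,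
    ≤-<-trans (proj₂ (R₂-between o hx)) (<-≤-trans lt₂ (proj₁ (R₂-between p hy)))

  before-separated : ∀ {e f} (o : Oriented e) (p : Oriented f) → BeforeEdge o p →
    ∀ {x y} → x IsEndOf e → y IsEndOf f → x ≢ y × ¬ Adj x y
  before-separated o p bf hx hy =
    (λ { refl → <-irrefl refl (proj₁ (before-ends o p bf hx hy)) }) ,
    (λ a → let lt₁ , lt₂ = before-ends o p bf hx hy in <-asym lt₂ (crosses a lt₁))

  comparable-separated : ∀ {e f} (o : Oriented e) (p : Oriented f) → BeforeEdge o p ⊎ BeforeEdge p o →
    ∀ {x y} → x IsEndOf e → y IsEndOf f → x ≢ y × ¬ Adj x y
  comparable-separated o p (inj₁ bf) hx hy = before-separated o p bf hx hy
  comparable-separated o p (inj₂ bf) hx hy = let ne , ¬a = before-separated p o bf hy hx in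
    (λ e → ne (sym e)) , (λ a → ¬a (Adj-sym G a))

  comparable⇒strong : ∀ {k} (φ : Edge G → Fin k) →
    (∀ {e f} → e ≢ f → φ e ≡ φ f → BeforeEdge (orient e) (orient f) ⊎ BeforeEdge (orient f) (orient e)) →
    IsStrongEdgeColouring φ
  comparable⇒strong φ comparable =
    (λ { e f (e≢f , v , ve , vf) eq →
      proj₁ (comparable-separated (orient e) (orient f) (comparable e≢f eq) ve vf) refl }) ,
    -- The edge `g` has an end in each of `e` and `f`; these ends are distinct, so `g` joins them.
    (λ { g e f (_ , x , xg , xe) (_ , y , yg , yf) e≢f eq →
      let ne , ¬a = comparable-separated (orient e) (orient f) (comparable e≢f eq) xe yf in
      ¬a (ends-adjacent {g} xg yg ne) })

  -- Distinct non-adjacent vertices have the same order on both lines. Let the left end of `e` come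
  -- first. If the right end of `e` came after the left end of `f` on the first line, it would do so
  -- on the second, where it precedes the left end of `e`: a contradiction. The comparison on the
  -- second line transfers from the first.
  separated⇒comparable : ∀ {e f} (o : Oriented e) (p : Oriented f) →
    (∀ {x y} → x IsEndOf e → y IsEndOf f → x ≢ y × ¬ Adj x y) → BeforeEdge o p ⊎ BeforeEdge p o
  separated⇒comparable {e} {f} o p sep with ◁-total (proj₁ (sep (left-end o) (left-end p)))
  ... | inj₁ lt = inj₁ (right-left , left-right)
    where
    R₂-lt = uncurry avoids (sep (left-end o) (left-end p)) lt
    right-left : right o ◁ left p
    right-left with ◁-total (proj₁ (sep (right-end o) (left-end p)))
    ... | inj₁ rl = rl
    ... | inj₂ lr = contradiction
      (avoids (λ e → proj₁ (sep (right-end o) (left-end p)) (sym e))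
              (λ a → proj₂ (sep (right-end o) (left-end p)) (Adj-sym G a)) lr)
      (<-asym (<-trans (E-R₂ (is-E o)) R₂-lt))
    left-right : R₂ (toℕ (left o)) < R₂ (toℕ (right p))
    left-right = uncurry avoids (sep (left-end o) (right-end p)) (<-trans lt (E-R₁ (is-E p)))
  ... | inj₂ gt = inj₂ (right-left , left-right)
    where
    flip : ∀ {x y} → x IsEndOf e → y IsEndOf f → y ≢ x × ¬ Adj y x
    flip hx hy = (λ e → proj₁ (sep hx hy) (sym e)) , (λ a → proj₂ (sep hx hy) (Adj-sym G a))
    R₂-lt = uncurry avoids (flip (left-end o) (left-end p)) gt
    right-left : right p ◁ left o
    right-left with ◁-total (proj₁ (flip (left-end o) (right-end p)))
    ... | inj₁ rl = rl
    ... | inj₂ lr = contradiction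
      (uncurry avoids (sep (left-end o) (right-end p)) lr)
      (<-asym (<-trans (E-R₂ (is-E p)) R₂-lt))
    left-right : R₂ (toℕ (left p)) < R₂ (toℕ (right o))
    left-right = uncurry avoids (flip (right-end o) (left-end p)) (<-trans gt (E-R₁ (is-E o)))

  -- Passes from pairs ordered along the first line to edges, which are stored by the order of
  -- names.
  join : (u v : Fin n) → Adj u v → Edge G
  join u v a with Fin.<-cmp u v
  ... | tri< lt _ _ = edge u v lt a
  ... | tri≈ _ e _  = contradiction e (Adj⇒≢ G a)
  ... | tri> _ _ gt = edge v u gt (Adj-sym G a)

  join-ends : ∀ u v a → u IsEndOf join u v a × v IsEndOf join u v a
  join-ends u v a with Fin.<-cmp u v
  ... | tri< lt _ _ = inj₁ refl , inj₂ refl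
  ... | tri≈ _ e _  = contradiction e (Adj⇒≢ G a)
  ... | tri> _ _ gt = inj₂ refl , inj₁ refl

  join-orient : ∀ u v a → u ◁ v →
    (Edge.lo (join u v a) ≡ u × Edge.hi (join u v a) ≡ v) ⊎ (Edge.lo (join u v a) ≡ v × Edge.hi (join u v a) ≡ u)
  join-orient u v a lt with Fin.<-cmp u v
  ... | tri< _ _ _ = inj₁ (refl , refl)
  ... | tri≈ _ e _ = contradiction e (Adj⇒≢ G a)
  ... | tri> _ _ _ = inj₂ (refl , refl)

  oriented-join : ∀ {u v} → E (toℕ u) (toℕ v) → ∀ a → Σ (Oriented (join u v a)) λ o → left o ≡ u × right o ≡ v
  oriented-join {u} {v} Euv a with join-orient u v a (E-R₁ Euv)
  ... | inj₁ (p , q) = oriented-edge Euv (inj₁ (sym p , sym q)) , refl , refl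
  ... | inj₂ (p , q) = oriented-edge Euv (inj₂ (sym q , sym p)) , refl , refl

  module _ {j : ℕ} (φ : Edge G → Fin j) (strong : IsStrongEdgeColouring φ) where

    -- An edge joining `e` to `f` would be adjacent to both, being different from each because `e`
    -- and `f` are disjoint; so equal colours leave `e` and `f` separated.
    strong⇒comparable : ∀ {e f} (o : Oriented e) (p : Oriented f) → φ e ≡ φ f → e ≢ f →
      BeforeEdge o p ⊎ BeforeEdge p o
    strong⇒comparable {e} {f} o p eq e≢f = separated⇒comparable o p λ hx hy → disjoint hx hy , unjoined hx hy
      where
      disjoint : ∀ {x y} → x IsEndOf e → y IsEndOf f → x ≢ y
      disjoint hx hy refl = proj₁ strong e f (e≢f , _ , hx , hy) eq
      unjoined : ∀ {x y} → x IsEndOf e → y IsEndOf f → ¬ Adj x y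
      unjoined {x} {y} hx hy a = proj₂ strong g e f
        ((λ { refl → disjoint (proj₂ gs) hy refl }) , x , proj₁ gs , hx)
        ((λ { refl → disjoint hx (proj₁ gs) refl }) , y , proj₂ gs , hy) e≢f eq
        where
        g  = join x y a
        gs = join-ends x y a

    on-pairs : ℕ → ℕ → ℕ
    on-pairs x y with x <? n | y <? n
    ... | no _    | _       = 0
    ... | yes _   | no _    = 0
    ... | yes x<n | yes y<n with T? (adj (fromℕ< x<n) (fromℕ< y<n))
    ...   | yes a = toℕ (φ (join (fromℕ< x<n) (fromℕ< y<n) a))
    ...   | no _  = 0

    on-pairs-E : ∀ {x y} → E x y → ∃₂ λ u v → toℕ u ≡ x × toℕ v ≡ y × Σ (Adj u v) λ a →
      on-pairs x y ≡ toℕ (φ (join u v a))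
    on-pairs-E {x} {y} e with x <? n | y <? n
    ... | no x≮n  | _       = contradiction (proj₁ (E-< e)) x≮n
    ... | yes _   | no y≮n  = contradiction (proj₂ (E-< e)) y≮n
    ... | yes x<n | yes y<n with T? (adj (fromℕ< x<n) (fromℕ< y<n))
    ...   | yes a = fromℕ< x<n , fromℕ< y<n , Fin.toℕ-fromℕ< x<n , Fin.toℕ-fromℕ< y<n , a , refl
    ...   | no ¬a = contradiction
      (E⇒Adj (subst₂ E (sym (Fin.toℕ-fromℕ< x<n)) (sym (Fin.toℕ-fromℕ< y<n)) e)) ¬a

    join-comparable : ∀ {a b u v} (ab : Adj a b) (uv : Adj u v) → E (toℕ a) (toℕ b) → E (toℕ u) (toℕ v) →
      φ (join a b ab) ≡ φ (join u v uv) → ¬ (a ≡ u × b ≡ v) →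
      Before (toℕ a) (toℕ b) (toℕ u) (toℕ v) ⊎ Before (toℕ u) (toℕ v) (toℕ a) (toℕ b)
    join-comparable ab uv Eab Euv eq ne with oriented-join Eab ab | oriented-join Euv uv
    ... | o , a≡ , b≡ | p , u≡ , v≡ = Sum.map (transport a≡ b≡ u≡ v≡) (transport u≡ v≡ a≡ b≡)
      (strong⇒comparable o p eq λ e≡f → let l , r = oriented-unique e≡f o p in
        ne (trans (sym a≡) (trans l u≡) , trans (sym b≡) (trans r v≡)))
      where
      transport : ∀ {a a′ b b′ u u′ v v′ : Fin n} → a ≡ a′ → b ≡ b′ → u ≡ u′ → v ≡ v′ →
        Before (toℕ a) (toℕ b) (toℕ u) (toℕ v) → Before (toℕ a′) (toℕ b′) (toℕ u′) (toℕ v′)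
      transport refl refl refl refl bf = bf

    strong⇒valid : Valid on-pairs j
    strong⇒valid .Valid.range e with on-pairs-E e
    ... | _ , _ , _ , _ , _ , eq = subst (_< j) (sym eq) (Fin.toℕ<n _)
    strong⇒valid .Valid.proper e e′ eq with on-pairs-E e | on-pairs-E e′
    ... | a , b , refl , refl , ab , p | u , v , refl , refl , uv , q
      with (a Fin.≟ u) ×-dec (b Fin.≟ v)
    ...   | yes (refl , refl) = inj₁ (refl , refl)
    ...   | no ne = inj₂ (join-comparable ab uv e e′
      (Fin.toℕ-injective (trans (sym p) (trans eq q))) ne)

  module Optimal (R₁<n : ∀ {x} → x < n → R₁ x < n) {c : ℕ → ℕ → ℕ} {k : ℕ} {last₁ last₂ : ℕ → ℕ}
    (g : Greedy n 0 c k last₁ last₂)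
    (symmetric : ∀ {a b} → E a b → Earlier n 0 a b → c b a ≡ c a b) where

    private
      -- All ranks are below `n`, so the completed sweep has passed every edge.
      done : ∀ {e} (o : Oriented e) → Earlier n 0 (toℕ (left o)) (toℕ (right o))
      done o = inj₁ (R₁<n (Fin.toℕ<n (left o)))

      colour : Edge G → ℕ
      colour e = c (toℕ (Edge.lo e)) (toℕ (Edge.hi e))

      colour-of : ∀ {e} (o : Oriented e) → colour e ≡ c (toℕ (left o)) (toℕ (right o))
      colour-of (oriented-edge _ (inj₁ (refl , refl)))     = refl
      colour-of o@(oriented-edge Ee (inj₂ (refl , refl))) = symmetric Ee (done o)

      colour< : ∀ e → colour e < k
      colour< e = subst (_< k) (sym (colour-of (orient e)))
        (Greedy.range g (is-E (orient e)) (done (orient e)))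

    ψ : Edge G → Fin k
    ψ e = fromℕ< (colour< e)

    toℕ-ψ : ∀ e → toℕ (ψ e) ≡ c (toℕ (Edge.lo e)) (toℕ (Edge.hi e))
    toℕ-ψ e = Fin.toℕ-fromℕ< (colour< e)

    ψ-strong : IsStrongEdgeColouring ψ
    ψ-strong = comparable⇒strong ψ λ {e} {f} → comparable (orient e) (orient f)
      where
      comparable : ∀ {e f} (o : Oriented e) (p : Oriented f) → e ≢ f → ψ e ≡ ψ f →
        BeforeEdge o p ⊎ BeforeEdge p o
      comparable {e} {f} o p e≢f eq with Greedy.proper g (is-E o) (done o) (is-E p) (done p)
        (trans (sym (colour-of o)) (trans (Fin.fromℕ<-injective _ _ (colour< e) (colour< f) eq) (colour-of p)))
      ... | inj₁ (l , r) = contradiction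
        (oriented-injective o p (Fin.toℕ-injective l) (Fin.toℕ-injective r)) e≢f
      ... | inj₂ cmp     = cmp

    index : IsStrongChromaticIndex G k
    index = (ψ , ψ-strong) , λ j (φ , strong) → optimal g (strong⇒valid φ strong)

-- The whole algorithm and its word size

algorithm : Prog
algorithm = mark-diagonal ⨾ search ⨾ ranks ⨾ greedy

record WordParameters (n W e : ℕ) : Set where
  field
    M       : ℕ
    2≤M     : 2 ≤ M
    M^e<W   : M ^ e < W
    2n²<M   : 2 * (n * n) < M
    n<M     : n < M

-- The cube of `b` exceeds 2n² because `b` is at least 2 and exceeds `n`. The exponent 3 e turns the
-- cell bound into a bound for expressions of size `e`, and one further factor `b` makes the
-- inequality strict.
cubic-parameters : ∀ {n b} e → n < b → 2 ≤ b → WordParameters n (b ^ suc (3 * e)) e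
cubic-parameters {n} {b} e n<b 2≤b = record
  { M = b ^ 3 ; 2≤M = ≤-trans 2≤b b≤M ; 2n²<M = 2n²<M ; n<M = ≤-trans n<b b≤M
  ; M^e<W = subst (_< b ^ suc (3 * e)) (sym (^-*-assoc b 3 e)) (^-monoʳ-< b 2≤b (n<1+n (3 * e))) }
  where
  instance
    b≢0 : NonZero b
    b≢0 = >-nonZero (≤-trans (s≤s z≤n) 2≤b)
  b≤M : b ≤ b ^ 3
  b≤M = m≤m*n b (b * (b * 1)) ⦃ m^n≢0 b 2 ⦄
  2n²<M : 2 * (n * n) < b ^ 3
  2n²<M = begin-strict
    2 * (n * n)       ≤⟨ *-monoˡ-≤ (n * n) 2≤b ⟩
    b * (n * n)       <⟨ *-monoʳ-< b (*-mono-< n<b n<b) ⟩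
    b * (b * b)       ≡⟨ cong (λ m → b * (b * m)) (*-identityʳ b) ⟨
    b * (b * (b * 1)) ∎
    where open ≤-Reasoning

abstract
  word-parameters : ∀ n e → WordParameters n (wordBound (suc (3 * e)) n) e
  word-parameters n e = cubic-parameters e (s≤s (n≤1+n n)) (s≤s (s≤s z≤n))

module Algorithm {n : ℕ} (G : Graph n) (promise : IsPermutationGraph G)
  {W : ℕ} (parameters : WordParameters n W 100) where

  open Promise G promise
  open WordParameters parameters

  open Colour (adjacency G)
  open Forcing n (adjacency G)
  open LexSearch n (adjacency G) _⊏_ ⊏-total ⊏-asym ⊏-forced using (at)
  open Verification n M W 2≤M M^e<W
  open Correctness n M W 2≤M M^e<W 2n²<M n<M (adjacency G)
    _⊏_ ⊏-total ⊏-asym ⊏-forced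

  input-bounded : Bounded (input G)
  input-bounded = bounded
    (λ { zero → <⇒≤ n<M ; (suc _) → z≤n })
    (λ { zero i → ≤-trans (matrixCells≤1 G i) (≤-trans (n≤1+n 1) 2≤M) ; (suc _) _ → z≤n })

  matrix-off-diagonal : ∀ {x y} → x < n → y < n → x ≢ y → matrixCells (Graph.adj G) (n * x + y) ≡ col x y
  matrix-off-diagonal x<n y<n x≢y with as-Fin x<n | as-Fin y<n
  ... | u , refl | v , refl = trans (matrixCells-combine G u v) (sym (col-toℕ G λ { refl → x≢y refl }))

  module _ {L : ℕ → ℕ} (O : Orientation (at L)) {τ : State} where
    open Ranked {L} O
    open Coloured {L} O

    painted⇒optimal : Painted n 0 τ → OutputsOptimalStrongEdgeColouring G τ
    painted⇒optimal (painted g symmetric _) =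
      vars τ 16 , index , ψ , ψ-strong , λ e → trans
        (cong (arrs τ 1) (Fin.toℕ-combine (Edge.lo e) (Edge.hi e))) (sym (toℕ-ψ e))
      where
      open StrongColouring G E R₁ R₂ proj₁ (λ e → proj₂ (proj₂ e)) E-R₂ K₁.rank-injective
        (λ (_ , c , _) → col⇒Adj G c)
        (λ {u} {v} a lt → (Fin.toℕ<n u , Fin.toℕ<n v) , Adj⇒col G a , lt)
        (λ {u} {v} u≢v ¬a lt → K₂.rank-mono (Fin.toℕ<n u) (Fin.toℕ<n v)
          (inj₂ ((λ c → ¬a (col⇒Adj G c)) , K₁.rank-reflects (Fin.toℕ<n u) (Fin.toℕ<n v) lt)))
      open Optimal K₁.rank<n g symmetric

  algorithm-spec : Spec algorithm (input G) (OutputsOptimalStrongEdgeColouring G)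
  algorithm-spec =
    do-seq (weaken (λ {ρ₁} _ (f₁ , ctx₁) →
    do-seq (weaken (λ {ρ₂} _ (f₂ , O) →
      let ctx₂ = context-frame (fv f₂ 0 _) (fa f₂ 0 _) ctx₁ in
    do-seq (weaken (λ {ρ₃} _ (f₃ , rk) →
      weaken (λ _ → painted⇒optimal {arrs ρ₂ 2} O)
        (Coloured.greedy-spec {arrs ρ₂ 2} O (context-frame (fv f₃ 0 _) (fa f₃ 0 _) ctx₂) rk
          (trans (fv f₃ 16 _) (trans (fv f₂ 16 _) (fv f₁ 16 _)))))
      (framed-post (Ranked.ranks-spec {arrs ρ₂ 2} O ctx₂ refl))))
      (framed-post (search-spec ctx₁ (λ i → cong (λ A → A i) (fa f₁ 2 _))
        (fv f₁ 2 _) (fv f₁ 3 _) (fv f₁ 4 _) (fv f₁ 5 _)))))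
      (framed-post (mark-diagonal-spec refl matrix-off-diagonal)))

  correct : ∃₂ λ τ t → Run W (compile algorithm) (input G) τ t ×
    t ≤ time n algorithm × OutputsOptimalStrongEdgeColouring G τ
  correct = final , steps , run , in-time , post
    where open Terminates (algorithm-spec .outcome input-bounded)

theorem6 : ∃ λ (alg : Command) → ∃ λ (d : ℕ) → ∃ λ (time : ℕ → ℕ) →
    (time ∈O (λ n → n ^ 4)) ×
    (∀ (n : ℕ) (G : Graph n) → IsPermutationGraph G →
    ∃₂ λ (τ : State) (t : ℕ) →
    Run (wordBound d n) alg (input G) τ t ×
    t ≤ time n ×
    OutputsOptimalStrongEdgeColouring G τ)
theorem6 = compile algorithm , suc (3 * 100) , (λ n → time n algorithm) ,
  -- `degree algorithm` evaluates to 4, attained by the sweep: rows, columns, and a scan of at most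
  -- n² colours.
  (coefficient algorithm , 1 , λ n 1≤n → time≤ 1≤n algorithm) ,
  λ n G promise → Algorithm.correct G promise (word-parameters n 100)
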